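{- Let $\Delta$ be a finite $(d-1)$-dimensional simplicial complex, $r\geq 1$, and let $\mathcal{C}^r(\Delta)$ be the clique complex of the graph on the set of $r$-multichains $A_1\subseteq\cdots\subseteq A_r$ of nonempty faces of $\Delta$ in which two distinct multichains $\mathfrak{p},\mathfrak{q}$ are adjacent iff $\mathfrak{p}\preceq_I\mathfrak{q}$ or $\mathfrak{q}\preceq_I\mathfrak{p}$, where $\mathfrak{p}\preceq_I\mathfrak{q}$ means $p_t\supseteq q_s$ for all $s\leq t-1$ and $p_t\subseteq q_s$ for all $s\geq t$. Then for $0\leq m\leq d$, $$h_m(\mathcal{C}^r(\Delta))=\sum_{k=0}^{d}A^{(0)}(d+1,k+1,m)\,h_k(\Delta),$$ i.e. $h(\mathcal{C}^r(\Delta))=\mathcal{R}_d\,h(\Delta)$ with transformation matrix given by the numbers $A^{(0)}(d+1,k+1,m)$, $0\le k,m\le d$.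
   Context: The $h$-vector $(h_0,\dots,h_d)$ of a $(d-1)$-dimensional complex $\Gamma$ is defined by $\sum_i h_i t^i=(1-t)^d\sum_{i=0}^d f_{i-1}(\Gamma)(t/(1-t))^i$, where $f_{i-1}$ counts faces with $i$ elements. $A^{(0)}(n,j,m)$ is the number of $r$-colored permutations $\sigma=(\sigma_1^{\epsilon_1},\dots,\sigma_n^{\epsilon_n})$ of $[n]$ (colors $\epsilon_i\in\{0,\dots,r-1\}$) with $\epsilon_1=0$, $\epsilon_n=0$, $\sigma_n=n+1-j$ and $\mathrm{des}(\sigma)=m$; here, with $\sigma_{n+1}:=n+1$, $\epsilon_{n+1}:=0$, $\mathrm{des}(\sigma)$ is the number of $1\le i\le n$ with $\epsilon_i>\epsilon_{i+1}$, or $\epsilon_i=\epsilon_{i+1}$ and $\sigma_i>\sigma_{i+1}$. -}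

module Defs where

open import Data.Bool using (Bool; true; false; _∧_; _∨_; not; if_then_else_)
open import Data.Nat using (ℕ; zero; suc; _+_; _*_; _≤_; _<_; _⊔_)
import Data.Nat as ℕ
open import Data.Integer as ℤ using (ℤ; +_; -[1+_])
open import Data.List using (List; []; _∷_; _++_; map; filter; length; concatMap; foldr; upTo; applyUpTo; lookup)
open import Data.Vec using (Vec; []; _∷_; toList)
import Data.Vec.Properties as VecP
import Data.Bool.Properties as BoolP
open import Data.Fin using (Fin)
open import Data.Fin.Subset using (Subset; _⊆_; ∣_∣; ⊥; Nonempty; inside; outside)
open import Data.Fin.Subset.Properties using (_⊆?_)
open import Data.Product using (_×_; _,_; proj₁; proj₂; ∃)
open import Relation.Nullary.Decidable using (⌊_⌋)
open import Relation.Binary.PropositionalEquality using (_≡_)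

count : {A : Set} → (A → Bool) → List A → ℕ
count p xs = length (filter (λ x → p x Data.Bool.≟ true) xs)
  where import Data.Bool

tuples : {A : Set} → List A → (r : ℕ) → List (Vec A r)
tuples xs zero    = [] ∷ []
tuples xs (suc r) = concatMap (λ x → map (x ∷_) (tuples xs r)) xs

sublists : {A : Set} → List A → List (List A)
sublists []       = [] ∷ []
sublists (x ∷ xs) = let s = sublists xs in s ++ map (x ∷_) s

allPairsB : {A : Set} → (A → A → Bool) → List A → Bool
allPairsB R []       = true
allPairsB R (x ∷ xs) = foldr (λ y b → R x y ∧ b) true xs ∧ allPairsB R xs

anyB : {A : Set} → (A → Bool) → List A → Bool
anyB p = foldr (λ x b → p x ∨ b) false

allB : {A : Set} → (A → Bool) → List A → Bool
allB p = foldr (λ x b → p x ∧ b) true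

maxLength : {A : Set} → List (List A) → ℕ
maxLength = foldr (λ xs m → length xs ⊔ m) 0

-- Polynomials with integer coefficients as coefficient lists (constant first)

Poly : Set
Poly = List ℤ

_⊕_ : Poly → Poly → Poly
[]       ⊕ q        = q
p        ⊕ []       = p
(a ∷ p)  ⊕ (b ∷ q)  = (a ℤ.+ b) ∷ (p ⊕ q)

scale : ℤ → Poly → Poly
scale c = map (c ℤ.*_)

_⊗_ : Poly → Poly → Poly
[]      ⊗ q = []
(a ∷ p) ⊗ q = scale a q ⊕ (+ 0 ∷ (p ⊗ q))

_^ₚ_ : Poly → ℕ → Poly
p ^ₚ zero  = + 1 ∷ []
p ^ₚ suc k = p ⊗ (p ^ₚ k)

tPoly : Poly
tPoly = + 0 ∷ + 1 ∷ []

oneMinusT : Poly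
oneMinusT = + 1 ∷ ℤ.- (+ 1) ∷ []

coeff : Poly → ℕ → ℤ
coeff []      _       = + 0
coeff (a ∷ p) zero    = a
coeff (a ∷ p) (suc k) = coeff p k

sumTo : {A : Set} → (A → A → A) → A → ℕ → (ℕ → A) → A
sumTo _+'_ z zero    g = g 0
sumTo _+'_ z (suc d) g = sumTo _+'_ z d g +' g (suc d)

-- h-vector of a (d-1)-dimensional complex with face numbers f i = f_{i-1}:
--   Σ_k h_k t^k = (1-t)^d Σ_{i=0}^d f_{i-1} (t/(1-t))^i
--              = Σ_{i=0}^d f_{i-1} t^i (1-t)^(d-i)
hPoly : (f : ℕ → ℕ) → (d : ℕ) → Poly
hPoly f d = sumTo _⊕_ [] d (λ i → scale (+ f i) ((tPoly ^ₚ i) ⊗ (oneMinusT ^ₚ (d ℕ.∸ i))))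

hVec : (f : ℕ → ℕ) → (d : ℕ) → ℕ → ℤ
hVec f d k = coeff (hPoly f d) k

allSubsets : (n : ℕ) → List (Subset n)
allSubsets n = tuples (inside ∷ outside ∷ []) n

record IsSimplicialComplex {n : ℕ} (Δ : Subset n → Bool) : Set where
  field
    hasEmpty    : Δ ⊥ ≡ true
    downClosed  : ∀ S T → T ⊆ S → Δ S ≡ true → Δ T ≡ true

-- Δ is (d-1)-dimensional: largest face has exactly d elements
record HasDim {n : ℕ} (Δ : Subset n → Bool) (d : ℕ) : Set where
  field
    faceOfSize  : ∃ λ S → Δ S ≡ true × ∣ S ∣ ≡ d
    facesBound  : ∀ S → Δ S ≡ true → ∣ S ∣ ≤ d

-- f_{i-1}(Δ): number of faces with i elements
fΔ : {n : ℕ} → (Subset n → Bool) → ℕ → ℕ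
fΔ {n} Δ i = count (λ S → Δ S ∧ ⌊ ∣ S ∣ ℕ.≟ i ⌋) (allSubsets n)

eqSub : {n : ℕ} → Subset n → Subset n → Bool
eqSub S T = ⌊ VecP.≡-dec BoolP._≟_ S T ⌋

subB : {n : ℕ} → Subset n → Subset n → Bool
subB S T = ⌊ S ⊆? T ⌋

nonemptyB : {n : ℕ} → Subset n → Bool
nonemptyB S = not ⌊ ∣ S ∣ ℕ.≟ 0 ⌋

MultiChain : ℕ → ℕ → Set
MultiChain n r = Vec (Subset n) r

isChainB : {n r : ℕ} → MultiChain n r → Bool
isChainB []           = true
isChainB (A ∷ [])     = true
isChainB (A ∷ B ∷ As) = subB A B ∧ isChainB (B ∷ As)

-- all r-multichains of nonempty faces of Δ (duplicate free list)
multichains : {n : ℕ} → (Subset n → Bool) → (r : ℕ) → List (MultiChain n r)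
multichains {n} Δ r =
  filter (λ p → isChainB p Data.Bool.≟ true)
    (tuples (filter (λ S → (Δ S ∧ nonemptyB S) Data.Bool.≟ true) (allSubsets n)) r)
  where import Data.Bool

eqMC : {n r : ℕ} → MultiChain n r → MultiChain n r → Bool
eqMC p q = ⌊ VecP.≡-dec (VecP.≡-dec BoolP._≟_) p q ⌋

precI : {n r : ℕ} → MultiChain n r → MultiChain n r → Bool
precI {n} {r} p q =
  allB (λ t → allB (λ s →
      if ⌊ s F.<? t ⌋
        then subB (Data.Vec.lookup q s) (Data.Vec.lookup p t)
        else subB (Data.Vec.lookup p t) (Data.Vec.lookup q s))
    (Data.List.allFin r)) (Data.List.allFin r)
  where import Data.Vec
        import Data.List
        import Data.Fin as F

adjacent : {n r : ℕ} → MultiChain n r → MultiChain n r → Bool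
adjacent p q = not (eqMC p q) ∧ (precI p q ∨ precI q p)

faces-C : {n : ℕ} → (Subset n → Bool) → (r : ℕ) → List (List (MultiChain n r))
faces-C Δ r = filter (λ c → allPairsB adjacent c Data.Bool.≟ true) (sublists (multichains Δ r))
  where import Data.Bool

fC : {n : ℕ} → (Subset n → Bool) → ℕ → ℕ → ℕ
fC Δ r i = count (λ c → ⌊ length c ℕ.≟ i ⌋) (faces-C Δ r)

dimC+1 : {n : ℕ} → (Subset n → Bool) → ℕ → ℕ
dimC+1 Δ r = maxLength (faces-C Δ r)

hC : {n : ℕ} → (Subset n → Bool) → ℕ → ℕ → ℤ
hC Δ r m = hVec (fC Δ r) (dimC+1 Δ r) m

hΔ : {n : ℕ} → (Subset n → Bool) → (d : ℕ) → ℕ → ℤ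
hΔ Δ d k = hVec (fΔ Δ) d k

distinctB : List ℕ → Bool
distinctB []       = true
distinctB (x ∷ xs) = allB (λ y → not ⌊ x ℕ.≟ y ⌋) xs ∧ distinctB xs

permutations : ℕ → List (List ℕ)
permutations n = filter (λ w → distinctB w Data.Bool.≟ true)
                   (map toList (tuples (applyUpTo suc n) n))
  where import Data.Bool

colorings : (r n : ℕ) → List (List ℕ)
colorings r n = map toList (tuples (upTo r) n)

descB : (ℕ × ℕ) → (ℕ × ℕ) → Bool
descB (a , ea) (b , eb) = ⌊ eb ℕ.<? ea ⌋ ∨ (⌊ ea ℕ.≟ eb ⌋ ∧ ⌊ b ℕ.<? a ⌋)

countDesc : List (ℕ × ℕ) → ℕ
countDesc []            = 0
countDesc (x ∷ [])      = 0
countDesc (x ∷ y ∷ xs)  = (if descB x y then 1 else 0) + countDesc (y ∷ xs)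

zipL : List ℕ → List ℕ → List (ℕ × ℕ)
zipL (a ∷ as) (b ∷ bs) = (a , b) ∷ zipL as bs
zipL _        _        = []

-- des(σ) with the convention σ_{n+1} = n+1, ε_{n+1} = 0
des : (n : ℕ) → List ℕ → List ℕ → ℕ
des n σ ε = countDesc (zipL σ ε ++ ((suc n , 0) ∷ []))

headIs0 : List ℕ → Bool
headIs0 []      = false
headIs0 (e ∷ _) = ⌊ e ℕ.≟ 0 ⌋

lastOr : ℕ → List ℕ → ℕ
lastOr z []       = z
lastOr z (x ∷ xs) = lastOr x xs

lastIs : ℕ → List ℕ → Bool
lastIs v []       = false
lastIs v (x ∷ xs) = ⌊ lastOr x xs ℕ.≟ v ⌋

A0 : (r n j m : ℕ) → ℕ
A0 r n j m =
  length (filter (λ pe → (headIs0 (proj₂ pe) ∧ lastIs 0 (proj₂ pe)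
                          ∧ lastIs (suc n ℕ.∸ j) (proj₁ pe)
                          ∧ ⌊ des n (proj₁ pe) (proj₂ pe) ℕ.≟ m ⌋) Data.Bool.≟ true)
     (concatMap (λ σ → map (σ ,_) (colorings r n)) (permutations n)))
  where import Data.Bool

{-# OPTIONS --safe #-}
module Submission where

-- Multiply power series by t (E) and by 1 − t (D). The h-polynomial of a complex of dimension d − 1 is Dᵈ of its
-- Hilbert function Σ_k f_{k−1} (t / (1 − t))ᵏ. For 𝒞ʳ(Δ) the coefficient of tˡ counts the weakly increasing
-- l-tuples of multichains; such a tuple, read column by column, is a multichain of N = rl nonempty faces, and a
-- face S ends Nˢ − (N − 1)ˢ of those, s = ∣S∣. Hence this coefficient is F(N) − F(N − 1) with F(x) = Σ_i f_{i−1}(Δ) xⁱ,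
-- and F(x) = Σ_k h_k(Δ) xᵏ (x + 1)ᵈ⁻ᵏ. It remains to see that Σ_m A⁽⁰⁾(d + 1, k + 1, m) tᵐ is Dᵈ of the sequence
-- l ↦ Q(rl) − Q(rl − 1), Q(x) = xᵏ (x + 1)ᵈ⁻ᵏ. More generally, for words ending in a letter of rank v and colour c
-- one gets l ↦ Q(rl + c) − Q(rl + c − 1), Q(x) = xᵈ⁻ᵛ (x + 1)ᵛ, by induction on the length, removing the last letter;
-- here Q(−1) and F(−1) are read as 0, in keeping with D.

open import Defs
open import Data.Bool using (Bool; true; false; _∧_; _∨_; not; if_then_else_)
import Data.Bool as Bool
import Data.Bool.Properties as BoolP
open import Data.Nat using (ℕ; zero; suc; _≤_; _<_; z≤n; s≤s)
import Data.Nat as ℕ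
import Data.Nat.Properties as ℕP
open import Data.Integer using (ℤ; +_; _+_; _*_; _-_; -_; _^_)
import Data.Integer.Properties as ℤP
open import Data.Integer.Tactic.RingSolver using (solve-∀)
open import Data.List using (List; []; _∷_; _++_; map; filter; length; concatMap; upTo; applyUpTo; allFin)
open import Data.List.Properties using (filter-all; filter-none; length-applyUpTo; length-filter; length-map)
open import Data.List.Membership.Propositional using (_∈_)
open import Data.List.Membership.Propositional.Properties using (∈-applyUpTo⁺; ∈-++⁺ˡ; ∈-++⁺ʳ; ∈-map⁺; ∈-filter⁺; ∈-concatMap⁺)
open import Data.List.Relation.Unary.Any as Any using (Any; here; there)
open import Data.List.Relation.Unary.All as All using (All; []; _∷_)
import Data.List.Relation.Unary.All.Properties as AllP
open import Data.List.Relation.Unary.AllPairs as AllPairs using (AllPairs; []; _∷_)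
import Data.List.Relation.Unary.AllPairs.Properties as AllPairsP
open import Data.Vec as Vec using (Vec; []; _∷_; toList; _∷ʳ_)
open import Data.Product using (_×_; _,_; proj₁; proj₂; ∃)
open import Data.Unit using (⊤; tt)
import Data.Vec.Relation.Unary.All.Properties as VAllP
open import Data.Vec.Relation.Unary.All as VAll using ([]; _∷_) renaming (All to VAll)
open import Data.Fin as F using (Fin)
open import Data.Fin.Subset using (Subset; _⊆_; ∣_∣; ⊥; inside; outside)
import Data.Fin.Subset.Properties as SubsetP
open import Data.Fin.Subset.Properties using (_⊆?_)
import Data.Vec.Properties as VecP
open import Data.Vec.Relation.Binary.Pointwise.Inductive using (Pointwise; []; _∷_)
open import Data.Sum using (_⊎_; inj₁; inj₂)
open import Function using (_∘_; id)
open import Relation.Nullary using (Dec; yes; no; ¬_; contradiction)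
open import Relation.Nullary.Decidable using (⌊_⌋)
open import Relation.Binary.PropositionalEquality using (_≡_; _≢_; refl; sym; trans; cong; cong₂; subst; _≗_; module ≡-Reasoning)
open ≡-Reasoning

-- The relation `precI` is not transitive: from `p ≼ q` and `q ≼ z` the inclusions of entries of `z`
-- in later entries of `p` do not follow. A clique is therefore more than a sequence of consecutive
-- comparisons, and weakly increasing tuples are tested on all pairs. What consecutive pairs would
-- miss, the inclusion of the last row's entry in one column in the first row's entry in the next,
-- is exactly what joins the columns into a single multichain. `A0` fixes the last colour to be 0,
-- but the letter before the last one may have any colour, so the induction on words needs all of
-- them. The numbers rl + c with 0 ≤ c < r are the natural numbers, each once: the colour is the
-- remainder of the argument modulo r, and adding over the colours of a removed letter gives sums
-- over blocks of r consecutive arguments. The condition that the first colour is 0 decides the case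
-- of a single letter. Chains are first built upwards, but the number of chains above a face depends
-- on the whole complex; below a face there is a full Boolean lattice, and this is why they are
-- counted by the face at their upper end.

private variable
  A B : Set

-- Indicators and finite sums

⟦_⟧ : Bool → ℤ
⟦ b ⟧ = if b then + 1 else + 0

⟦∧⟧ : ∀ b c → ⟦ b ∧ c ⟧ ≡ ⟦ b ⟧ * ⟦ c ⟧
⟦∧⟧ true  c = sym (ℤP.*-identityˡ ⟦ c ⟧)
⟦∧⟧ false c = sym (ℤP.*-zeroˡ ⟦ c ⟧)

≡true-ext : ∀ {b c} → (b ≡ true → c ≡ true) → (c ≡ true → b ≡ true) → b ≡ c
≡true-ext {true}  {c}     f g = sym (f refl)
≡true-ext {false} {false} f g = refl
≡true-ext {false} {true}  f g = g refl

select : (A → Bool) → List A → List A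
select p = filter (λ x → p x Bool.≟ true)

∑ : List A → (A → ℤ) → ℤ
∑ []       f = + 0
∑ (x ∷ xs) f = f x + ∑ xs f

∑-cong : (xs : List A) {f g : A → ℤ} → f ≗ g → ∑ xs f ≡ ∑ xs g
∑-cong []       e = refl
∑-cong (x ∷ xs) e = cong₂ _+_ (e x) (∑-cong xs e)

∑-cong-All : {P : A → Set} {xs : List A} {f g : A → ℤ} → All P xs → (∀ x → P x → f x ≡ g x) → ∑ xs f ≡ ∑ xs g
∑-cong-All []         e = refl
∑-cong-All (px ∷ pxs) e = cong₂ _+_ (e _ px) (∑-cong-All pxs e)

∑-zero : (xs : List A) → ∑ xs (λ _ → + 0) ≡ + 0
∑-zero []       = refl
∑-zero (x ∷ xs) = trans (ℤP.+-identityˡ _) (∑-zero xs)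

∑-+ : (xs : List A) (f g : A → ℤ) → ∑ xs (λ x → f x + g x) ≡ ∑ xs f + ∑ xs g
∑-+ []       f g = refl
∑-+ (x ∷ xs) f g = trans (cong (_+_ (f x + g x)) (∑-+ xs f g)) (interchange (f x) (g x) _ _)
  where
  interchange : ∀ a b c d → a + b + (c + d) ≡ a + c + (b + d)
  interchange = solve-∀

∑-*ˡ : (c : ℤ) (xs : List A) (f : A → ℤ) → ∑ xs (λ x → c * f x) ≡ c * ∑ xs f
∑-*ˡ c []       f = sym (ℤP.*-zeroʳ c)
∑-*ˡ c (x ∷ xs) f = trans (cong (_+_ (c * f x)) (∑-*ˡ c xs f)) (sym (ℤP.*-distribˡ-+ c _ _))

∑-*ʳ : (c : ℤ) (xs : List A) (f : A → ℤ) → ∑ xs (λ x → f x * c) ≡ ∑ xs f * c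
∑-*ʳ c xs f = trans (∑-cong xs (λ x → ℤP.*-comm (f x) c)) (trans (∑-*ˡ c xs f) (ℤP.*-comm c _))

∑-++ : (xs ys : List A) (f : A → ℤ) → ∑ (xs ++ ys) f ≡ ∑ xs f + ∑ ys f
∑-++ []       ys f = sym (ℤP.+-identityˡ _)
∑-++ (x ∷ xs) ys f = trans (cong (_+_ (f x)) (∑-++ xs ys f)) (sym (ℤP.+-assoc (f x) _ _))

∑-map : (h : A → B) (xs : List A) (f : B → ℤ) → ∑ (map h xs) f ≡ ∑ xs (f ∘ h)
∑-map h []       f = refl
∑-map h (x ∷ xs) f = cong (_+_ (f (h x))) (∑-map h xs f)

∑-concatMap : (h : A → List B) (xs : List A) (f : B → ℤ) → ∑ (concatMap h xs) f ≡ ∑ xs (λ x → ∑ (h x) f)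
∑-concatMap h []       f = refl
∑-concatMap h (x ∷ xs) f = trans (∑-++ (h x) _ f) (cong (_+_ (∑ (h x) f)) (∑-concatMap h xs f))

∑-swap : (xs : List A) (ys : List B) (f : A → B → ℤ) → ∑ xs (λ x → ∑ ys (f x)) ≡ ∑ ys (λ y → ∑ xs (λ x → f x y))
∑-swap []       ys f = sym (∑-zero ys)
∑-swap (x ∷ xs) ys f = trans (cong (_+_ (∑ ys (f x))) (∑-swap xs ys f)) (sym (∑-+ ys (f x) _))

∑-select : (p : A → Bool) (xs : List A) (f : A → ℤ) → ∑ (select p xs) f ≡ ∑ xs (λ x → ⟦ p x ⟧ * f x)
∑-select p []       f = refl
∑-select p (x ∷ xs) f with p x
... | true  = cong₂ _+_ (sym (ℤP.*-identityˡ (f x))) (∑-select p xs f)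
... | false = sym (trans (cong₂ _+_ (ℤP.*-zeroˡ (f x)) (sym (∑-select p xs f))) (ℤP.+-identityˡ _))

length-select : (p : A → Bool) (xs : List A) → + length (select p xs) ≡ ∑ xs (λ x → ⟦ p x ⟧)
length-select p []       = refl
length-select p (x ∷ xs) with p x
... | true  = trans (ℤP.pos-+ 1 _) (cong (_+_ (+ 1)) (length-select p xs))
... | false = trans (length-select p xs) (sym (ℤP.+-identityˡ _))

∑-tuples-suc : (xs : List A) (n : ℕ) (f : Vec A (suc n) → ℤ) →
  ∑ (tuples xs (suc n)) f ≡ ∑ xs (λ x → ∑ (tuples xs n) (λ w → f (x ∷ w)))
∑-tuples-suc xs n f = trans (∑-concatMap _ xs f) (∑-cong xs λ x → ∑-map (x ∷_) (tuples xs n) f)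

-- `tuples` builds vectors from the front, whereas words have to be taken apart from the back, where
-- the letter and the colour are prescribed.
∑-tuples-∷ʳ : (xs : List A) (n : ℕ) (f : Vec A (suc n) → ℤ) →
  ∑ (tuples xs (suc n)) f ≡ ∑ xs (λ x → ∑ (tuples xs n) (λ w → f (w ∷ʳ x)))
∑-tuples-∷ʳ xs zero    f = ∑-tuples-suc xs zero f
∑-tuples-∷ʳ xs (suc n) f = begin
  ∑ (tuples xs (suc (suc n))) f
    ≡⟨ ∑-tuples-suc xs (suc n) f ⟩
  ∑ xs (λ x → ∑ (tuples xs (suc n)) (λ w → f (x ∷ w)))
    ≡⟨ ∑-cong xs (λ x → ∑-tuples-∷ʳ xs n (λ w → f (x ∷ w))) ⟩
  ∑ xs (λ x → ∑ xs (λ y → ∑ (tuples xs n) (λ w → f (x ∷ (w ∷ʳ y)))))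
    ≡⟨ ∑-swap xs xs _ ⟩
  ∑ xs (λ y → ∑ xs (λ x → ∑ (tuples xs n) (λ w → f (x ∷ (w ∷ʳ y)))))
    ≡⟨ ∑-cong xs (λ y → sym (∑-tuples-suc xs n (λ w → f (w ∷ʳ y)))) ⟩
  ∑ xs (λ y → ∑ (tuples xs (suc n)) (λ w → f (w ∷ʳ y))) ∎

∑-tuples-select : (p : A → Bool) (xs : List A) (n : ℕ) (f : Vec A n → ℤ) →
  ∑ (tuples (select p xs) n) f ≡ ∑ (tuples xs n) (λ w → ⟦ allB p (toList w) ⟧ * f w)
∑-tuples-select p xs zero    f = cong (_+ + 0) (sym (ℤP.*-identityˡ (f [])))
∑-tuples-select p xs (suc n) f = begin
  ∑ (tuples (select p xs) (suc n)) f
    ≡⟨ ∑-tuples-suc (select p xs) n f ⟩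
  ∑ (select p xs) (λ x → ∑ (tuples (select p xs) n) (λ w → f (x ∷ w)))
    ≡⟨ ∑-select p xs _ ⟩
  ∑ xs (λ x → ⟦ p x ⟧ * ∑ (tuples (select p xs) n) (λ w → f (x ∷ w)))
    ≡⟨ ∑-cong xs (λ x → cong (⟦ p x ⟧ *_) (∑-tuples-select p xs n _)) ⟩
  ∑ xs (λ x → ⟦ p x ⟧ * ∑ (tuples xs n) (λ w → ⟦ allB p (toList w) ⟧ * f (x ∷ w)))
    ≡⟨ ∑-cong xs (λ x → sym (∑-*ˡ ⟦ p x ⟧ (tuples xs n) _)) ⟩
  ∑ xs (λ x → ∑ (tuples xs n) (λ w → ⟦ p x ⟧ * (⟦ allB p (toList w) ⟧ * f (x ∷ w))))
    ≡⟨ ∑-cong xs (λ x → ∑-cong (tuples xs n) (λ w → sym (trans (cong (_* f (x ∷ w)) (⟦∧⟧ (p x) _)) (ℤP.*-assoc ⟦ p x ⟧ _ _)))) ⟩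
  ∑ xs (λ x → ∑ (tuples xs n) (λ w → ⟦ p x ∧ allB p (toList w) ⟧ * f (x ∷ w)))
    ≡⟨ sym (∑-tuples-suc xs n _) ⟩
  ∑ (tuples xs (suc n)) (λ w → ⟦ allB p (toList w) ⟧ * f w) ∎

∑< : ℕ → (ℕ → ℤ) → ℤ
∑< zero    f = + 0
∑< (suc n) f = ∑< n f + f n

syntax ∑< n (λ i → e) = ∑[ i < n ] e

∑<-cong-< : ∀ n {f g : ℕ → ℤ} → (∀ i → i < n → f i ≡ g i) → ∑< n f ≡ ∑< n g
∑<-cong-< zero    e = refl
∑<-cong-< (suc n) e = cong₂ _+_ (∑<-cong-< n (λ i i<n → e i (ℕP.m<n⇒m<1+n i<n))) (e n ℕP.≤-refl)

∑<-cong : ∀ n {f g : ℕ → ℤ} → f ≗ g → ∑< n f ≡ ∑< n g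
∑<-cong n e = ∑<-cong-< n (λ i _ → e i)

∑<-zero : ∀ n → ∑< n (λ _ → + 0) ≡ + 0
∑<-zero zero    = refl
∑<-zero (suc n) = trans (ℤP.+-identityʳ _) (∑<-zero n)

∑<-+ : ∀ n (f g : ℕ → ℤ) → ∑[ i < n ] (f i + g i) ≡ ∑< n f + ∑< n g
∑<-+ zero    f g = refl
∑<-+ (suc n) f g = trans (cong (_+ (f n + g n)) (∑<-+ n f g)) (interchange (∑< n f) (∑< n g) (f n) (g n))
  where
  interchange : ∀ a b c d → a + b + (c + d) ≡ a + c + (b + d)
  interchange = solve-∀

∑<-*ˡ : ∀ c n (f : ℕ → ℤ) → ∑[ i < n ] (c * f i) ≡ c * ∑< n f
∑<-*ˡ c zero    f = sym (ℤP.*-zeroʳ c)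
∑<-*ˡ c (suc n) f = trans (cong (_+ c * f n) (∑<-*ˡ c n f)) (sym (ℤP.*-distribˡ-+ c _ _))

∑<-*ʳ : ∀ c n (f : ℕ → ℤ) → ∑[ i < n ] (f i * c) ≡ ∑< n f * c
∑<-*ʳ c n f = trans (∑<-cong n (λ i → ℤP.*-comm (f i) c)) (trans (∑<-*ˡ c n f) (ℤP.*-comm c _))

∑<-minus : ∀ n (f g : ℕ → ℤ) → ∑[ i < n ] (f i - g i) ≡ ∑< n f - ∑< n g
∑<-minus zero    f g = refl
∑<-minus (suc n) f g = trans (cong (_+ (f n - g n)) (∑<-minus n f g)) (interchange (∑< n f) (∑< n g) (f n) (g n))
  where
  interchange : ∀ a b c d → a - b + (c - d) ≡ a + c - (b + d)
  interchange = solve-∀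

∑<-head : ∀ n (f : ℕ → ℤ) → ∑< (suc n) f ≡ f 0 + ∑< n (f ∘ suc)
∑<-head zero    f = ℤP.+-comm (+ 0) (f 0)
∑<-head (suc n) f = trans (cong (_+ f (suc n)) (∑<-head n f)) (ℤP.+-assoc (f 0) _ _)

∑<-split : ∀ m n (f : ℕ → ℤ) → ∑< (m ℕ.+ n) f ≡ ∑< m f + ∑[ i < n ] f (m ℕ.+ i)
∑<-split zero    n f = sym (ℤP.+-identityˡ _)
∑<-split (suc m) n f = begin
  ∑< (suc (m ℕ.+ n)) f                                        ≡⟨ ∑<-head (m ℕ.+ n) f ⟩
  f 0 + ∑< (m ℕ.+ n) (f ∘ suc)                                ≡⟨ cong (_+_ (f 0)) (∑<-split m n (f ∘ suc)) ⟩
  f 0 + (∑< m (f ∘ suc) + ∑[ i < n ] f (suc m ℕ.+ i))         ≡⟨ sym (ℤP.+-assoc (f 0) _ _) ⟩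
  f 0 + ∑< m (f ∘ suc) + ∑[ i < n ] f (suc m ℕ.+ i)           ≡⟨ cong₂ _+_ (sym (∑<-head m f)) refl ⟩
  ∑< (suc m) f + ∑[ i < n ] f (suc m ℕ.+ i)                   ∎

∑-∑< : (xs : List A) (n : ℕ) (f : A → ℕ → ℤ) → ∑ xs (λ x → ∑< n (f x)) ≡ ∑[ i < n ] ∑ xs (λ x → f x i)
∑-∑< xs zero    f = ∑-zero xs
∑-∑< xs (suc n) f = trans (∑-+ xs (λ x → ∑< n (f x)) (λ x → f x n)) (cong₂ _+_ (∑-∑< xs n f) refl)

∑<-swap : ∀ m n (f : ℕ → ℕ → ℤ) → ∑[ i < m ] ∑[ j < n ] f i j ≡ ∑[ j < n ] ∑[ i < m ] f i j
∑<-swap m zero    f = ∑<-zero m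
∑<-swap m (suc n) f = trans (∑<-+ m (λ i → ∑< n (f i)) (λ i → f i n)) (cong₂ _+_ (∑<-swap m n f) refl)

∑-applyUpTo : (h : ℕ → A) (n : ℕ) (f : A → ℤ) → ∑ (applyUpTo h n) f ≡ ∑< n (f ∘ h)
∑-applyUpTo h zero    f = refl
∑-applyUpTo h (suc n) f = trans (cong (_+_ (f (h 0))) (∑-applyUpTo (h ∘ suc) n f)) (sym (∑<-head n (f ∘ h)))

∑<-indicator : ∀ n k (f : ℕ → ℤ) → k < n → ∑[ i < n ] (⟦ ⌊ k ℕ.≟ i ⌋ ⟧ * f i) ≡ f k
∑<-indicator n k f k<n = go n k<n
  where
  miss : ∀ j → j ≤ k → ∑[ i < j ] (⟦ ⌊ k ℕ.≟ i ⌋ ⟧ * f i) ≡ + 0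
  miss j j≤k = trans (∑<-cong-< j λ i i<j → off i (ℕP.<-≤-trans i<j j≤k)) (∑<-zero j)
    where
    off : ∀ i → i < k → ⟦ ⌊ k ℕ.≟ i ⌋ ⟧ * f i ≡ + 0
    off i i<k with k ℕ.≟ i
    ... | yes refl = contradiction i<k (ℕP.<-irrefl refl)
    ... | no _     = ℤP.*-zeroˡ (f i)
  go : ∀ n → k < n → ∑[ i < n ] (⟦ ⌊ k ℕ.≟ i ⌋ ⟧ * f i) ≡ f k
  go (suc n) k<1+n with k ℕ.≟ n
  ... | yes refl = trans (cong₂ _+_ (miss n ℕP.≤-refl) (ℤP.*-identityˡ (f k))) (ℤP.+-identityˡ (f k))
  ... | no  k≢n  = trans (cong₂ _+_ (go n (ℕP.≤∧≢⇒< (ℕ.s≤s⁻¹ k<1+n) k≢n)) (ℤP.*-zeroˡ (f n))) (ℤP.+-identityʳ (f k))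

sumTo≡∑< : ∀ d (g : ℕ → ℤ) → sumTo _+_ (+ 0) d g ≡ ∑< (suc d) g
sumTo≡∑< zero    g = sym (ℤP.+-identityˡ (g 0))
sumTo≡∑< (suc d) g = cong (_+ g (suc d)) (sumTo≡∑< d g)

-- A sequence stands for the formal power series with these coefficients: E multiplies by t and D by 1 − t.

Seq : Set
Seq = ℕ → ℤ

E : Seq → Seq
E f zero    = + 0
E f (suc ℓ) = f ℓ

D : Seq → Seq
D f ℓ = f ℓ - E f ℓ

D^ : ℕ → Seq → Seq
D^ zero    f = f
D^ (suc n) f = D (D^ n f)

E^ : ℕ → Seq → Seq
E^ zero    f = f
E^ (suc n) f = E (E^ n f)

δ : Seq
δ zero    = + 1
δ (suc _) = + 0

E-cong : ∀ {f g} → f ≗ g → E f ≗ E g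
E-cong e zero    = refl
E-cong e (suc ℓ) = e ℓ

D-cong : ∀ {f g} → f ≗ g → D f ≗ D g
D-cong e ℓ = cong₂ _-_ (e ℓ) (E-cong e ℓ)

D^-cong : ∀ n {f g} → f ≗ g → D^ n f ≗ D^ n g
D^-cong zero    e = e
D^-cong (suc n) e = D-cong (D^-cong n e)

E^-cong : ∀ n {f g} → f ≗ g → E^ n f ≗ E^ n g
E^-cong zero    e = e
E^-cong (suc n) e = E-cong (E^-cong n e)

E-* : ∀ c f → E (λ ℓ → c * f ℓ) ≗ λ ℓ → c * E f ℓ
E-* c f zero    = sym (ℤP.*-zeroʳ c)
E-* c f (suc ℓ) = refl

D-* : ∀ c f → D (λ ℓ → c * f ℓ) ≗ λ ℓ → c * D f ℓ
D-* c f ℓ = trans (cong (_-_ (c * f ℓ)) (E-* c f ℓ)) (factor c (f ℓ) (E f ℓ))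
  where
  factor : ∀ a b e → a * b - a * e ≡ a * (b - e)
  factor = solve-∀

D^-* : ∀ n c f → D^ n (λ ℓ → c * f ℓ) ≗ λ ℓ → c * D^ n f ℓ
D^-* zero    c f ℓ = refl
D^-* (suc n) c f ℓ = trans (D-cong (D^-* n c f) ℓ) (D-* c (D^ n f) ℓ)

E-∑< : ∀ k (F : ℕ → Seq) → E (λ ℓ → ∑[ i < k ] F i ℓ) ≗ λ ℓ → ∑[ i < k ] E (F i) ℓ
E-∑< k F zero    = sym (∑<-zero k)
E-∑< k F (suc ℓ) = refl

E-∑ : (xs : List A) (F : A → Seq) → E (λ ℓ → ∑ xs (λ x → F x ℓ)) ≗ λ ℓ → ∑ xs (λ x → E (F x) ℓ)
E-∑ xs F zero    = sym (∑-zero xs)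
E-∑ xs F (suc ℓ) = refl

D-∑< : ∀ k (F : ℕ → Seq) → D (λ ℓ → ∑[ i < k ] F i ℓ) ≗ λ ℓ → ∑[ i < k ] D (F i) ℓ
D-∑< k F ℓ = trans (cong (_-_ (∑[ i < k ] F i ℓ)) (E-∑< k F ℓ)) (sym (∑<-minus k (λ i → F i ℓ) (λ i → E (F i) ℓ)))

D^-∑< : ∀ n k (F : ℕ → Seq) → D^ n (λ ℓ → ∑[ i < k ] F i ℓ) ≗ λ ℓ → ∑[ i < k ] D^ n (F i) ℓ
D^-∑< zero    k F ℓ = refl
D^-∑< (suc n) k F ℓ = trans (D-cong (D^-∑< n k F) ℓ) (D-∑< k (λ i → D^ n (F i)) ℓ)

E-D : ∀ f → E (D f) ≗ D (E f)
E-D f zero    = refl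
E-D f (suc ℓ) = refl

E-D^ : ∀ n f → E (D^ n f) ≗ D^ n (E f)
E-D^ zero    f ℓ = refl
E-D^ (suc n) f ℓ = trans (E-D (D^ n f) ℓ) (D-cong (E-D^ n f) ℓ)

D^-suc : ∀ n f → D^ (suc n) f ≗ D^ n (D f)
D^-suc zero    f ℓ = refl
D^-suc (suc n) f ℓ = D-cong (D^-suc n f) ℓ

-- The sum telescopes, starting from the 0 that `E` places before the first term; here the
-- convention that sequences vanish at -1 pays off.
∑<-D : ∀ f N → ∑< N (D f) ≡ E f N
∑<-D f zero    = refl
∑<-D f (suc N) = trans (cong (_+ D f N) (∑<-D f N)) (cancel (E f N) (f N))
  where
  cancel : ∀ a b → a + (b - a) ≡ b
  cancel = solve-∀

-- Partial sums that exclude the last index multiply a series by t / (1 - t), so a factor 1 - t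
-- leaves t.
D-∑ : ∀ (f : Seq) → D (λ N → ∑< N f) ≗ E f
D-∑ f zero    = refl
D-∑ f (suc N) = cancel (∑< N f) (f N)
  where
  cancel : ∀ a b → a + b - a ≡ b
  cancel = solve-∀

⌊⌋-ext : ∀ {P Q : Set} (p? : Dec P) (q? : Dec Q) → (P → Q) → (Q → P) → ⌊ p? ⌋ ≡ ⌊ q? ⌋
⌊⌋-ext (yes p) (yes q) f g = refl
⌊⌋-ext (yes p) (no ¬q) f g = contradiction (f p) ¬q
⌊⌋-ext (no ¬p) (yes q) f g = contradiction (g q) ¬p
⌊⌋-ext (no ¬p) (no ¬q) f g = refl

⌊⌋-yes : ∀ {P : Set} (p? : Dec P) → P → ⌊ p? ⌋ ≡ true
⌊⌋-yes (yes _) p = refl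
⌊⌋-yes (no ¬p) p = contradiction p ¬p

⌊⌋-no : ∀ {P : Set} (p? : Dec P) → ¬ P → ⌊ p? ⌋ ≡ false
⌊⌋-no (yes p) ¬p = contradiction p ¬p
⌊⌋-no (no _)  ¬p = refl

-- Coloured permutations

-- Ranks count from 0. The Q n v are the terms of the geometric sum (N + 1)ⁿ⁺¹ − Nⁿ⁺¹ = Σ_v Nⁿ⁻ᵛ (N + 1)ᵛ.
Q : ℕ → ℕ → Seq
Q n v N = (+ N) ^ (n ℕ.∸ v) * (+ suc N) ^ v

-- Each summand is the change caused by replacing one factor N by N + 1, so the sum telescopes. The
-- bound on `v` keeps the truncated subtraction in the exponents an honest one.
∑-Q : ∀ n v N → v ≤ suc n → ∑[ i < v ] Q n i N ≡ Q (suc n) v N - (+ N) ^ suc n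
∑-Q n zero    N _ = empty ((+ N) ^ suc n)
  where
  empty : ∀ a → + 0 ≡ a * + 1 - a
  empty = solve-∀
∑-Q n (suc v) N (s≤s v≤n) = begin
  ∑[ i < v ] Q n i N + Q n v N
    ≡⟨ cong (_+ Q n v N) (∑-Q n v N (ℕP.m≤n⇒m≤1+n v≤n)) ⟩
  (+ N) ^ (suc n ℕ.∸ v) * (+ suc N) ^ v - (+ N) ^ suc n + Q n v N
    ≡⟨ cong (λ e → (+ N) ^ e * (+ suc N) ^ v - (+ N) ^ suc n + Q n v N) (ℕP.+-∸-assoc 1 v≤n) ⟩
  (+ N) * (+ N) ^ (n ℕ.∸ v) * (+ suc N) ^ v - (+ N) ^ suc n + Q n v N
    ≡⟨ regroup (+ N) ((+ N) ^ (n ℕ.∸ v)) ((+ suc N) ^ v) ((+ N) ^ suc n) ⟩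
  Q (suc n) (suc v) N - (+ N) ^ suc n ∎
  where
  regroup : ∀ x a b c → x * a * b - c + a * b ≡ a * ((+ 1 + x) * b) - c
  regroup = solve-∀

-- By the geometric sum this is `D` of the sequence (M + 1)ⁿ⁺¹ - Mⁿ⁺¹.
∑-DQ : ℕ → Seq
∑-DQ n M = ∑[ v < suc n ] D (Q n v) M

-- A sum over the pairs (argument, rank) that precede (N , v) lexicographically. The sum over
-- smaller arguments telescopes to Nⁿ⁺¹ - (N - 1)ⁿ⁺¹, and this cancels the powers left over by `∑-Q`
-- in the sum over smaller ranks.
DQ-suc : ∀ n v N → v ≤ suc n → D (Q (suc n) v) N ≡ ∑< N (∑-DQ n) + ∑[ i < v ] D (Q n i) N
DQ-suc n v zero v≤ = begin
  Q (suc n) v 0 - + 0                               ≡⟨ pad (Q (suc n) v 0) ((+ 0) ^ n) ⟩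
  + 0 + ((Q (suc n) v 0 - (+ 0) ^ suc n) - + 0)      ≡⟨ cong (λ z → + 0 + (z - + 0)) (sym (∑-Q n v 0 v≤)) ⟩
  + 0 + (∑[ i < v ] Q n i 0 - + 0)                   ≡⟨ cong (λ z → + 0 + (∑[ i < v ] Q n i 0 - z)) (sym (∑<-zero v)) ⟩
  + 0 + (∑[ i < v ] Q n i 0 - ∑< v (λ _ → + 0))        ≡⟨ cong (_+_ (+ 0)) (sym (∑<-minus v (λ i → Q n i 0) (λ _ → + 0))) ⟩
  + 0 + ∑[ i < v ] D (Q n i) 0                       ∎
  where
  pad : ∀ a b → a - + 0 ≡ + 0 + ((a - + 0 * b) - + 0)
  pad = solve-∀
DQ-suc n v (suc M) v≤ = sym (begin
  ∑< N (∑-DQ n) + ∑[ i < v ] D (Q n i) N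
    ≡⟨ cong₂ _+_ (∑<-swap N (suc n) (λ M′ i → D (Q n i) M′)) (∑<-minus v (λ i → Q n i N) (λ i → Q n i M)) ⟩
  ∑[ i < suc n ] ∑< N (D (Q n i)) + (∑[ i < v ] Q n i N - ∑[ i < v ] Q n i M)
    ≡⟨ cong (_+ (∑[ i < v ] Q n i N - ∑[ i < v ] Q n i M)) (∑<-cong (suc n) λ i → ∑<-D (Q n i) N) ⟩
  ∑[ i < suc n ] Q n i M + (∑[ i < v ] Q n i N - ∑[ i < v ] Q n i M)
    ≡⟨ cong₂ _+_ (∑-Q n (suc n) M ℕP.≤-refl) (cong₂ _-_ (∑-Q n v N v≤) (∑-Q n v M v≤)) ⟩
  Q (suc n) (suc n) M - (+ M) ^ suc n + ((Q (suc n) v N - (+ N) ^ suc n) - (Q (suc n) v M - (+ M) ^ suc n))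
    ≡⟨ cong (λ e → (+ M) ^ e * (+ N) ^ suc n - (+ M) ^ suc n + ((Q (suc n) v N - (+ N) ^ suc n) - (Q (suc n) v M - (+ M) ^ suc n))) (ℕP.n∸n≡0 n) ⟩
  (+ 1) * (+ N) ^ suc n - (+ M) ^ suc n + ((Q (suc n) v N - (+ N) ^ suc n) - (Q (suc n) v M - (+ M) ^ suc n))
    ≡⟨ collect ((+ N) ^ suc n) ((+ M) ^ suc n) (Q (suc n) v N) (Q (suc n) v M) ⟩
  Q (suc n) v N - Q (suc n) v M ∎)
  where
  N = suc M
  collect : ∀ a b c e → + 1 * a - b + ((c - a) - (e - b)) ≡ c - e
  collect = solve-∀

-- A descent raises the statistic by one, hence multiplies the generating function by t.
shiftIf : Bool → Seq → Seq
shiftIf b f = if b then E f else f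

shiftIf-cong : ∀ b {f g} → f ≗ g → shiftIf b f ≗ shiftIf b g
shiftIf-cong true  e = E-cong e
shiftIf-cong false e = e

shiftIf-D^ : ∀ b n f → shiftIf b (D^ n f) ≗ D^ n (shiftIf b f)
shiftIf-D^ true  n f = E-D^ n f
shiftIf-D^ false n f ℓ = refl

shiftIf-∑ : ∀ b (xs : List A) (F : A → Seq) → shiftIf b (λ ℓ → ∑ xs (λ x → F x ℓ)) ≗ λ ℓ → ∑ xs (λ x → shiftIf b (F x) ℓ)
shiftIf-∑ true  xs F = E-∑ xs F
shiftIf-∑ false xs F ℓ = refl

shiftIf-* : ∀ b c f → shiftIf b (λ ℓ → c * f ℓ) ≗ λ ℓ → c * shiftIf b f ℓ
shiftIf-* true  c f = E-* c f
shiftIf-* false c f ℓ = refl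

-- The recursion for one more letter, on the level of sequences

module Transfer (r : ℕ) where

  -- Descent from the letter of rank v′ and colour c′ to a new last letter of colour c whose rank, in the
  -- set enlarged by it, is v.
  drop? : (c′ v′ c v : ℕ) → Bool
  drop? c′ v′ c v = ⌊ c ℕ.<? c′ ⌋ ∨ (⌊ c′ ℕ.≟ c ⌋ ∧ ⌊ v ℕ.≤? v′ ⌋)

  -- Here `D` takes the difference in the argument of `Q`, before ℓ r + c is substituted; it is not
  -- a factor 1 - t of the series in ℓ.
  wt : (n c v : ℕ) → Seq
  wt n c v ℓ = D (Q n v) (ℓ ℕ.* r ℕ.+ c)

  -- The contribution of all words whose last letter but one has colour `c′`, up to the common
  -- factor `D^ n`.
  rankSum : (n c v c′ : ℕ) → Seq
  rankSum n c v c′ ℓ = ∑[ v′ < suc n ] shiftIf (drop? c′ v′ c v) (wt n c′ v′) ℓ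

  rankSum-< : ∀ n c v c′ ℓ → c′ < c → rankSum n c v c′ ℓ ≡ ∑-DQ n (ℓ ℕ.* r ℕ.+ c′)
  rankSum-< n c v c′ ℓ c′<c
    rewrite ⌊⌋-no (c ℕ.<? c′) (ℕP.<⇒≯ c′<c) | ⌊⌋-no (c′ ℕ.≟ c) (ℕP.<⇒≢ c′<c) = refl

  rankSum-> : ∀ n c v c′ ℓ → c < c′ → rankSum n c v c′ ℓ ≡ E (λ ℓ → ∑-DQ n (ℓ ℕ.* r ℕ.+ c′)) ℓ
  rankSum-> n c v c′ ℓ c<c′ rewrite ⌊⌋-yes (c ℕ.<? c′) c<c′ = sym (E-∑< (suc n) (wt n c′) ℓ)

  -- For equal colours the ranks below `v` give no descent and all others give one. The latter are
  -- written as a complement, so that the full sum `∑-DQ` appears as it does for the other colours.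
  rankSum-≡ : ∀ n c v ℓ → v ≤ suc n →
    rankSum n c v c ℓ ≡ ∑[ i < v ] wt n c i ℓ + E (λ ℓ → ∑-DQ n (ℓ ℕ.* r ℕ.+ c) - ∑[ i < v ] wt n c i ℓ) ℓ
  rankSum-≡ n c v ℓ v≤ rewrite ⌊⌋-no (c ℕ.<? c) (ℕP.<-irrefl refl) | ⌊⌋-yes (c ℕ.≟ c) refl = begin
    ∑[ i < suc n ] shiftIf ⌊ v ℕ.≤? i ⌋ (wt n c i) ℓ
      ≡⟨ cong (λ k → ∑[ i < k ] shiftIf ⌊ v ℕ.≤? i ⌋ (wt n c i) ℓ) (sym n≡) ⟩
    ∑[ i < v ℕ.+ j ] shiftIf ⌊ v ℕ.≤? i ⌋ (wt n c i) ℓ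
      ≡⟨ ∑<-split v j _ ⟩
    ∑[ i < v ] shiftIf ⌊ v ℕ.≤? i ⌋ (wt n c i) ℓ + ∑[ i < j ] shiftIf ⌊ v ℕ.≤? v ℕ.+ i ⌋ (wt n c (v ℕ.+ i)) ℓ
      ≡⟨ cong₂ _+_
           (∑<-cong-< v λ i i<v → cong (λ b → shiftIf b (wt n c i) ℓ) (⌊⌋-no (v ℕ.≤? i) (ℕP.<⇒≱ i<v)))
           (∑<-cong j λ i → cong (λ b → shiftIf b (wt n c (v ℕ.+ i)) ℓ) (⌊⌋-yes (v ℕ.≤? v ℕ.+ i) (ℕP.m≤m+n v i))) ⟩
    ∑[ i < v ] wt n c i ℓ + ∑[ i < j ] E (wt n c (v ℕ.+ i)) ℓ
      ≡⟨ cong (_+_ (∑[ i < v ] wt n c i ℓ)) (sym (E-∑< j (λ i → wt n c (v ℕ.+ i)) ℓ)) ⟩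
    ∑[ i < v ] wt n c i ℓ + E (λ ℓ → ∑[ i < j ] wt n c (v ℕ.+ i) ℓ) ℓ
      ≡⟨ cong (_+_ (∑[ i < v ] wt n c i ℓ)) (E-cong tail ℓ) ⟩
    ∑[ i < v ] wt n c i ℓ + E (λ ℓ → ∑-DQ n (ℓ ℕ.* r ℕ.+ c) - ∑[ i < v ] wt n c i ℓ) ℓ ∎
    where
    j = suc n ℕ.∸ v
    n≡ : v ℕ.+ j ≡ suc n
    n≡ = ℕP.m+[n∸m]≡n v≤
    cancel : ∀ a b → b ≡ a + b - a
    cancel = solve-∀
    tail : ∀ ℓ → ∑[ i < j ] wt n c (v ℕ.+ i) ℓ ≡ ∑-DQ n (ℓ ℕ.* r ℕ.+ c) - ∑[ i < v ] wt n c i ℓ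
    tail ℓ = begin
      ∑[ i < j ] wt n c (v ℕ.+ i) ℓ
        ≡⟨ cancel (∑[ i < v ] wt n c i ℓ) _ ⟩
      ∑[ i < v ] wt n c i ℓ + ∑[ i < j ] wt n c (v ℕ.+ i) ℓ - ∑[ i < v ] wt n c i ℓ
        ≡⟨ cong (_- ∑[ i < v ] wt n c i ℓ) (sym (∑<-split v j (λ i → wt n c i ℓ))) ⟩
      ∑[ i < v ℕ.+ j ] wt n c i ℓ - ∑[ i < v ] wt n c i ℓ
        ≡⟨ cong (λ k → ∑[ i < k ] wt n c i ℓ - ∑[ i < v ] wt n c i ℓ) n≡ ⟩
      ∑[ i < suc n ] wt n c i ℓ - ∑[ i < v ] wt n c i ℓ ∎

  -- Let N = ℓ r + c with ℓ > 0. The full sums have the arguments ℓ r, ..., N - 1 from the colours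
  -- below `c`, and N - r, ..., ℓ r - 1 from the shifted terms of `c` and of the colours above it.
  -- Together these are the r consecutive arguments before N, so `DQ-suc` at N minus `DQ-suc` at N -
  -- r gives the claim.
  wt-suc : ∀ n c v → c < r → v ≤ suc n → ∀ ℓ → ∑[ c′ < r ] rankSum n c v c′ ℓ ≡ D (wt (suc n) c v) ℓ
  wt-suc n c v c<r v≤ ℓ = trans splitColours (main ℓ)
    where
    e = r ℕ.∸ suc c
    r≡ : r ≡ c ℕ.+ suc e
    r≡ = sym (trans (ℕP.+-suc c e) (ℕP.m+[n∸m]≡n c<r))
    σ = ∑-DQ n
    low : Seq
    low ℓ = ∑[ i < v ] wt n c i ℓ
    splitColours : ∑[ c′ < r ] rankSum n c v c′ ℓ ≡
      ∑[ c′ < c ] σ (ℓ ℕ.* r ℕ.+ c′) + (low ℓ + E (λ ℓ → σ (ℓ ℕ.* r ℕ.+ c) - low ℓ) ℓ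
        + ∑[ i < e ] E (λ ℓ → σ (ℓ ℕ.* r ℕ.+ (c ℕ.+ suc i))) ℓ)
    splitColours = begin
      ∑[ c′ < r ] rankSum n c v c′ ℓ
        ≡⟨ cong (λ k → ∑[ c′ < k ] rankSum n c v c′ ℓ) r≡ ⟩
      ∑[ c′ < c ℕ.+ suc e ] rankSum n c v c′ ℓ
        ≡⟨ ∑<-split c (suc e) _ ⟩
      ∑[ c′ < c ] rankSum n c v c′ ℓ + ∑[ i < suc e ] rankSum n c v (c ℕ.+ i) ℓ
        ≡⟨ cong₂ _+_ (∑<-cong-< c λ c′ c′<c → rankSum-< n c v c′ ℓ c′<c) (∑<-head e (λ i → rankSum n c v (c ℕ.+ i) ℓ)) ⟩
      ∑[ c′ < c ] σ (ℓ ℕ.* r ℕ.+ c′) + (rankSum n c v (c ℕ.+ 0) ℓ + ∑[ i < e ] rankSum n c v (c ℕ.+ suc i) ℓ)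
        ≡⟨ cong (_+_ (∑[ c′ < c ] σ (ℓ ℕ.* r ℕ.+ c′))) (cong₂ _+_
             (trans (cong (λ k → rankSum n c v k ℓ) (ℕP.+-identityʳ c)) (rankSum-≡ n c v ℓ v≤))
             (∑<-cong e λ i → rankSum-> n c v (c ℕ.+ suc i) ℓ (ℕP.m<m+n c (s≤s z≤n)))) ⟩
      ∑[ c′ < c ] σ (ℓ ℕ.* r ℕ.+ c′) + (low ℓ + E (λ ℓ → σ (ℓ ℕ.* r ℕ.+ c) - low ℓ) ℓ
        + ∑[ i < e ] E (λ ℓ → σ (ℓ ℕ.* r ℕ.+ (c ℕ.+ suc i))) ℓ) ∎
    main : ∀ ℓ → ∑[ c′ < c ] σ (ℓ ℕ.* r ℕ.+ c′) + (low ℓ + E (λ ℓ → σ (ℓ ℕ.* r ℕ.+ c) - low ℓ) ℓ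
        + ∑[ i < e ] E (λ ℓ → σ (ℓ ℕ.* r ℕ.+ (c ℕ.+ suc i))) ℓ) ≡ D (wt (suc n) c v) ℓ
    -- All shifted terms vanish at ℓ = 0, and the colours below `c` supply every argument below `c`;
    -- no second instance of `DQ-suc` is subtracted.
    main zero = begin
      ∑[ c′ < c ] σ c′ + (low 0 + + 0 + ∑< e (λ _ → + 0))
        ≡⟨ cong (λ z → ∑< c σ + (low 0 + + 0 + z)) (∑<-zero e) ⟩
      ∑< c σ + (low 0 + + 0 + + 0)
        ≡⟨ pad (∑< c σ) (low 0) ⟩
      ∑< c σ + low 0 - + 0
        ≡⟨ cong (_- + 0) (sym (DQ-suc n v c v≤)) ⟩
      D (Q (suc n) v) c - + 0 ∎
      where
      pad : ∀ a b → a + (b + + 0 + + 0) ≡ a + b - + 0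
      pad = solve-∀
    main (suc k) = begin
      X + (low (suc k) + (σ K - low k) + ∑[ i < e ] σ (k ℕ.* r ℕ.+ (c ℕ.+ suc i)))
        ≡⟨ cong (λ z → X + (low (suc k) + (σ K - low k) + z)) (∑<-cong e λ i → cong σ (sym (ℕP.+-assoc (k ℕ.* r) c (suc i)))) ⟩
      X + (low (suc k) + (σ K - low k) + Y)
        ≡⟨ regroup X (low (suc k)) (σ K) (low k) Y (∑< K σ) ⟩
      ∑< K σ + (σ K + Y + X) + low (suc k) - (∑< K σ + low k)
        ≡⟨ cong (λ z → ∑< K σ + z + low (suc k) - (∑< K σ + low k)) (sym block) ⟩
      ∑< K σ + ∑[ i < suc e ℕ.+ c ] σ (K ℕ.+ i) + low (suc k) - (∑< K σ + low k)
        ≡⟨ cong (λ z → z + low (suc k) - (∑< K σ + low k)) (sym (∑<-split K (suc e ℕ.+ c) σ)) ⟩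
      ∑< (K ℕ.+ (suc e ℕ.+ c)) σ + low (suc k) - (∑< K σ + low k)
        ≡⟨ cong (λ z → ∑< z σ + low (suc k) - (∑< K σ + low k)) (shift c) ⟩
      ∑< (suc k ℕ.* r ℕ.+ c) σ + low (suc k) - (∑< K σ + low k)
        ≡⟨ sym (cong₂ _-_ (DQ-suc n v (suc k ℕ.* r ℕ.+ c) v≤) (DQ-suc n v K v≤)) ⟩
      D (Q (suc n) v) (suc k ℕ.* r ℕ.+ c) - D (Q (suc n) v) K ∎
      where
      K = k ℕ.* r ℕ.+ c
      X = ∑[ c′ < c ] σ (suc k ℕ.* r ℕ.+ c′)
      Y = ∑[ i < e ] σ (K ℕ.+ suc i)
      regroup : ∀ x l s l′ y b → x + (l + (s - l′) + y) ≡ b + (s + y + x) + l - (b + l′)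
      regroup = solve-∀
      shift : ∀ i → K ℕ.+ (suc e ℕ.+ i) ≡ suc k ℕ.* r ℕ.+ i
      shift i = begin
        K ℕ.+ (suc e ℕ.+ i)                     ≡⟨ sym (ℕP.+-assoc K (suc e) i) ⟩
        K ℕ.+ suc e ℕ.+ i                       ≡⟨ cong (ℕ._+ i) (ℕP.+-assoc (k ℕ.* r) c (suc e)) ⟩
        k ℕ.* r ℕ.+ (c ℕ.+ suc e) ℕ.+ i         ≡⟨ cong (λ z → k ℕ.* r ℕ.+ z ℕ.+ i) (sym r≡) ⟩
        k ℕ.* r ℕ.+ r ℕ.+ i                     ≡⟨ cong (ℕ._+ i) (ℕP.+-comm (k ℕ.* r) r) ⟩
        suc k ℕ.* r ℕ.+ i                       ∎
      block : ∑[ i < suc e ℕ.+ c ] σ (K ℕ.+ i) ≡ σ K + Y + X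
      block = begin
        ∑[ i < suc e ℕ.+ c ] σ (K ℕ.+ i)
          ≡⟨ ∑<-split (suc e) c _ ⟩
        ∑[ i < suc e ] σ (K ℕ.+ i) + ∑[ i < c ] σ (K ℕ.+ (suc e ℕ.+ i))
          ≡⟨ cong₂ _+_ (∑<-head e (λ i → σ (K ℕ.+ i))) (∑<-cong c λ i → cong σ (shift i)) ⟩
        σ (K ℕ.+ 0) + Y + X
          ≡⟨ cong (λ z → σ z + Y + X) (ℕP.+-identityʳ K) ⟩
        σ K + Y + X ∎

-- Ranks in increasing lists

≟-sym : ∀ a b → ⌊ a ℕ.≟ b ⌋ ≡ ⌊ b ℕ.≟ a ⌋
≟-sym a b = ⌊⌋-ext (a ℕ.≟ b) (b ℕ.≟ a) sym sym

rank : List ℕ → ℕ → ℕ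
rank X y = length (select (λ z → ⌊ z ℕ.<? y ⌋) X)

remove : ℕ → List ℕ → List ℕ
remove y = select (λ z → not ⌊ z ℕ.≟ y ⌋)

rank-min : ∀ {y X} → All (y <_) X → rank X y ≡ 0
rank-min []                          = refl
rank-min {y} (_∷_ {x} y<x y<X) rewrite ⌊⌋-no (x ℕ.<? y) (ℕP.<⇒≯ y<x) = rank-min y<X

rank-∷-> : ∀ {x y} X → x < y → rank (x ∷ X) y ≡ suc (rank X y)
rank-∷-> {x} {y} X x<y rewrite ⌊⌋-yes (x ℕ.<? y) x<y = refl

rank-∷-≯ : ∀ {x y} X → ¬ x < y → rank (x ∷ X) y ≡ rank X y
rank-∷-≯ {x} {y} X x≮y rewrite ⌊⌋-no (x ℕ.<? y) x≮y = refl

-- This frees the count from the letters themselves: whatever depends on a letter only through its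
-- rank depends on the list only through its length.
∑-rank : ∀ {X} (f : ℕ → ℤ) → AllPairs _<_ X → ∑ X (λ y → f (rank X y)) ≡ ∑< (length X) f
∑-rank f []                          = refl
∑-rank {x ∷ X} f (x<X ∷ X↗) = begin
  f (rank (x ∷ X) x) + ∑ X (λ y → f (rank (x ∷ X) y))
    ≡⟨ cong₂ _+_ (cong f (trans (rank-∷-≯ X (ℕP.<-irrefl refl)) (rank-min x<X)))
                 (∑-cong-All x<X λ y x<y → cong f (rank-∷-> X x<y)) ⟩
  f 0 + ∑ X (λ y → f (suc (rank X y)))   ≡⟨ cong (_+_ (f 0)) (∑-rank (f ∘ suc) X↗) ⟩
  f 0 + ∑< (length X) (f ∘ suc)          ≡⟨ sym (∑<-head (length X) f) ⟩
  ∑< (suc (length X)) f                  ∎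

rank-mono : ∀ X {x y} → x ≤ y → rank X x ≤ rank X y
rank-mono []      x≤y = z≤n
rank-mono (z ∷ X) {x} {y} x≤y with z ℕ.<? x | z ℕ.<? y
... | yes _   | yes _   = s≤s (rank-mono X x≤y)
... | yes z<x | no  z≮y = contradiction (ℕP.<-≤-trans z<x x≤y) z≮y
... | no  _   | yes _   = ℕP.m≤n⇒m≤1+n (rank-mono X x≤y)
... | no  _   | no  _   = rank-mono X x≤y

rank-strict : ∀ {X x y} → y ∈ X → y < x → rank X y < rank X x
rank-strict {z ∷ X} {x} {y} (here refl) y<x
  rewrite rank-∷-≯ {y} {y} X (ℕP.<-irrefl refl) | rank-∷-> {y} {x} X y<x = s≤s (rank-mono X (ℕP.<⇒≤ y<x))
rank-strict {z ∷ X} {x} {y} (there y∈X) y<x with z ℕ.<? x | z ℕ.<? y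
... | yes _   | yes _   = s≤s (rank-strict y∈X y<x)
... | yes _   | no  _   = ℕP.m≤n⇒m≤1+n (rank-strict y∈X y<x)
... | no  z≮x | yes z<y = contradiction (ℕP.<-trans z<y y<x) z≮x
... | no  _   | no  _   = rank-strict y∈X y<x

rank-remove : ∀ X y → rank (remove y X) y ≡ rank X y
rank-remove []      y = refl
rank-remove (z ∷ X) y with z ℕ.≟ y
... | yes refl = trans (rank-remove X y) (sym (rank-∷-≯ {y} {y} X (ℕP.<-irrefl refl)))
... | no  _    with z ℕ.<? y
...   | yes _ = cong suc (rank-remove X y)
...   | no  _ = rank-remove X y

remove-∉ : ∀ y {X} → All (y ≢_) X → remove y X ≡ X
remove-∉ y y∉X = filter-all _ (All.map (λ {z} y≢z → cong not (⌊⌋-no (z ℕ.≟ y) (y≢z ∘ sym))) y∉X)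

length-remove : ∀ {X y} → AllPairs _<_ X → y ∈ X → length X ≡ suc (length (remove y X))
length-remove {x ∷ X} {y} (x<X ∷ X↗) y∈ with x ℕ.≟ y | y∈
... | yes refl | _ = cong (suc ∘ length) (sym (remove-∉ x (All.map ℕP.<⇒≢ x<X)))
... | no x≢y | here refl = contradiction refl x≢y
... | no x≢y | there y∈X = cong suc (length-remove X↗ y∈X)

∉-remove : ∀ y X → All (y ≢_) (remove y X)
∉-remove y X = All.map distinct (AllP.all-filter (λ z → not ⌊ z ℕ.≟ y ⌋ Bool.≟ true) X)
  where
  distinct : ∀ {z} → not ⌊ z ℕ.≟ y ⌋ ≡ true → y ≢ z
  distinct {z} p y≡z with z ℕ.≟ y
  distinct () y≡z | yes _
  ... | no z≢y = z≢y (sym y≡z)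

rank-applyUpTo : ∀ (f : ℕ → ℕ) n j → (∀ {a b} → a < b → f a < f b) → j < n → rank (applyUpTo f n) (f j) ≡ j
rank-applyUpTo f (suc n) zero    mono _ =
  trans (rank-∷-≯ (applyUpTo (f ∘ suc) n) (ℕP.<-irrefl refl)) (rank-min (AllP.applyUpTo⁺₂ (f ∘ suc) n (λ i → mono (s≤s z≤n))))
rank-applyUpTo f (suc n) (suc j) mono (s≤s j<n) =
  trans (rank-∷-> (applyUpTo (f ∘ suc) n) (mono (s≤s z≤n))) (cong suc (rank-applyUpTo (f ∘ suc) n j (mono ∘ s≤s) j<n))

-- Words split at their last letter

letters : ∀ {n} → Vec ℕ n → Vec ℕ n → List (ℕ × ℕ)
letters w ε = zipL (toList w) (toList ε)

countDesc-∷ʳ : ∀ {n} (w ε : Vec ℕ n) y c′ x c →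
  countDesc (letters (w ∷ʳ y ∷ʳ x) (ε ∷ʳ c′ ∷ʳ c))
    ≡ countDesc (letters (w ∷ʳ y) (ε ∷ʳ c′)) ℕ.+ (if descB (y , c′) (x , c) then 1 else 0)
countDesc-∷ʳ []          []          y c′ x c = ℕP.+-identityʳ _
countDesc-∷ʳ (a ∷ [])    (e ∷ [])    y c′ x c =
  trans (cong (first ℕ.+_) (countDesc-∷ʳ [] [] y c′ x c)) (sym (ℕP.+-assoc first _ _))
  where first = if descB (a , e) (y , c′) then 1 else 0
countDesc-∷ʳ (a ∷ b ∷ w) (e ∷ f ∷ ε) y c′ x c =
  trans (cong (first ℕ.+_) (countDesc-∷ʳ (b ∷ w) (f ∷ ε) y c′ x c)) (sym (ℕP.+-assoc first _ _))
  where first = if descB (a , e) (b , f) then 1 else 0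

-- The letter appended by convention has the same colour 0 as the last letter and a larger value, so
-- it adds no descent.
des-last : ∀ {n} (w ε : Vec ℕ n) v N → v ≤ N →
  des N (toList (w ∷ʳ v)) (toList (ε ∷ʳ 0)) ≡ countDesc (letters (w ∷ʳ v) (ε ∷ʳ 0))
des-last []          []          v N v≤N rewrite ⌊⌋-no (suc N ℕ.<? v) (ℕP.<⇒≯ (s≤s v≤N)) = refl
des-last (a ∷ [])    (e ∷ [])    v N v≤N = cong ((if descB (a , e) (v , 0) then 1 else 0) ℕ.+_) (des-last [] [] v N v≤N)
des-last (a ∷ b ∷ w) (e ∷ f ∷ ε) v N v≤N = cong ((if descB (a , e) (b , f) then 1 else 0) ℕ.+_) (des-last (b ∷ w) (f ∷ ε) v N v≤N)

distinctB-∷ʳ : ∀ {n} (w : Vec ℕ n) y →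
  distinctB (toList (w ∷ʳ y)) ≡ allB (λ z → not ⌊ z ℕ.≟ y ⌋) (toList w) ∧ distinctB (toList w)
distinctB-∷ʳ []      y = refl
distinctB-∷ʳ (a ∷ w) y = trans (cong₂ _∧_ (allB-∷ʳ w) (distinctB-∷ʳ w y)) (regroup (allB _ (toList w)) _ _ _)
  where
  allB-∷ʳ : ∀ {n} (w : Vec ℕ n) → allB (λ z → not ⌊ a ℕ.≟ z ⌋) (toList (w ∷ʳ y))
    ≡ allB (λ z → not ⌊ a ℕ.≟ z ⌋) (toList w) ∧ not ⌊ a ℕ.≟ y ⌋
  allB-∷ʳ []      = BoolP.∧-identityʳ _
  allB-∷ʳ (b ∷ w) = trans (cong (not ⌊ a ℕ.≟ b ⌋ ∧_) (allB-∷ʳ w)) (sym (BoolP.∧-assoc (not ⌊ a ℕ.≟ b ⌋) _ _))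
  regroup : ∀ p q s t → (p ∧ q) ∧ (s ∧ t) ≡ (q ∧ s) ∧ (p ∧ t)
  regroup true  q s t = sym (BoolP.∧-assoc q s t)
  regroup false q s t = sym (BoolP.∧-zeroʳ (q ∧ s))

headIs0-∷ʳ : ∀ {n} (ε : Vec ℕ n) c′ c → headIs0 (toList (ε ∷ʳ c′ ∷ʳ c)) ≡ headIs0 (toList (ε ∷ʳ c′))
headIs0-∷ʳ []      c′ c = refl
headIs0-∷ʳ (e ∷ ε) c′ c = refl

lastIs-∷ʳ : ∀ {n} v (w : Vec ℕ n) x → lastIs v (toList (w ∷ʳ x)) ≡ ⌊ x ℕ.≟ v ⌋
lastIs-∷ʳ v []          x = refl
lastIs-∷ʳ v (a ∷ [])    x = refl
lastIs-∷ʳ v (a ∷ b ∷ w) x = lastIs-∷ʳ v (b ∷ w) x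

≟-shift : ∀ a b m → ⟦ ⌊ a ℕ.+ (if b then 1 else 0) ℕ.≟ m ⌋ ⟧ ≡ shiftIf b (λ m → ⟦ ⌊ a ℕ.≟ m ⌋ ⟧) m
≟-shift a false m rewrite ℕP.+-identityʳ a = refl
≟-shift a true  m rewrite ℕP.+-comm a 1 with m
... | zero   = refl
... | suc m′ = cong ⟦_⟧ (⌊⌋-ext (suc a ℕ.≟ suc m′) (a ℕ.≟ m′) ℕP.suc-injective (cong suc))

-- Being distinct from the last letter is a condition on each remaining entry separately, so it can
-- be moved into the alphabet.
∑-tuples-remove : ∀ X {n} y (F : Vec ℕ n → ℤ) →
  ∑ (tuples X n) (λ w → ⟦ distinctB (toList (w ∷ʳ y)) ⟧ * F w) ≡ ∑ (tuples (remove y X) n) (λ w → ⟦ distinctB (toList w) ⟧ * F w)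
∑-tuples-remove X {n} y F = begin
  ∑ (tuples X n) (λ w → ⟦ distinctB (toList (w ∷ʳ y)) ⟧ * F w)
    ≡⟨ ∑-cong (tuples X n) (λ w → trans (cong (λ b → ⟦ b ⟧ * F w) (distinctB-∷ʳ w y))
         (trans (cong (_* F w) (⟦∧⟧ (allB (λ z → not ⌊ z ℕ.≟ y ⌋) (toList w)) (distinctB (toList w)))) (ℤP.*-assoc ⟦ allB (λ z → not ⌊ z ℕ.≟ y ⌋) (toList w) ⟧ _ _))) ⟩
  ∑ (tuples X n) (λ w → ⟦ allB (λ z → not ⌊ z ℕ.≟ y ⌋) (toList w) ⟧ * (⟦ distinctB (toList w) ⟧ * F w))
    ≡⟨ sym (∑-tuples-select (λ z → not ⌊ z ℕ.≟ y ⌋) X n _) ⟩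
  ∑ (tuples (remove y X) n) (λ w → ⟦ distinctB (toList w) ⟧ * F w) ∎

module Words (r : ℕ) where
  open Transfer r

  -- The condition on the first colour is imposed on `ε ∷ʳ c`, so for the empty `w` it falls on `c`
  -- itself.
  colourSum : ∀ {n} → Vec ℕ n → (x c : ℕ) → Seq
  colourSum {n} w x c m = ∑ (tuples (upTo r) n) λ ε →
    ⟦ headIs0 (toList (ε ∷ʳ c)) ⟧ * ⟦ ⌊ countDesc (letters (w ∷ʳ x) (ε ∷ʳ c)) ℕ.≟ m ⌋ ⟧

  -- Arrangements of the n elements of X followed by the letter x of colour c, counted by descents.
  arrangements : (n : ℕ) → List ℕ → (x c : ℕ) → Seq
  arrangements n X x c m = ∑ (tuples X n) λ w → ⟦ distinctB (toList w) ⟧ * colourSum w x c m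

  colourSum-∷ʳ : ∀ {n} (w : Vec ℕ n) y x c m →
    colourSum (w ∷ʳ y) x c m ≡ ∑ (upTo r) (λ c′ → shiftIf (descB (y , c′) (x , c)) (colourSum w y c′) m)
  colourSum-∷ʳ {n} w y x c m = begin
    colourSum (w ∷ʳ y) x c m
      ≡⟨ ∑-tuples-∷ʳ (upTo r) n _ ⟩
    ∑ (upTo r) (λ c′ → ∑ (tuples (upTo r) n) λ ε → ⟦ headIs0 (toList (ε ∷ʳ c′ ∷ʳ c)) ⟧
      * ⟦ ⌊ countDesc (letters (w ∷ʳ y ∷ʳ x) (ε ∷ʳ c′ ∷ʳ c)) ℕ.≟ m ⌋ ⟧)
      ≡⟨ ∑-cong (upTo r) (λ c′ → trans (∑-cong (tuples (upTo r) n) (step c′))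
           (sym (shiftIf-∑ (descB (y , c′) (x , c)) (tuples (upTo r) n) _ m))) ⟩
    ∑ (upTo r) (λ c′ → shiftIf (descB (y , c′) (x , c)) (colourSum w y c′) m) ∎
    where
    step : ∀ c′ ε → ⟦ headIs0 (toList (ε ∷ʳ c′ ∷ʳ c)) ⟧ * ⟦ ⌊ countDesc (letters (w ∷ʳ y ∷ʳ x) (ε ∷ʳ c′ ∷ʳ c)) ℕ.≟ m ⌋ ⟧
      ≡ shiftIf (descB (y , c′) (x , c)) (λ m → ⟦ headIs0 (toList (ε ∷ʳ c′)) ⟧ * ⟦ ⌊ countDesc (letters (w ∷ʳ y) (ε ∷ʳ c′)) ℕ.≟ m ⌋ ⟧) m
    step c′ ε = trans
      (cong₂ (λ b k → ⟦ b ⟧ * ⟦ ⌊ k ℕ.≟ m ⌋ ⟧) (headIs0-∷ʳ ε c′ c) (countDesc-∷ʳ w ε y c′ x c))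
      (trans (cong (⟦ headIs0 (toList (ε ∷ʳ c′)) ⟧ *_) (≟-shift (countDesc (letters (w ∷ʳ y) (ε ∷ʳ c′))) (descB (y , c′) (x , c)) m))
             (sym (shiftIf-* (descB (y , c′) (x , c)) ⟦ headIs0 (toList (ε ∷ʳ c′)) ⟧ _ m)))

  arrangements-suc : ∀ n X x c m → arrangements (suc n) X x c m
    ≡ ∑ X (λ y → ∑ (upTo r) (λ c′ → shiftIf (descB (y , c′) (x , c)) (arrangements n (remove y X) y c′) m))
  arrangements-suc n X x c m = begin
    arrangements (suc n) X x c m
      ≡⟨ ∑-tuples-∷ʳ X n _ ⟩
    ∑ X (λ y → ∑ (tuples X n) (λ w → ⟦ distinctB (toList (w ∷ʳ y)) ⟧ * colourSum (w ∷ʳ y) x c m))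
      ≡⟨ ∑-cong X (λ y → trans (∑-tuples-remove X {n} y (λ w → colourSum (w ∷ʳ y) x c m)) (peel y)) ⟩
    ∑ X (λ y → ∑ (upTo r) (λ c′ → shiftIf (descB (y , c′) (x , c)) (arrangements n (remove y X) y c′) m)) ∎
    where
    peel : ∀ y → ∑ (tuples (remove y X) n) (λ w → ⟦ distinctB (toList w) ⟧ * colourSum (w ∷ʳ y) x c m)
      ≡ ∑ (upTo r) (λ c′ → shiftIf (descB (y , c′) (x , c)) (arrangements n (remove y X) y c′) m)
    peel y = begin
      ∑ W (λ w → ⟦ distinctB (toList w) ⟧ * colourSum (w ∷ʳ y) x c m)
        ≡⟨ ∑-cong W (λ w → trans (cong (⟦ distinctB (toList w) ⟧ *_) (colourSum-∷ʳ w y x c m)) (sym (∑-*ˡ ⟦ distinctB (toList w) ⟧ (upTo r) _))) ⟩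
      ∑ W (λ w → ∑ (upTo r) (λ c′ → ⟦ distinctB (toList w) ⟧ * shiftIf (descB (y , c′) (x , c)) (colourSum w y c′) m))
        ≡⟨ ∑-swap W (upTo r) _ ⟩
      ∑ (upTo r) (λ c′ → ∑ W (λ w → ⟦ distinctB (toList w) ⟧ * shiftIf (descB (y , c′) (x , c)) (colourSum w y c′) m))
        ≡⟨ ∑-cong (upTo r) (λ c′ → trans (∑-cong W (λ w → sym (shiftIf-* (descB (y , c′) (x , c)) ⟦ distinctB (toList w) ⟧ (colourSum w y c′) m)))
             (sym (shiftIf-∑ (descB (y , c′) (x , c)) W _ m))) ⟩
      ∑ (upTo r) (λ c′ → shiftIf (descB (y , c′) (x , c)) (arrangements n (remove y X) y c′) m) ∎
      where W = tuples (remove y X) n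

  -- The rank of `x`, which need not lie in `X`, counts the elements of `X` below it. An element of
  -- `X` with the same rank is thus the next one above `x`, which is why a descent corresponds to a
  -- weak inequality of ranks.
  descB-rank : ∀ {X x y} c′ c → y ∈ X → y ≢ x → descB (y , c′) (x , c) ≡ drop? c′ (rank X y) c (rank X x)
  descB-rank {X} {x} {y} c′ c y∈X y≢x = cong (λ b → ⌊ c ℕ.<? c′ ⌋ ∨ (⌊ c′ ℕ.≟ c ⌋ ∧ b))
    (⌊⌋-ext (x ℕ.<? y) (rank X x ℕ.≤? rank X y) (rank-mono X ∘ ℕP.<⇒≤)
      (λ r≤ → ℕP.≰⇒> (λ y≤x → ℕP.<⇒≱ (rank-strict y∈X (ℕP.≤∧≢⇒< y≤x y≢x)) r≤)))

  -- The letter `x` is kept outside `X` so that the induction hypothesis applies to `remove y X` and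
  -- `y`: again an increasing list, one entry shorter, with a letter outside it.
  arrangements≡D^ : ∀ n X x c m → AllPairs _<_ X → length X ≡ n → All (x ≢_) X → c < r →
    arrangements n X x c m ≡ D^ n (wt n c (rank X x)) m
  arrangements≡D^ zero (_ ∷ _) x c m X↗ () x∉X c<r
  arrangements≡D^ zero []      x c m X↗ _  x∉X c<r = base c m c<r
    where
    constant : ∀ N → 0 < N → + 0 ≡ D (Q 0 0) N
    constant (suc N) _ = refl
    -- `Q 0 0` is constantly 1, so its difference is 1 at the argument 0 and 0 elsewhere. As r > 0,
    -- the argument m r + c is 0 only if m = c = 0: the single letter must have colour 0 and there
    -- is no descent.
    base : ∀ c m → c < r → + 1 * (⟦ ⌊ c ℕ.≟ 0 ⌋ ⟧ * ⟦ ⌊ 0 ℕ.≟ m ⌋ ⟧ + + 0) + + 0 ≡ wt 0 c 0 m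
    base zero    zero    _   = refl
    base (suc c) zero    _   = refl
    base zero    (suc m) 0<r = constant _ (ℕP.<-≤-trans 0<r (ℕP.≤-trans (ℕP.m≤m+n r (m ℕ.* r)) (ℕP.m≤m+n _ 0)))
    base (suc c) (suc m) _   = constant _ (ℕP.≤-trans (s≤s z≤n) (ℕP.m≤n+m (suc c) (suc m ℕ.* r)))
  arrangements≡D^ (suc n) X x c m X↗ |X| x∉X c<r = begin
    arrangements (suc n) X x c m
      ≡⟨ arrangements-suc n X x c m ⟩
    ∑ X (λ y → ∑ (upTo r) (λ c′ → shiftIf (descB (y , c′) (x , c)) (arrangements n (remove y X) y c′) m))
      ≡⟨ ∑-cong X (λ y → ∑-applyUpTo id r _) ⟩
    ∑ X (λ y → ∑[ c′ < r ] shiftIf (descB (y , c′) (x , c)) (arrangements n (remove y X) y c′) m)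
      ≡⟨ ∑-cong-All (All.tabulate id) (λ y y∈X → ∑<-cong-< r λ c′ c′<r → byRank y y∈X c′ c′<r) ⟩
    ∑ X (λ y → ∑[ c′ < r ] D^ n (G c′ (rank X y)) m)
      ≡⟨ ∑-rank (λ v′ → ∑[ c′ < r ] D^ n (G c′ v′) m) X↗ ⟩
    ∑[ v′ < length X ] ∑[ c′ < r ] D^ n (G c′ v′) m
      ≡⟨ cong (λ k → ∑[ v′ < k ] ∑[ c′ < r ] D^ n (G c′ v′) m) |X| ⟩
    ∑[ v′ < suc n ] ∑[ c′ < r ] D^ n (G c′ v′) m
      ≡⟨ ∑<-swap (suc n) r _ ⟩
    ∑[ c′ < r ] ∑[ v′ < suc n ] D^ n (G c′ v′) m
      ≡⟨ ∑<-cong r (λ c′ → sym (D^-∑< n (suc n) (G c′) m)) ⟩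
    ∑[ c′ < r ] D^ n (rankSum n c v c′) m
      ≡⟨ sym (D^-∑< n r (rankSum n c v) m) ⟩
    D^ n (λ ℓ → ∑[ c′ < r ] rankSum n c v c′ ℓ) m
      ≡⟨ D^-cong n (wt-suc n c v c<r v≤) m ⟩
    D^ n (D (wt (suc n) c v)) m
      ≡⟨ sym (D^-suc n (wt (suc n) c v) m) ⟩
    D^ (suc n) (wt (suc n) c v) m ∎
    where
    v = rank X x
    v≤ : v ≤ suc n
    v≤ = subst (v ≤_) |X| (length-filter _ X)
    G : ℕ → ℕ → Seq
    G c′ v′ = shiftIf (drop? c′ v′ c v) (wt n c′ v′)
    byRank : ∀ y → y ∈ X → ∀ c′ → c′ < r →
      shiftIf (descB (y , c′) (x , c)) (arrangements n (remove y X) y c′) m ≡ D^ n (G c′ (rank X y)) m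
    byRank y y∈X c′ c′<r = begin
      shiftIf (descB (y , c′) (x , c)) (arrangements n (remove y X) y c′) m
        ≡⟨ cong (λ b → shiftIf b (arrangements n (remove y X) y c′) m) (descB-rank c′ c y∈X (All.lookup x∉X y∈X ∘ sym)) ⟩
      shiftIf b (arrangements n (remove y X) y c′) m
        ≡⟨ shiftIf-cong b (λ m → arrangements≡D^ n (remove y X) y c′ m (AllPairsP.filter⁺ _ X↗)
             (ℕP.suc-injective (trans (sym (length-remove X↗ y∈X)) |X|)) (∉-remove y X) c′<r) m ⟩
      shiftIf b (D^ n (wt n c′ (rank (remove y X) y))) m
        ≡⟨ cong (λ k → shiftIf b (D^ n (wt n c′ k)) m) (rank-remove X y) ⟩
      shiftIf b (D^ n (wt n c′ (rank X y))) m
        ≡⟨ shiftIf-D^ b n _ m ⟩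
      D^ n (G c′ (rank X y)) m ∎
      where b = drop? c′ (rank X y) c v

-- The generating function of `A0`

module ColouredPermutations (r : ℕ) where
  open Transfer r
  open Words r

  A0≡D^ : ∀ d k m → 1 ≤ r → k ≤ d → + A0 r (suc d) (suc k) m ≡ D^ d (wt d 0 (d ℕ.∸ k)) m
  A0≡D^ d k m 0<r k≤d = begin
    + A0 r n (suc k) m
      ≡⟨ length-select cond (concatMap (λ σ → map (σ ,_) (colorings r n)) (permutations n)) ⟩
    ∑ (concatMap (λ σ → map (σ ,_) (colorings r n)) (permutations n)) (λ pe → ⟦ cond pe ⟧)
      ≡⟨ trans (∑-concatMap _ (permutations n) _)
           (∑-cong (permutations n) λ σ → trans (∑-map (σ ,_) (colorings r n) _) (∑-map toList (tuples (upTo r) n) _)) ⟩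
    ∑ (permutations n) (λ σ → ∑ (tuples (upTo r) n) (λ ε → ⟦ cond (σ , toList ε) ⟧))
      ≡⟨ trans (∑-select distinctB (map toList (tuples X n)) _) (∑-map toList (tuples X n) _) ⟩
    ∑ (tuples X n) (λ w → ⟦ distinctB (toList w) ⟧ * ∑ (tuples (upTo r) n) (λ ε → ⟦ cond (toList w , toList ε) ⟧))
      ≡⟨ ∑-tuples-∷ʳ X d _ ⟩
    ∑ X (λ x → ∑ (tuples X d) (λ w → ⟦ distinctB (toList (w ∷ʳ x)) ⟧ * ∑ (tuples (upTo r) n) (λ ε → ⟦ cond (toList (w ∷ʳ x) , toList ε) ⟧)))
      ≡⟨ ∑-cong X (λ x → ∑-cong (tuples X d) λ w → cong (⟦ distinctB (toList (w ∷ʳ x)) ⟧ *_) (colours w x)) ⟩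
    ∑ X (λ x → ∑ (tuples X d) (λ w → ⟦ distinctB (toList (w ∷ʳ x)) ⟧ * (⟦ ⌊ v ℕ.≟ x ⌋ ⟧ * colourSum w x 0 m)))
      ≡⟨ ∑-cong X (λ x → trans (∑-tuples-remove X {d} x (λ w → ⟦ ⌊ v ℕ.≟ x ⌋ ⟧ * colourSum w x 0 m)) (pull x)) ⟩
    ∑ X (λ x → ⟦ ⌊ v ℕ.≟ x ⌋ ⟧ * arrangements d (remove x X) x 0 m)
      ≡⟨ ∑-applyUpTo suc n (λ x → ⟦ ⌊ v ℕ.≟ x ⌋ ⟧ * arrangements d (remove x X) x 0 m) ⟩
    ∑[ i < n ] (⟦ ⌊ v ℕ.≟ suc i ⌋ ⟧ * arrangements d (remove (suc i) X) (suc i) 0 m)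
      ≡⟨ ∑<-cong n (λ i → cong (λ b → ⟦ b ⟧ * arrangements d (remove (suc i) X) (suc i) 0 m)
           (⌊⌋-ext (v ℕ.≟ suc i) (j ℕ.≟ i) (λ e → ℕP.suc-injective (trans (sym v≡) e)) (λ e → trans v≡ (cong suc e)))) ⟩
    ∑[ i < n ] (⟦ ⌊ j ℕ.≟ i ⌋ ⟧ * arrangements d (remove (suc i) X) (suc i) 0 m)
      ≡⟨ ∑<-indicator n j _ j<n ⟩
    arrangements d (remove (suc j) X) (suc j) 0 m
      ≡⟨ arrangements≡D^ d (remove (suc j) X) (suc j) 0 m (AllPairsP.filter⁺ (λ z → not ⌊ z ℕ.≟ suc j ⌋ Bool.≟ true) X↗)
           (ℕP.suc-injective (trans (sym (length-remove X↗ (applyUpTo⁺ j<n))) (length-applyUpTo suc n))) (∉-remove (suc j) X) 0<r ⟩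
    D^ d (wt d 0 (rank (remove (suc j) X) (suc j))) m
      ≡⟨ cong (λ i → D^ d (wt d 0 i) m) (trans (rank-remove X (suc j)) (rank-applyUpTo suc n j s≤s j<n)) ⟩
    D^ d (wt d 0 j) m ∎
    where
    n = suc d
    -- The prescribed last letter is `v` = d + 1 - k. Letters start at 1 and ranks at 0, so `j` is
    -- its rank.
    j = d ℕ.∸ k
    v = suc n ℕ.∸ suc k
    X = applyUpTo suc n
    v≡ : v ≡ suc j
    v≡ = ℕP.+-∸-assoc 1 k≤d
    j<n : j < n
    j<n = s≤s (ℕP.m∸n≤m d k)
    X↗ : AllPairs _<_ X
    X↗ = AllPairsP.applyUpTo⁺₁ suc n (λ i<j _ → s≤s i<j)
    applyUpTo⁺ : ∀ {i} → i < n → suc i ∈ X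
    applyUpTo⁺ = ∈-applyUpTo⁺ suc
    cond : List ℕ × List ℕ → Bool
    cond pe = headIs0 (proj₂ pe) ∧ lastIs 0 (proj₂ pe) ∧ lastIs v (proj₁ pe) ∧ ⌊ des n (proj₁ pe) (proj₂ pe) ℕ.≟ m ⌋
    pull : ∀ x → ∑ (tuples (remove x X) d) (λ w → ⟦ distinctB (toList w) ⟧ * (⟦ ⌊ v ℕ.≟ x ⌋ ⟧ * colourSum w x 0 m))
      ≡ ⟦ ⌊ v ℕ.≟ x ⌋ ⟧ * arrangements d (remove x X) x 0 m
    pull x = trans (∑-cong (tuples (remove x X) d) λ w → swap ⟦ distinctB (toList w) ⟧ ⟦ ⌊ v ℕ.≟ x ⌋ ⟧ (colourSum w x 0 m))
      (∑-*ˡ ⟦ ⌊ v ℕ.≟ x ⌋ ⟧ (tuples (remove x X) d) _)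
      where
      swap : ∀ a b c → a * (b * c) ≡ b * (a * c)
      swap = solve-∀
    colours : ∀ w x → ∑ (tuples (upTo r) n) (λ ε → ⟦ cond (toList (w ∷ʳ x) , toList ε) ⟧) ≡ ⟦ ⌊ v ℕ.≟ x ⌋ ⟧ * colourSum w x 0 m
    colours w x = begin
      ∑ (tuples (upTo r) n) (λ ε → ⟦ cond (toList (w ∷ʳ x) , toList ε) ⟧)
        ≡⟨ ∑-tuples-∷ʳ (upTo r) d _ ⟩
      ∑ (upTo r) (λ c → ∑ (tuples (upTo r) d) (λ ε → ⟦ cond (toList (w ∷ʳ x) , toList (ε ∷ʳ c)) ⟧))
        ≡⟨ ∑-cong (upTo r) (λ c → trans (∑-cong (tuples (upTo r) d) (condition c)) (trans (∑-*ˡ ⟦ ⌊ 0 ℕ.≟ c ⌋ ⟧ (tuples (upTo r) d) _)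
             (cong (⟦ ⌊ 0 ℕ.≟ c ⌋ ⟧ *_) (∑-*ˡ ⟦ ⌊ v ℕ.≟ x ⌋ ⟧ (tuples (upTo r) d) _)))) ⟩
      ∑ (upTo r) (λ c → ⟦ ⌊ 0 ℕ.≟ c ⌋ ⟧ * (⟦ ⌊ v ℕ.≟ x ⌋ ⟧ * colourSum w x c m))
        ≡⟨ ∑-applyUpTo id r _ ⟩
      ∑[ c < r ] (⟦ ⌊ 0 ℕ.≟ c ⌋ ⟧ * (⟦ ⌊ v ℕ.≟ x ⌋ ⟧ * colourSum w x c m))
        ≡⟨ ∑<-indicator r 0 _ 0<r ⟩
      ⟦ ⌊ v ℕ.≟ x ⌋ ⟧ * colourSum w x 0 m ∎
      where
      ones : ∀ a b → a * b ≡ + 1 * (+ 1 * (a * b))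
      ones = solve-∀
      condition : ∀ c ε → ⟦ cond (toList (w ∷ʳ x) , toList (ε ∷ʳ c)) ⟧
        ≡ ⟦ ⌊ 0 ℕ.≟ c ⌋ ⟧ * (⟦ ⌊ v ℕ.≟ x ⌋ ⟧ * (⟦ headIs0 (toList (ε ∷ʳ c)) ⟧ * ⟦ ⌊ countDesc (letters (w ∷ʳ x) (ε ∷ʳ c)) ℕ.≟ m ⌋ ⟧))
      condition c ε rewrite lastIs-∷ʳ 0 ε c | lastIs-∷ʳ v w x | ≟-sym c 0 | ≟-sym x v with 0 ℕ.≟ c | v ℕ.≟ x
      ... | no _     | v≟x   = trans (cong ⟦_⟧ (BoolP.∧-zeroʳ (headIs0 (toList (ε ∷ʳ c)))))
        (sym (ℤP.*-zeroˡ (⟦ ⌊ v≟x ⌋ ⟧ * (⟦ headIs0 (toList (ε ∷ʳ c)) ⟧ * ⟦ ⌊ countDesc (letters (w ∷ʳ x) (ε ∷ʳ c)) ℕ.≟ m ⌋ ⟧))))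
      ... | yes _    | no _  = trans (cong ⟦_⟧ (BoolP.∧-zeroʳ (headIs0 (toList (ε ∷ʳ c))))) (sym (ℤP.*-identityˡ _))
      ... | yes refl | yes v≡x = trans (cong (λ N → ⟦ headIs0 (toList (ε ∷ʳ 0)) ∧ ⌊ N ℕ.≟ m ⌋ ⟧) (des-last w ε x n x≤n))
        (trans (⟦∧⟧ h s) (ones ⟦ h ⟧ ⟦ s ⟧))
        where
        h = headIs0 (toList (ε ∷ʳ 0))
        s = ⌊ countDesc (letters (w ∷ʳ x) (ε ∷ʳ 0)) ℕ.≟ m ⌋
        x≤n : x ≤ n
        x≤n = subst (_≤ n) v≡x (ℕP.m∸n≤m n k)

-- h-vectors

coeff-⊕ : ∀ p q k → coeff (p ⊕ q) k ≡ coeff p k + coeff q k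
coeff-⊕ []      q       k       = sym (ℤP.+-identityˡ _)
coeff-⊕ (a ∷ p) []      k       = sym (ℤP.+-identityʳ _)
coeff-⊕ (a ∷ p) (b ∷ q) zero    = refl
coeff-⊕ (a ∷ p) (b ∷ q) (suc k) = coeff-⊕ p q k

coeff-scale : ∀ c p k → coeff (scale c p) k ≡ c * coeff p k
coeff-scale c []      k       = sym (ℤP.*-zeroʳ c)
coeff-scale c (a ∷ p) zero    = refl
coeff-scale c (a ∷ p) (suc k) = coeff-scale c p k

coeff-0∷ : ∀ p → coeff (+ 0 ∷ p) ≗ E (coeff p)
coeff-0∷ p zero    = refl
coeff-0∷ p (suc k) = refl

coeff-∷-⊗ : ∀ a p q k → coeff ((a ∷ p) ⊗ q) k ≡ a * coeff q k + E (coeff (p ⊗ q)) k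
coeff-∷-⊗ a p q k = trans (coeff-⊕ (scale a q) _ k) (cong₂ _+_ (coeff-scale a q k) (coeff-0∷ (p ⊗ q) k))

coeff-⊕-⊗ : ∀ p p′ q k → coeff ((p ⊕ p′) ⊗ q) k ≡ coeff (p ⊗ q) k + coeff (p′ ⊗ q) k
coeff-⊕-⊗ []      p′       q k = sym (ℤP.+-identityˡ _)
coeff-⊕-⊗ (a ∷ p) []       q k = sym (ℤP.+-identityʳ _)
coeff-⊕-⊗ (a ∷ p) (b ∷ p′) q k = begin
  coeff (((a + b) ∷ (p ⊕ p′)) ⊗ q) k
    ≡⟨ coeff-∷-⊗ (a + b) (p ⊕ p′) q k ⟩
  (a + b) * coeff q k + E (coeff ((p ⊕ p′) ⊗ q)) k
    ≡⟨ cong (_+_ ((a + b) * coeff q k)) (E-rec k) ⟩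
  (a + b) * coeff q k + (E (coeff (p ⊗ q)) k + E (coeff (p′ ⊗ q)) k)
    ≡⟨ regroup a b (coeff q k) _ _ ⟩
  a * coeff q k + E (coeff (p ⊗ q)) k + (b * coeff q k + E (coeff (p′ ⊗ q)) k)
    ≡⟨ sym (cong₂ _+_ (coeff-∷-⊗ a p q k) (coeff-∷-⊗ b p′ q k)) ⟩
  coeff ((a ∷ p) ⊗ q) k + coeff ((b ∷ p′) ⊗ q) k ∎
  where
  E-rec : ∀ k → E (coeff ((p ⊕ p′) ⊗ q)) k ≡ E (coeff (p ⊗ q)) k + E (coeff (p′ ⊗ q)) k
  E-rec zero    = refl
  E-rec (suc k) = coeff-⊕-⊗ p p′ q k
  regroup : ∀ a b c x y → (a + b) * c + (x + y) ≡ a * c + x + (b * c + y)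
  regroup = solve-∀

coeff-scale-⊗ : ∀ c p q k → coeff (scale c p ⊗ q) k ≡ c * coeff (p ⊗ q) k
coeff-scale-⊗ c []      q k = sym (ℤP.*-zeroʳ c)
coeff-scale-⊗ c (a ∷ p) q k = begin
  coeff ((c * a ∷ scale c p) ⊗ q) k                    ≡⟨ coeff-∷-⊗ (c * a) (scale c p) q k ⟩
  c * a * coeff q k + E (coeff (scale c p ⊗ q)) k      ≡⟨ cong (_+_ (c * a * coeff q k)) (trans (E-cong (coeff-scale-⊗ c p q) k) (E-* c _ k)) ⟩
  c * a * coeff q k + c * E (coeff (p ⊗ q)) k          ≡⟨ factor c a (coeff q k) _ ⟩
  c * (a * coeff q k + E (coeff (p ⊗ q)) k)            ≡⟨ cong (c *_) (sym (coeff-∷-⊗ a p q k)) ⟩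
  c * coeff ((a ∷ p) ⊗ q) k                            ∎
  where
  factor : ∀ c a b x → c * a * b + c * x ≡ c * (a * b + x)
  factor = solve-∀

coeff-t⊗-⊗ : ∀ p q → coeff ((tPoly ⊗ p) ⊗ q) ≗ E (coeff (p ⊗ q))
coeff-t⊗-⊗ p q k = begin
  coeff ((scale (+ 0) p ⊕ (+ 0 ∷ u)) ⊗ q) k
    ≡⟨ coeff-⊕-⊗ (scale (+ 0) p) (+ 0 ∷ u) q k ⟩
  coeff (scale (+ 0) p ⊗ q) k + coeff ((+ 0 ∷ u) ⊗ q) k
    ≡⟨ cong₂ _+_ (coeff-scale-⊗ (+ 0) p q k) (coeff-∷-⊗ (+ 0) u q k) ⟩
  + 0 * coeff (p ⊗ q) k + (+ 0 * coeff q k + E (coeff (u ⊗ q)) k)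
    ≡⟨ drop (coeff (p ⊗ q) k) (coeff q k) _ ⟩
  E (coeff (u ⊗ q)) k
    ≡⟨ E-cong u⊗ k ⟩
  E (coeff (p ⊗ q)) k ∎
  where
  u = (+ 1 ∷ []) ⊗ p
  drop : ∀ a b c → + 0 * a + (+ 0 * b + c) ≡ c
  drop = solve-∀
  one : ∀ a b → + 1 * a + (+ 0 * b + + 0) ≡ a
  one = solve-∀
  u⊗ : coeff (u ⊗ q) ≗ coeff (p ⊗ q)
  u⊗ k = begin
    coeff (u ⊗ q) k
      ≡⟨ coeff-⊕-⊗ (scale (+ 1) p) (+ 0 ∷ []) q k ⟩
    coeff (scale (+ 1) p ⊗ q) k + coeff ((+ 0 ∷ []) ⊗ q) k
      ≡⟨ cong₂ _+_ (coeff-scale-⊗ (+ 1) p q k) (trans (coeff-∷-⊗ (+ 0) [] q k) (cong (_+_ (+ 0 * coeff q k)) (E-zero k))) ⟩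
    + 1 * coeff (p ⊗ q) k + (+ 0 * coeff q k + + 0)
      ≡⟨ one (coeff (p ⊗ q) k) (coeff q k) ⟩
    coeff (p ⊗ q) k ∎
    where
    E-zero : ∀ k → E (coeff ([] ⊗ q)) k ≡ + 0
    E-zero zero    = refl
    E-zero (suc k) = refl

coeff-t^⊗ : ∀ i q → coeff ((tPoly ^ₚ i) ⊗ q) ≗ E^ i (coeff q)
coeff-t^⊗ zero    q k = begin
  coeff ((+ 1 ∷ []) ⊗ q) k                    ≡⟨ coeff-∷-⊗ (+ 1) [] q k ⟩
  + 1 * coeff q k + E (coeff ([] ⊗ q)) k      ≡⟨ cong₂ _+_ (ℤP.*-identityˡ (coeff q k)) (E-zero k) ⟩
  coeff q k + + 0                             ≡⟨ ℤP.+-identityʳ _ ⟩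
  coeff q k                                   ∎
  where
  E-zero : ∀ k → E (coeff ([] ⊗ q)) k ≡ + 0
  E-zero zero    = refl
  E-zero (suc k) = refl
coeff-t^⊗ (suc i) q k = trans (coeff-t⊗-⊗ (tPoly ^ₚ i) q k) (E-cong (coeff-t^⊗ i q) k)

coeff-[1-t]^ : ∀ n → coeff (oneMinusT ^ₚ n) ≗ D^ n δ
coeff-[1-t]^ zero    zero    = refl
coeff-[1-t]^ zero    (suc k) = refl
coeff-[1-t]^ (suc n) k = begin
  coeff (oneMinusT ⊗ p) k
    ≡⟨ coeff-∷-⊗ (+ 1) (- (+ 1) ∷ []) p k ⟩
  + 1 * coeff p k + E (coeff ((- (+ 1) ∷ []) ⊗ p)) k
    ≡⟨ cong (_+_ (+ 1 * coeff p k)) (trans (E-cong neg k) (E-* (- (+ 1)) (coeff p) k)) ⟩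
  + 1 * coeff p k + - (+ 1) * E (coeff p) k
    ≡⟨ minus (coeff p k) (E (coeff p) k) ⟩
  D (coeff p) k
    ≡⟨ D-cong (coeff-[1-t]^ n) k ⟩
  D^ (suc n) δ k ∎
  where
  p = oneMinusT ^ₚ n
  minus : ∀ a b → + 1 * a + - (+ 1) * b ≡ a - b
  minus = solve-∀
  neg : ∀ k → coeff ((- (+ 1) ∷ []) ⊗ p) k ≡ - (+ 1) * coeff p k
  neg zero    = trans (coeff-∷-⊗ (- (+ 1)) [] p 0) (ℤP.+-identityʳ _)
  neg (suc k) = trans (coeff-∷-⊗ (- (+ 1)) [] p (suc k)) (ℤP.+-identityʳ _)

coeff-sumTo : ∀ d (g : ℕ → Poly) k → coeff (sumTo _⊕_ [] d g) k ≡ ∑[ i < suc d ] coeff (g i) k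
coeff-sumTo zero    g k = sym (ℤP.+-identityˡ _)
coeff-sumTo (suc d) g k = trans (coeff-⊕ (sumTo _⊕_ [] d g) _ k) (cong (_+ coeff (g (suc d)) k) (coeff-sumTo d g k))

hVec≡∑ : ∀ f d k → hVec f d k ≡ ∑[ i < suc d ] (+ f i * E^ i (D^ (d ℕ.∸ i) δ) k)
hVec≡∑ f d k = trans (coeff-sumTo d _ k) (∑<-cong (suc d) λ i →
  trans (coeff-scale (+ f i) ((tPoly ^ₚ i) ⊗ (oneMinusT ^ₚ (d ℕ.∸ i))) k)
    (cong (+ f i *_) (trans (coeff-t^⊗ i _ k) (E^-cong i (coeff-[1-t]^ (d ℕ.∸ i)) k))))

-- The coefficients of (t / (1 − t))ᵏ, which count the compositions of ℓ into k positive parts.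
compositions : ℕ → Seq
compositions zero    = δ
compositions (suc k) ℓ = ∑< ℓ (compositions k)

-- Both sides are tⁱ (1 - t)ʲ. On the right the exponent of 1 - t is i + j, which is the same d for
-- every term of the h-polynomial, so that `D^ d` can be taken out of the sum.
E^D^δ : ∀ i j → E^ i (D^ j δ) ≗ D^ (i ℕ.+ j) (compositions i)
E^D^δ zero    j k = refl
E^D^δ (suc i) j k = begin
  E (E^ i (D^ j δ)) k                              ≡⟨ E-cong (E^D^δ i j) k ⟩
  E (D^ (i ℕ.+ j) (compositions i)) k              ≡⟨ E-D^ (i ℕ.+ j) (compositions i) k ⟩
  D^ (i ℕ.+ j) (E (compositions i)) k              ≡⟨ D^-cong (i ℕ.+ j) (λ ℓ → sym (D-∑ (compositions i) ℓ)) k ⟩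
  D^ (i ℕ.+ j) (D (compositions (suc i))) k        ≡⟨ sym (D^-suc (i ℕ.+ j) _ k) ⟩
  D^ (suc i ℕ.+ j) (compositions (suc i)) k        ∎

hVec≡D^ : ∀ f d k → hVec f d k ≡ D^ d (λ ℓ → ∑[ i < suc d ] (+ f i * compositions i ℓ)) k
hVec≡D^ f d k = begin
  hVec f d k
    ≡⟨ hVec≡∑ f d k ⟩
  ∑[ i < suc d ] (+ f i * E^ i (D^ (d ℕ.∸ i) δ) k)
    ≡⟨ ∑<-cong-< (suc d) (λ i i≤d → cong (+ f i *_) (trans (E^D^δ i (d ℕ.∸ i) k)
         (cong (λ e → D^ e (compositions i) k) (ℕP.m+[n∸m]≡n (ℕ.s≤s⁻¹ i≤d))))) ⟩
  ∑[ i < suc d ] (+ f i * D^ d (compositions i) k)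
    ≡⟨ ∑<-cong (suc d) (λ i → sym (D^-* d (+ f i) (compositions i) k)) ⟩
  ∑[ i < suc d ] D^ d (λ ℓ → + f i * compositions i ℓ) k
    ≡⟨ sym (D^-∑< d (suc d) (λ i ℓ → + f i * compositions i ℓ) k) ⟩
  D^ d (λ ℓ → ∑[ i < suc d ] (+ f i * compositions i ℓ)) k ∎

-- The degree bound for (1 - t)ʲ, without which a homogenization in degree j would lose terms.
D^δ-vanishes : ∀ j k → j < k → D^ j δ k ≡ + 0
D^δ-vanishes zero    (suc k) _         = refl
D^δ-vanishes (suc j) (suc k) (s≤s j<k) = cong₂ _-_ (D^δ-vanishes j (suc k) (ℕP.m<n⇒m<1+n j<k)) (D^δ-vanishes j k j<k)

module Homogenize (x : ℤ) where

  -- The value at (x , x + 1) of the degree d homogenization of Σ c_k tᵏ; there 1 − t becomes (x + 1) − x = 1.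
  homogenize : ℕ → Seq → ℤ
  homogenize d c = ∑[ k < suc d ] (c k * (x ^ k * (+ 1 + x) ^ (d ℕ.∸ k)))

  homogenize-cong : ∀ d {c c′} → c ≗ c′ → homogenize d c ≡ homogenize d c′
  homogenize-cong d e = ∑<-cong (suc d) λ k → cong (_* (x ^ k * (+ 1 + x) ^ (d ℕ.∸ k))) (e k)

  homogenize-E : ∀ d c → homogenize (suc d) (E c) ≡ x * homogenize d c
  homogenize-E d c = begin
    homogenize (suc d) (E c)
      ≡⟨ ∑<-head (suc d) _ ⟩
    + 0 * (+ 1 * (+ 1 + x) ^ suc d) + ∑[ k < suc d ] (c k * (x * x ^ k * (+ 1 + x) ^ (d ℕ.∸ k)))
      ≡⟨ trans (cong (_+ R) (ℤP.*-zeroˡ (+ 1 * (+ 1 + x) ^ suc d))) (ℤP.+-identityˡ R) ⟩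
    ∑[ k < suc d ] (c k * (x * x ^ k * (+ 1 + x) ^ (d ℕ.∸ k)))
      ≡⟨ ∑<-cong (suc d) (λ k → pull (c k) x (x ^ k) _) ⟩
    ∑[ k < suc d ] (x * (c k * (x ^ k * (+ 1 + x) ^ (d ℕ.∸ k))))
      ≡⟨ ∑<-*ˡ x (suc d) _ ⟩
    x * homogenize d c ∎
    where
    R = ∑[ k < suc d ] (c k * (x * x ^ k * (+ 1 + x) ^ (d ℕ.∸ k)))
    pull : ∀ c x a b → c * (x * a * b) ≡ x * (c * (a * b))
    pull = solve-∀

  -- Raising the degree by one gives each old term another factor of the homogenizing variable, here
  -- 1 + x; the hypothesis excludes a new term.
  homogenize-suc : ∀ d c → c (suc d) ≡ + 0 → homogenize (suc d) c ≡ (+ 1 + x) * homogenize d c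
  homogenize-suc d c c≡0 = begin
    ∑[ k < suc d ] (c k * (x ^ k * (+ 1 + x) ^ (suc d ℕ.∸ k))) + c (suc d) * (x ^ suc d * (+ 1 + x) ^ (d ℕ.∸ d))
      ≡⟨ cong₂ _+_ (∑<-cong-< (suc d) λ k k≤d → trans (cong (λ e → c k * (x ^ k * (+ 1 + x) ^ e)) (ℕP.+-∸-assoc 1 (ℕ.s≤s⁻¹ k≤d)))
                     (pull (c k) (x ^ k) (+ 1 + x) _))
                   (trans (cong (_* (x ^ suc d * (+ 1 + x) ^ (d ℕ.∸ d))) c≡0) (ℤP.*-zeroˡ (x ^ suc d * (+ 1 + x) ^ (d ℕ.∸ d)))) ⟩
    ∑[ k < suc d ] ((+ 1 + x) * (c k * (x ^ k * (+ 1 + x) ^ (d ℕ.∸ k)))) + + 0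
      ≡⟨ trans (ℤP.+-identityʳ _) (∑<-*ˡ (+ 1 + x) (suc d) _) ⟩
    (+ 1 + x) * homogenize d c ∎
    where
    pull : ∀ c a y b → c * (a * (y * b)) ≡ y * (c * (a * b))
    pull = solve-∀

  homogenize-D : ∀ d c → c (suc d) ≡ + 0 → homogenize (suc d) (D c) ≡ homogenize d c
  homogenize-D d c c≡0 = begin
    homogenize (suc d) (D c)
      ≡⟨ ∑<-cong (suc (suc d)) (λ k → distrib (c k) (E c k) _) ⟩
    ∑[ k < suc (suc d) ] (c k * (x ^ k * (+ 1 + x) ^ (suc d ℕ.∸ k)) - E c k * (x ^ k * (+ 1 + x) ^ (suc d ℕ.∸ k)))
      ≡⟨ ∑<-minus (suc (suc d)) _ _ ⟩
    homogenize (suc d) c - homogenize (suc d) (E c)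
      ≡⟨ cong₂ _-_ (homogenize-suc d c c≡0) (homogenize-E d c) ⟩
    (+ 1 + x) * homogenize d c - x * homogenize d c
      ≡⟨ cancel x (homogenize d c) ⟩
    homogenize d c ∎
    where
    distrib : ∀ a b z → (a - b) * z ≡ a * z - b * z
    distrib = solve-∀
    cancel : ∀ x h → (+ 1 + x) * h - x * h ≡ h
    cancel = solve-∀

  homogenize-D^δ : ∀ j → homogenize j (D^ j δ) ≡ + 1
  homogenize-D^δ zero    = refl
  homogenize-D^δ (suc j) = trans (homogenize-D j (D^ j δ) (D^δ-vanishes j (suc j) ℕP.≤-refl)) (homogenize-D^δ j)

  homogenize-E^D^δ : ∀ i j → homogenize (i ℕ.+ j) (E^ i (D^ j δ)) ≡ x ^ i
  homogenize-E^D^δ zero    j = homogenize-D^δ j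
  homogenize-E^D^δ (suc i) j = trans (homogenize-E (i ℕ.+ j) _) (cong (x *_) (homogenize-E^D^δ i j))

  -- The summand tⁱ (1 - t)ᵈ⁻ⁱ of the h-polynomial takes the value xⁱ, so homogenizing undoes the
  -- passage from face numbers to the h-vector.
  homogenize-hVec : ∀ f d → homogenize d (hVec f d) ≡ ∑[ i < suc d ] (+ f i * x ^ i)
  homogenize-hVec f d = begin
    homogenize d (hVec f d)
      ≡⟨ homogenize-cong d (hVec≡∑ f d) ⟩
    ∑[ k < suc d ] ((∑[ i < suc d ] (+ f i * E^ i (D^ (d ℕ.∸ i) δ) k)) * (x ^ k * (+ 1 + x) ^ (d ℕ.∸ k)))
      ≡⟨ ∑<-cong (suc d) (λ k → sym (∑<-*ʳ (x ^ k * (+ 1 + x) ^ (d ℕ.∸ k)) (suc d) _)) ⟩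
    ∑[ k < suc d ] ∑[ i < suc d ] (+ f i * E^ i (D^ (d ℕ.∸ i) δ) k * (x ^ k * (+ 1 + x) ^ (d ℕ.∸ k)))
      ≡⟨ ∑<-swap (suc d) (suc d) _ ⟩
    ∑[ i < suc d ] ∑[ k < suc d ] (+ f i * E^ i (D^ (d ℕ.∸ i) δ) k * (x ^ k * (+ 1 + x) ^ (d ℕ.∸ k)))
      ≡⟨ ∑<-cong-< (suc d) (λ i i≤d → trans (trans (∑<-cong (suc d) λ k → ℤP.*-assoc (+ f i) _ _) (∑<-*ˡ (+ f i) (suc d) _))
           (cong (+ f i *_) (term i (ℕ.s≤s⁻¹ i≤d)))) ⟩
    ∑[ i < suc d ] (+ f i * x ^ i) ∎
    where
    term : ∀ i → i ≤ d → homogenize d (E^ i (D^ (d ℕ.∸ i) δ)) ≡ x ^ i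
    term i i≤d = trans (cong (λ e → homogenize e (E^ i (D^ (d ℕ.∸ i) δ))) (sym (ℕP.m+[n∸m]≡n i≤d))) (homogenize-E^D^δ i (d ℕ.∸ i))

-- The index d - k is the rank of the last letter d + 1 - k. It turns `Q` into xᵏ (x + 1)ᵈ⁻ᵏ, the
-- factor of the k-th coefficient in the homogenization.
∑-hVec-Q : ∀ f d N → ∑[ k < suc d ] (hVec f d k * Q d (d ℕ.∸ k) N) ≡ ∑[ i < suc d ] (+ f i * (+ N) ^ i)
∑-hVec-Q f d N = trans
  (∑<-cong-< (suc d) λ k k≤d → cong (λ e → hVec f d k * ((+ N) ^ e * (+ suc N) ^ (d ℕ.∸ k))) (ℕP.m∸[m∸n]≡n (ℕ.s≤s⁻¹ k≤d)))
  (Homogenize.homogenize-hVec (+ N) f d)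

∑-hVec-DQ : ∀ f d N → ∑[ k < suc d ] (hVec f d k * D (Q d (d ℕ.∸ k)) N) ≡ D (λ N → ∑[ i < suc d ] (+ f i * (+ N) ^ i)) N
∑-hVec-DQ f d N = begin
  ∑[ k < suc d ] (hVec f d k * D (Q d (d ℕ.∸ k)) N)
    ≡⟨ ∑<-cong (suc d) (λ k → sym (D-* (hVec f d k) (Q d (d ℕ.∸ k)) N)) ⟩
  ∑[ k < suc d ] D (λ N → hVec f d k * Q d (d ℕ.∸ k) N) N
    ≡⟨ sym (D-∑< (suc d) (λ k N → hVec f d k * Q d (d ℕ.∸ k) N) N) ⟩
  D (λ N → ∑[ k < suc d ] (hVec f d k * Q d (d ℕ.∸ k) N)) N
    ≡⟨ D-cong (∑-hVec-Q f d) N ⟩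
  D (λ N → ∑[ i < suc d ] (+ f i * (+ N) ^ i)) N ∎

-- Cliques and weak chains

select-∷ : (p : A → Bool) (x : A) (xs : List A) → select p (x ∷ xs) ≡ (if p x then x ∷ select p xs else select p xs)
select-∷ p x xs with p x
... | true  = refl
... | false = refl

select-cong : {P : A → Set} {p q : A → Bool} {xs : List A} → All P xs → (∀ x → P x → p x ≡ q x) → select p xs ≡ select q xs
select-cong [] e = refl
select-cong {p = p} {q} {x ∷ xs} (px ∷ pxs) e
  rewrite select-∷ p x xs | select-∷ q x xs | e x px | select-cong {p = p} {q} pxs e = refl

select-select : (p q : A → Bool) (xs : List A) → select p (select q xs) ≡ select (λ x → q x ∧ p x) xs
select-select p q []       = refl
select-select p q (x ∷ xs) with q x
... | false = select-select p q xs
... | true  with p x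
...   | true  = cong (x ∷_) (select-select p q xs)
...   | false = select-select p q xs

select-comm : (p q : A → Bool) (xs : List A) → select p (select q xs) ≡ select q (select p xs)
select-comm p q xs = trans (select-select p q xs)
  (trans (select-cong (All.universal {P = λ _ → ⊤} (λ _ → tt) xs) (λ x _ → BoolP.∧-comm (q x) (p x))) (sym (select-select q p xs)))

∑-sublists-select : (p : A → Bool) (xs : List A) (F : List A → ℤ) →
  ∑ (sublists (select p xs)) F ≡ ∑ (sublists xs) (λ c → ⟦ allB p c ⟧ * F c)
∑-sublists-select p []       F = cong (_+ + 0) (sym (ℤP.*-identityˡ (F [])))
∑-sublists-select p (x ∷ xs) F = trans (split (p x) refl) (sym (trans (∑-++ (sublists xs) _ _)
    (cong (_+_ (∑ (sublists xs) (λ c → ⟦ allB p c ⟧ * F c))) (∑-map (x ∷_) (sublists xs) _))))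
  where
  split : ∀ b → p x ≡ b → ∑ (sublists (select p (x ∷ xs))) F
    ≡ ∑ (sublists xs) (λ c → ⟦ allB p c ⟧ * F c) + ∑ (sublists xs) (λ c → ⟦ p x ∧ allB p c ⟧ * F (x ∷ c))
  split true px rewrite select-∷ p x xs | px = trans (∑-++ (sublists (select p xs)) _ F)
    (cong₂ _+_ (∑-sublists-select p xs F) (trans (∑-map (x ∷_) (sublists (select p xs)) F) (∑-sublists-select p xs (λ c → F (x ∷ c)))))
  split false px rewrite select-∷ p x xs | px = trans (∑-sublists-select p xs F)
    (sym (trans (cong (_+_ (∑ (sublists xs) (λ c → ⟦ allB p c ⟧ * F c)))
      (trans (∑-cong (sublists xs) (λ c → ℤP.*-zeroˡ (F (x ∷ c)))) (∑-zero (sublists xs)))) (ℤP.+-identityʳ _)))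

allB-∧ : (p q : A → Bool) (xs : List A) → allB (λ x → p x ∧ q x) xs ≡ allB p xs ∧ allB q xs
allB-∧ p q []       = refl
allB-∧ p q (x ∷ xs) = trans (cong ((p x ∧ q x) ∧_) (allB-∧ p q xs)) (interchange (p x) (q x) (allB p xs) (allB q xs))
  where
  interchange : ∀ a b c d → (a ∧ b) ∧ (c ∧ d) ≡ (a ∧ c) ∧ (b ∧ d)
  interchange true  b true  d = refl
  interchange true  b false d = BoolP.∧-zeroʳ b
  interchange false b c     d = refl

-- The parameter `x` stands for an entry listed before `y`. Larger entries come first, so `le x y`
-- fails and only one of the two alternatives in a symmetric adjacency survives.
module Cliques {A : Set} (adj le : A → A → Bool)
  (adj≡le : ∀ x y → le x y ≡ false → le y y ≡ true → adj x y ≡ le y x) where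

  cliques : List A → Seq
  cliques L k = ∑ (sublists L) λ c → ⟦ allPairsB adj c ⟧ * ⟦ ⌊ length c ℕ.≟ k ⌋ ⟧

  -- Each choice filters the whole remaining list, so a later entry is compared with all earlier
  -- ones and not just with its predecessor.
  weakChains : List A → Seq
  weakChains L zero    = + 1
  weakChains L (suc ℓ) = ∑ L λ p → weakChains (select (le p) L) ℓ

  -- A reversed linear extension: sublists, and with them cliques, are then listed from the top
  -- down.
  record Descending (L : List A) : Set where
    constructor _,_
    field
      reflexive  : All (λ p → le p p ≡ true) L
      descending : AllPairs (λ p q → le p q ≡ false) L

  Descending-select : ∀ p {L} → Descending L → Descending (select p L)
  Descending-select p (rs , ds) = AllP.filter⁺ (λ x → p x Bool.≟ true) rs , AllPairsP.filter⁺ (λ x → p x Bool.≟ true) ds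

  below : A → List A → List A
  below x = select (λ y → le y x)

  cliques-∷ : ∀ x L k → cliques (x ∷ L) k ≡ cliques L k + E (cliques (select (adj x) L)) k
  cliques-∷ x L k = trans (∑-++ (sublists L) _ _) (cong (_+_ (cliques L k)) (trans (∑-map (x ∷_) (sublists L) _) (with-x k)))
    where
    with-x : ∀ k → ∑ (sublists L) (λ c → ⟦ allB (adj x) c ∧ allPairsB adj c ⟧ * ⟦ ⌊ suc (length c) ℕ.≟ k ⌋ ⟧)
      ≡ E (cliques (select (adj x) L)) k
    with-x zero    = trans (∑-cong (sublists L) (λ c → ℤP.*-zeroʳ ⟦ allB (adj x) c ∧ allPairsB adj c ⟧)) (∑-zero (sublists L))
    with-x (suc k) = trans (∑-cong (sublists L) λ c → trans
        (cong₂ (λ a b → a * ⟦ b ⟧) (⟦∧⟧ (allB (adj x) c) (allPairsB adj c))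
          (⌊⌋-ext (suc (length c) ℕ.≟ suc k) (length c ℕ.≟ k) ℕP.suc-injective (cong suc)))
        (ℤP.*-assoc ⟦ allB (adj x) c ⟧ _ _))
      (sym (∑-sublists-select (adj x) L (λ c → ⟦ allPairsB adj c ⟧ * ⟦ ⌊ length c ℕ.≟ k ⌋ ⟧)))

  weakChains-[x] : ∀ x → le x x ≡ true → ∀ ℓ → weakChains (x ∷ []) ℓ ≡ + 1
  weakChains-[x] x x≤x zero    = refl
  weakChains-[x] x x≤x (suc ℓ) rewrite select-∷ (le x) x [] | x≤x = trans (ℤP.+-identityʳ _) (weakChains-[x] x x≤x ℓ)

  -- Nothing in `L` lies above `x`, so once `x` occurs only `x` can follow. A weak chain either
  -- avoids `x` or consists of i < ℓ entries from `below x L` followed by ℓ - i copies of `x`.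
  weakChains-∷ : ∀ ℓ x L → le x x ≡ true → All (λ y → le x y ≡ false) L →
    weakChains (x ∷ L) ℓ ≡ weakChains L ℓ + ∑< ℓ (weakChains (below x L))
  weakChains-∷ zero    x L x≤x x≰L = refl
  weakChains-∷ (suc ℓ) x L x≤x x≰L = begin
    weakChains (select (le x) (x ∷ L)) ℓ + ∑ L (λ p → weakChains (select (le p) (x ∷ L)) ℓ)
      ≡⟨ cong₂ _+_ (trans (cong (λ M → weakChains M ℓ) only-x) (weakChains-[x] x x≤x ℓ))
                   (trans (∑-cong L λ p → from p (le p x) refl) (∑-+ L (λ p → weakChains (select (le p) L) ℓ) _)) ⟩
    + 1 + (weakChains L (suc ℓ) + ∑ L (λ p → ⟦ le p x ⟧ * ∑[ i < ℓ ] weakChains (select (le p) L₁) i))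
      ≡⟨ cong (λ z → + 1 + (weakChains L (suc ℓ) + z)) (trans (sym (∑-select (λ y → le y x) L _)) (∑-∑< L₁ ℓ _)) ⟩
    + 1 + (weakChains L (suc ℓ) + ∑[ i < ℓ ] weakChains L₁ (suc i))
      ≡⟨ swap (weakChains L (suc ℓ)) _ ⟩
    weakChains L (suc ℓ) + (+ 1 + ∑[ i < ℓ ] weakChains L₁ (suc i))
      ≡⟨ cong (_+_ (weakChains L (suc ℓ))) (sym (∑<-head ℓ (weakChains L₁))) ⟩
    weakChains L (suc ℓ) + ∑< (suc ℓ) (weakChains L₁) ∎
    where
    L₁ = below x L
    swap : ∀ a b → + 1 + (a + b) ≡ a + (+ 1 + b)
    swap = solve-∀
    only-x : select (le x) (x ∷ L) ≡ x ∷ []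
    only-x rewrite select-∷ (le x) x L | x≤x = cong (x ∷_)
      (filter-none (λ y → le x y Bool.≟ true) (All.map (λ {y} e e′ → contradiction (trans (sym e) e′) λ ()) x≰L))
    from : ∀ p b → le p x ≡ b → weakChains (select (le p) (x ∷ L)) ℓ
      ≡ weakChains (select (le p) L) ℓ + ⟦ le p x ⟧ * ∑[ i < ℓ ] weakChains (select (le p) L₁) i
    from p false px rewrite select-∷ (le p) x L | px =
      sym (trans (cong (_+_ (weakChains (select (le p) L) ℓ)) (ℤP.*-zeroˡ (∑[ i < ℓ ] weakChains (select (le p) L₁) i))) (ℤP.+-identityʳ _))
    from p true  px rewrite select-∷ (le p) x L | px =
      trans (weakChains-∷ ℓ x (select (le p) L) x≤x (AllP.filter⁺ (λ y → le p y Bool.≟ true) x≰L))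
        (cong (_+_ (weakChains (select (le p) L) ℓ)) (trans
          (∑<-cong ℓ λ i → cong (λ M → weakChains M i) (select-comm (λ y → le y x) (le p) L))
          (sym (ℤP.*-identityˡ _))))

  -- A weak chain is a clique together with positive multiplicities of its elements.
  ∑-cliques≡weakChains : ∀ K L ℓ → Descending L → length L ≤ K →
    ∑[ k < suc K ] (cliques L k * compositions k ℓ) ≡ weakChains L ℓ
  ∑-cliques≡weakChains K [] ℓ _ _ = begin
    ∑[ k < suc K ] (cliques [] k * compositions k ℓ)
      ≡⟨ ∑<-head K _ ⟩
    + 1 * δ ℓ + ∑[ k < K ] (+ 0 * compositions (suc k) ℓ)
      ≡⟨ cong₂ _+_ (ℤP.*-identityˡ (δ ℓ)) (trans (∑<-cong K (λ k → ℤP.*-zeroˡ (compositions (suc k) ℓ))) (∑<-zero K)) ⟩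
    δ ℓ + + 0
      ≡⟨ trans (ℤP.+-identityʳ (δ ℓ)) (one ℓ) ⟩
    weakChains [] ℓ ∎
    where
    one : ∀ ℓ → δ ℓ ≡ weakChains [] ℓ
    one zero    = refl
    one (suc ℓ) = refl
  ∑-cliques≡weakChains (suc K) (x ∷ L) ℓ (x≤x ∷ L≤L , x≰L ∷ L≰) (s≤s |L|) = begin
    ∑[ k < suc (suc K) ] (cliques (x ∷ L) k * compositions k ℓ)
      ≡⟨ ∑<-cong (suc (suc K)) (λ k → trans (cong (_* compositions k ℓ) (cliques-∷ x L k)) (ℤP.*-distribʳ-+ (compositions k ℓ) (cliques L k) _)) ⟩
    ∑[ k < suc (suc K) ] (cliques L k * compositions k ℓ + E (cliques (select (adj x) L)) k * compositions k ℓ)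
      ≡⟨ ∑<-+ (suc (suc K)) _ _ ⟩
    ∑[ k < suc (suc K) ] (cliques L k * compositions k ℓ) + ∑[ k < suc (suc K) ] (E (cliques (select (adj x) L)) k * compositions k ℓ)
      ≡⟨ cong₂ _+_ (∑-cliques≡weakChains (suc K) L ℓ (L≤L , L≰) (ℕP.m≤n⇒m≤1+n |L|)) upper ⟩
    weakChains L ℓ + ∑< ℓ (weakChains L₁)
      ≡⟨ sym (weakChains-∷ ℓ x L x≤x x≰L) ⟩
    weakChains (x ∷ L) ℓ ∎
    where
    L₁ = below x L
    L₁≡ : select (adj x) L ≡ L₁
    L₁≡ = select-cong {p = adj x} (All.zip (x≰L , L≤L)) λ y (x≰y , y≤y) → adj≡le x y x≰y y≤y
    upper : ∑[ k < suc (suc K) ] (E (cliques (select (adj x) L)) k * compositions k ℓ) ≡ ∑< ℓ (weakChains L₁)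
    upper = begin
      ∑[ k < suc (suc K) ] (E (cliques (select (adj x) L)) k * compositions k ℓ)
        ≡⟨ cong (λ M → ∑[ k < suc (suc K) ] (E (cliques M) k * compositions k ℓ)) L₁≡ ⟩
      ∑[ k < suc (suc K) ] (E (cliques L₁) k * compositions k ℓ)
        ≡⟨ ∑<-head (suc K) _ ⟩
      + 0 * δ ℓ + ∑[ k < suc K ] (cliques L₁ k * ∑< ℓ (compositions k))
        ≡⟨ trans (cong (_+ R) (ℤP.*-zeroˡ (δ ℓ))) (ℤP.+-identityˡ R) ⟩
      ∑[ k < suc K ] (cliques L₁ k * ∑< ℓ (compositions k))
        ≡⟨ ∑<-cong (suc K) (λ k → sym (∑<-*ˡ (cliques L₁ k) ℓ (compositions k))) ⟩
      ∑[ k < suc K ] ∑[ i < ℓ ] (cliques L₁ k * compositions k i)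
        ≡⟨ ∑<-swap (suc K) ℓ _ ⟩
      ∑[ i < ℓ ] ∑[ k < suc K ] (cliques L₁ k * compositions k i)
        ≡⟨ ∑<-cong ℓ (λ i → ∑-cliques≡weakChains K L₁ i (Descending-select _ (L≤L , L≰)) (ℕP.≤-trans (length-filter _ L) |L|)) ⟩
      ∑< ℓ (weakChains L₁) ∎
      where R = ∑[ k < suc K ] (cliques L₁ k * ∑< ℓ (compositions k))

  -- The predicate `q` is arbitrary because the recursion accumulates one filter for each chosen
  -- entry. It also allows the multichain condition to be moved from the alphabet to the tuples.
  weakChains-select : ∀ ℓ q L → weakChains (select q L) ℓ
    ≡ ∑ (tuples L ℓ) (λ w → ⟦ allB q (toList w) ∧ allPairsB le (toList w) ⟧)
  weakChains-select zero    q L = refl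
  weakChains-select (suc ℓ) q L = begin
    ∑ (select q L) (λ p → weakChains (select (le p) (select q L)) ℓ)
      ≡⟨ ∑-select q L _ ⟩
    ∑ L (λ p → ⟦ q p ⟧ * weakChains (select (le p) (select q L)) ℓ)
      ≡⟨ ∑-cong L (λ p → cong (⟦ q p ⟧ *_) (trans (cong (λ M → weakChains M ℓ) (select-select (le p) q L)) (weakChains-select ℓ _ L))) ⟩
    ∑ L (λ p → ⟦ q p ⟧ * ∑ (tuples L ℓ) (λ w → ⟦ allB (λ y → q y ∧ le p y) (toList w) ∧ allPairsB le (toList w) ⟧))
      ≡⟨ ∑-cong L (λ p → trans (sym (∑-*ˡ ⟦ q p ⟧ (tuples L ℓ) _)) (∑-cong (tuples L ℓ) λ w → merge p (toList w))) ⟩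
    ∑ L (λ p → ∑ (tuples L ℓ) (λ w → ⟦ (q p ∧ allB q (toList w)) ∧ (allB (le p) (toList w) ∧ allPairsB le (toList w)) ⟧))
      ≡⟨ sym (∑-tuples-suc L ℓ _) ⟩
    ∑ (tuples L (suc ℓ)) (λ w → ⟦ allB q (toList w) ∧ allPairsB le (toList w) ⟧) ∎
    where
    merge : ∀ p w → ⟦ q p ⟧ * ⟦ allB (λ y → q y ∧ le p y) w ∧ allPairsB le w ⟧
      ≡ ⟦ (q p ∧ allB q w) ∧ (allB (le p) w ∧ allPairsB le w) ⟧
    merge p w = trans (sym (⟦∧⟧ (q p) _)) (cong ⟦_⟧ (begin
      q p ∧ (allB (λ y → q y ∧ le p y) w ∧ allPairsB le w)            ≡⟨ cong (λ b → q p ∧ (b ∧ allPairsB le w)) (allB-∧ q (le p) w) ⟩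
      q p ∧ ((allB q w ∧ allB (le p) w) ∧ allPairsB le w)             ≡⟨ cong (q p ∧_) (BoolP.∧-assoc (allB q w) _ _) ⟩
      q p ∧ (allB q w ∧ (allB (le p) w ∧ allPairsB le w))             ≡⟨ sym (BoolP.∧-assoc (q p) _ _) ⟩
      (q p ∧ allB q w) ∧ (allB (le p) w ∧ allPairsB le w)             ∎))

-- Interlacing multichains

∧-true⁻ : ∀ {b c} → b ∧ c ≡ true → b ≡ true × c ≡ true
∧-true⁻ {true} {true} _ = refl , refl

∧-true⁺ : ∀ {b c} → b ≡ true → c ≡ true → b ∧ c ≡ true
∧-true⁺ refl refl = refl

allB⁻ : (p : A → Bool) (xs : List A) → allB p xs ≡ true → All (λ x → p x ≡ true) xs
allB⁻ p []       _ = []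
allB⁻ p (x ∷ xs) e = let px , pxs = ∧-true⁻ e in px ∷ allB⁻ p xs pxs

allB⁺ : (p : A → Bool) {xs : List A} → All (λ x → p x ≡ true) xs → allB p xs ≡ true
allB⁺ p []         = refl
allB⁺ p (px ∷ pxs) = ∧-true⁺ px (allB⁺ p pxs)

-- A tuple of multichains is a matrix with the multichains as rows; this prepares the removal of its
-- columns one at a time.
∑-tuples-zipWith : (F : List A) (r ℓ : ℕ) (f : Vec (Vec A (suc r)) ℓ → ℤ) →
  ∑ (tuples (tuples F (suc r)) ℓ) f ≡ ∑ (tuples F ℓ) (λ a → ∑ (tuples (tuples F r) ℓ) (λ B → f (Vec.zipWith _∷_ a B)))
∑-tuples-zipWith F r zero    f = sym (ℤP.+-identityʳ _)
∑-tuples-zipWith F r (suc ℓ) f = begin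
  ∑ (tuples (tuples F (suc r)) (suc ℓ)) f
    ≡⟨ trans (∑-tuples-suc (tuples F (suc r)) ℓ f) (∑-tuples-suc F r _) ⟩
  ∑ F (λ x → ∑ R (λ p → ∑ (tuples (tuples F (suc r)) ℓ) (λ C → f ((x ∷ p) ∷ C))))
    ≡⟨ ∑-cong F (λ x → ∑-cong R λ p → ∑-tuples-zipWith F r ℓ _) ⟩
  ∑ F (λ x → ∑ R (λ p → ∑ (tuples F ℓ) (λ a → ∑ (tuples R ℓ) (λ B → f ((x ∷ p) ∷ Vec.zipWith _∷_ a B)))))
    ≡⟨ ∑-cong F (λ x → ∑-swap R (tuples F ℓ) _) ⟩
  ∑ F (λ x → ∑ (tuples F ℓ) (λ a → ∑ R (λ p → ∑ (tuples R ℓ) (λ B → f ((x ∷ p) ∷ Vec.zipWith _∷_ a B)))))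
    ≡⟨ ∑-cong F (λ x → ∑-cong (tuples F ℓ) λ a → sym (∑-tuples-suc R ℓ (λ B → f (Vec.zipWith _∷_ (x ∷ a) B)))) ⟩
  ∑ F (λ x → ∑ (tuples F ℓ) (λ a → ∑ (tuples R (suc ℓ)) (λ B → f (Vec.zipWith _∷_ (x ∷ a) B))))
    ≡⟨ sym (∑-tuples-suc F ℓ _) ⟩
  ∑ (tuples F (suc ℓ)) (λ a → ∑ (tuples R (suc ℓ)) (λ B → f (Vec.zipWith _∷_ a B))) ∎
  where R = tuples F r

∑-tuples-[x] : (x : A) (n : ℕ) → ∑ (tuples (x ∷ []) n) (λ _ → + 1) ≡ + 1
∑-tuples-[x] x zero    = refl
∑-tuples-[x] x (suc n) = trans (∑-tuples-suc (x ∷ []) n (λ _ → + 1)) (trans (ℤP.+-identityʳ _) (∑-tuples-[x] x n))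

module Interlacing {A : Set} (sub : A → A → Bool)
  (sub-refl : ∀ a → sub a a ≡ true)
  (sub-trans : ∀ {a b c} → sub a b ≡ true → sub b c ≡ true → sub a c ≡ true) where

  infix 4 _⊑_ _≼_

  _⊑_ : A → A → Set
  a ⊑ b = sub a b ≡ true

  chainB : ∀ {r} → Vec A r → Bool
  chainB []          = true
  chainB (a ∷ [])    = true
  chainB (a ∷ b ∷ p) = sub a b ∧ chainB (b ∷ p)

  -- For `subB` this is `precI` by definition, so results about it transfer without conversion.
  interlaceB : ∀ {r} → Vec A r → Vec A r → Bool
  interlaceB {r} p q =
    allB (λ t → allB (λ s → if ⌊ s F.<? t ⌋ then sub (Vec.lookup q s) (Vec.lookup p t) else sub (Vec.lookup p t) (Vec.lookup q s))
      (allFin r)) (allFin r)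

  -- A recursive form of the interlacing condition: all comparisons that involve the first column
  -- are listed, and what remains is the same condition on the other columns.
  _≼_ : ∀ {r} → Vec A r → Vec A r → Set
  []      ≼ []      = ⊤
  (a ∷ p) ≼ (b ∷ q) = a ⊑ b × VAll (b ⊑_) p × VAll (a ⊑_) q × p ≼ q

  private
    Pairwise : ∀ {r} → Vec A r → Vec A r → Set
    Pairwise {r} p q = ∀ (t s : Fin r) →
      (if ⌊ s F.<? t ⌋ then sub (Vec.lookup q s) (Vec.lookup p t) else sub (Vec.lookup p t) (Vec.lookup q s)) ≡ true

    ≼⇒Pairwise : ∀ {r} (p q : Vec A r) → p ≼ q → Pairwise p q
    ≼⇒Pairwise (a ∷ p) (b ∷ q) (a⊑b , b⊑p , a⊑q , p≼q) F.zero    F.zero    = a⊑b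
    ≼⇒Pairwise (a ∷ p) (b ∷ q) (a⊑b , b⊑p , a⊑q , p≼q) F.zero    (F.suc s) = VAllP.lookup⁺ a⊑q s
    ≼⇒Pairwise (a ∷ p) (b ∷ q) (a⊑b , b⊑p , a⊑q , p≼q) (F.suc t) F.zero    = VAllP.lookup⁺ b⊑p t
    ≼⇒Pairwise (a ∷ p) (b ∷ q) (a⊑b , b⊑p , a⊑q , p≼q) (F.suc t) (F.suc s) =
      trans (cong (λ c → if c then sub (Vec.lookup q s) (Vec.lookup p t) else sub (Vec.lookup p t) (Vec.lookup q s))
        (⌊⌋-ext (F.suc s F.<? F.suc t) (s F.<? t) ℕ.s≤s⁻¹ s≤s)) (≼⇒Pairwise p q p≼q t s)

    Pairwise⇒≼ : ∀ {r} (p q : Vec A r) → Pairwise p q → p ≼ q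
    Pairwise⇒≼ []      []      h = tt
    Pairwise⇒≼ (a ∷ p) (b ∷ q) h = h F.zero F.zero , VAllP.lookup⁻ (λ t → h (F.suc t) F.zero) , VAllP.lookup⁻ (λ s → h F.zero (F.suc s)) ,
      Pairwise⇒≼ p q (λ t s → trans (cong (λ c → if c then sub (Vec.lookup q s) (Vec.lookup p t) else sub (Vec.lookup p t) (Vec.lookup q s))
        (⌊⌋-ext (s F.<? t) (F.suc s F.<? F.suc t) s≤s ℕ.s≤s⁻¹)) (h (F.suc t) (F.suc s)))

  interlaceB⁻ : ∀ {r} {p q : Vec A r} → interlaceB p q ≡ true → p ≼ q
  interlaceB⁻ {r} {p} {q} e = Pairwise⇒≼ p q λ t s → AllP.tabulate⁻ (allB⁻ _ (allFin r) (AllP.tabulate⁻ (allB⁻ _ (allFin r) e) t)) s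

  interlaceB⁺ : ∀ {r} {p q : Vec A r} → p ≼ q → interlaceB p q ≡ true
  interlaceB⁺ {r} {p} {q} p≼q = allB⁺ _ (AllP.tabulate⁺ λ t → allB⁺ _ (AllP.tabulate⁺ λ s → ≼⇒Pairwise p q p≼q t s))

  -- Interlacing of a row with itself is the multichain condition, so conditions within rows and
  -- between rows can be treated alike.
  chainB⁻ : ∀ {r} (p : Vec A r) → chainB p ≡ true → p ≼ p
  chainB⁻ []          _ = tt
  chainB⁻ (a ∷ [])    _ = sub-refl a , [] , [] , tt
  chainB⁻ (a ∷ b ∷ p) e =
    let a⊑b , e′ = ∧-true⁻ {sub a b} e
        b≼ = chainB⁻ (b ∷ p) e′
        _ , b⊑p , _ = b≼
        a⊑ = a⊑b ∷ VAll.map (sub-trans a⊑b) b⊑p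
    in sub-refl a , a⊑ , a⊑ , b≼

  chainB⁺ : ∀ {r} (p : Vec A r) → p ≼ p → chainB p ≡ true
  chainB⁺ []          _ = refl
  chainB⁺ (a ∷ [])    _ = refl
  chainB⁺ (a ∷ b ∷ p) (_ , a⊑b ∷ _ , _ , b≼) = ∧-true⁺ a⊑b (chainB⁺ (b ∷ p) b≼)

  Good : ∀ {r} → List (Vec A r) → Set
  Good []      = ⊤
  Good (p ∷ B) = p ≼ p × All (p ≼_) B × Good B

  -- In the recursion `T` is the last row's entry in the column removed before: all that is
  -- remembered of the columns to the left.
  Above : ∀ {r} → A → List (Vec A r) → Set
  Above T B = All (λ p → VAll (T ⊑_) p) B

  goodB : ∀ {r} → List (Vec A r) → Bool
  goodB B = allB chainB B ∧ allPairsB interlaceB B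

  aboveB : ∀ {r} → A → List (Vec A r) → Bool
  aboveB T B = allB (λ p → allB (sub T) (toList p)) B

  goodB⁻ : ∀ {r} (B : List (Vec A r)) → goodB B ≡ true → Good B
  goodB⁻ []      _ = tt
  goodB⁻ (p ∷ B) e with ∧-true⁻ {allB chainB (p ∷ B)} e
  ... | e₁ , e₂ with ∧-true⁻ {chainB p} e₁ | ∧-true⁻ {allB (interlaceB p) B} e₂
  ...   | cp , cB | ip , iB = chainB⁻ p cp , All.map interlaceB⁻ (allB⁻ (interlaceB p) B ip) , goodB⁻ B (∧-true⁺ cB iB)

  goodB⁺ : ∀ {r} (B : List (Vec A r)) → Good B → goodB B ≡ true
  goodB⁺ []      _ = refl
  goodB⁺ (p ∷ B) (p≼p , p≼B , good) with ∧-true⁻ {allB chainB B} (goodB⁺ B good)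
  ... | cB , iB = ∧-true⁺ {chainB p ∧ allB chainB B} (∧-true⁺ (chainB⁺ p p≼p) cB) (∧-true⁺ (allB⁺ (interlaceB p) (All.map interlaceB⁺ p≼B)) iB)

  aboveB⁻ : ∀ {r} T (B : List (Vec A r)) → aboveB T B ≡ true → Above T B
  aboveB⁻ T B e = All.map (λ {p} e′ → VAllP.toList⁻ (allB⁻ (sub T) (toList p) e′)) (allB⁻ _ B e)

  aboveB⁺ : ∀ {r} T {B : List (Vec A r)} → Above T B → aboveB T B ≡ true
  aboveB⁺ T T⊑B = allB⁺ _ (All.map (λ T⊑p → allB⁺ (sub T) (VAllP.toList⁺ T⊑p)) T⊑B)

  chainFromB : ∀ {ℓ} → A → Vec A ℓ → Bool
  chainFromB T []       = true
  chainFromB T (a ∷ as) = sub T a ∧ chainFromB a as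

  lastFrom : ∀ {ℓ} → A → Vec A ℓ → A
  lastFrom T []       = T
  lastFrom T (a ∷ as) = lastFrom a as

  glue : ∀ {r ℓ} → Vec A ℓ → Vec (Vec A r) ℓ → List (Vec A (suc r))
  glue a B = toList (Vec.zipWith _∷_ a B)

  private
    unglue : ∀ {r ℓ} {P : Vec A (suc r) → Set} {Q : Vec A r → Set} → (∀ b q → P (b ∷ q) → Q q) →
      (a : Vec A ℓ) (B : Vec (Vec A r) ℓ) → All P (glue a B) → All Q (toList B)
    unglue f []       []      []         = []
    unglue f (a ∷ as) (p ∷ B) (pz ∷ pzs) = f a p pz ∷ unglue f as B pzs

    lastFrom-⊑ : ∀ {r ℓ} {p : Vec A r} {a} (as : Vec A ℓ) (B : Vec (Vec A r) ℓ) → VAll (a ⊑_) p →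
      All (λ z → VAll (Vec.head z ⊑_) p) (glue as B) → VAll (lastFrom a as ⊑_) p
    lastFrom-⊑ []       []      a⊑p []           = a⊑p
    lastFrom-⊑ (b ∷ as) (q ∷ B) a⊑p (b⊑p ∷ rest) = lastFrom-⊑ as B b⊑p rest

    chainFrom-last : ∀ {ℓ} T (a : Vec A ℓ) → chainFromB T a ≡ true → T ⊑ lastFrom T a
    chainFrom-last T []       _ = sub-refl T
    chainFrom-last T (a ∷ as) e = let T⊑a , e′ = ∧-true⁻ e in sub-trans T⊑a (chainFrom-last a as e′)

    chainFrom-all : ∀ {ℓ} T (a : Vec A ℓ) → chainFromB T a ≡ true → VAll (_⊑ lastFrom T a) a
    chainFrom-all T []       _ = []
    chainFrom-all T (a ∷ as) e = let _ , e′ = ∧-true⁻ {sub T a} e in chainFrom-last a as e′ ∷ chainFrom-all a as e′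

    rows-≼ : ∀ {r ℓ} {a U} {p : Vec A r} (as : Vec A ℓ) (B : Vec (Vec A r) ℓ) → VAll (_⊑ U) as → VAll (U ⊑_) p →
      Above a (glue as B) → All (p ≼_) (toList B) → All ((a ∷ p) ≼_) (glue as B)
    rows-≼ []       []      []           U⊑p []                 []           = []
    rows-≼ (b ∷ as) (q ∷ B) (b⊑U ∷ as⊑U) U⊑p ((a⊑b ∷ a⊑q) ∷ a⊑B) (p≼q ∷ p≼B) =
      (a⊑b , VAll.map (sub-trans b⊑U) U⊑p , a⊑q , p≼q) ∷ rows-≼ as B as⊑U U⊑p a⊑B p≼B

  peel⁻ : ∀ {r ℓ} T (a : Vec A ℓ) (B : Vec (Vec A r) ℓ) → Good (glue a B) → Above T (glue a B) →
    chainFromB T a ≡ true × Good (toList B) × Above (lastFrom T a) (toList B)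
  peel⁻ T []       []      _ _ = refl , tt , []
  peel⁻ T (a ∷ as) (p ∷ B) ((_ , a⊑p , _ , p≼p) , ap≼ , good) ((T⊑a ∷ _) ∷ _) =
    let c , good′ , U⊑B = peel⁻ a as B good (All.map (λ { {b ∷ q} (a⊑b , _ , a⊑q , _) → a⊑b ∷ a⊑q }) ap≼) in
    ∧-true⁺ T⊑a c ,
    (p≼p , unglue (λ b q (_ , _ , _ , p≼q) → p≼q) as B ap≼ , good′) ,
    lastFrom-⊑ as B a⊑p (All.map (λ { {b ∷ q} (_ , b⊑p , _) → b⊑p }) ap≼) ∷ U⊑B

  peel⁺ : ∀ {r ℓ} T (a : Vec A ℓ) (B : Vec (Vec A r) ℓ) →
    chainFromB T a ≡ true → Good (toList B) → Above (lastFrom T a) (toList B) → Good (glue a B) × Above T (glue a B)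
  peel⁺ T []       []      _ _ _ = tt , []
  peel⁺ T (a ∷ as) (p ∷ B) c (p≼p , p≼B , good) (U⊑p ∷ U⊑B) =
    let T⊑a , c′ = ∧-true⁻ c
        good′ , a⊑B = peel⁺ a as B c′ good U⊑B
        a⊑p = VAll.map (sub-trans (chainFrom-last a as c′)) U⊑p
    in ((sub-refl a , a⊑p , a⊑p , p≼p) , rows-≼ as B (chainFrom-all a as c′) U⊑p a⊑B p≼B , good′) ,
       (T⊑a ∷ VAll.map (sub-trans T⊑a) a⊑p) ∷ All.map (VAll.map (sub-trans T⊑a)) a⊑B

  -- The first column increases from row to row, and since every row interlaces with the last one,
  -- the last entry of that column lies below all entries of the other columns. Conversely,
  -- transitivity of `sub` recovers every comparison with the first column from these facts.
  peel : ∀ {r ℓ} T (a : Vec A ℓ) (B : Vec (Vec A r) ℓ) →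
    goodB (glue a B) ∧ aboveB T (glue a B) ≡ chainFromB T a ∧ (goodB (toList B) ∧ aboveB (lastFrom T a) (toList B))
  peel T a B = ≡true-ext
    (λ e → let g , ab = ∧-true⁻ {goodB (glue a B)} e
               c , good , above = peel⁻ T a B (goodB⁻ _ g) (aboveB⁻ T _ ab)
           in ∧-true⁺ c (∧-true⁺ (goodB⁺ _ good) (aboveB⁺ _ above)))
    (λ e → let c , e′ = ∧-true⁻ {chainFromB T a} e
               g , ab = ∧-true⁻ {goodB (toList B)} e′
               good , above = peel⁺ T a B c (goodB⁻ _ g) (aboveB⁻ _ _ ab)
           in ∧-true⁺ (goodB⁺ _ good) (aboveB⁺ T above))

  module Sums (F : List A) where

    up : ℕ → (A → ℤ) → A → ℤ
    up zero    φ T = φ T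
    up (suc j) φ T = ∑ F λ S → ⟦ sub T S ⟧ * up j φ S

    down : ℕ → A → ℤ
    down zero    S = + 1
    down (suc j) S = ∑ F λ T → ⟦ sub T S ⟧ * down j T

    up-cong : ∀ j {φ ψ} → φ ≗ ψ → up j φ ≗ up j ψ
    up-cong zero    e T = e T
    up-cong (suc j) e T = ∑-cong F λ S → cong (⟦ sub T S ⟧ *_) (up-cong j e S)

    up-+ : ∀ i j φ → up i (up j φ) ≗ up (i ℕ.+ j) φ
    up-+ zero    j φ T = refl
    up-+ (suc i) j φ T = ∑-cong F λ S → cong (⟦ sub T S ⟧ *_) (up-+ i j φ S)

    ∑-chainFrom : ∀ ℓ φ T → ∑ (tuples F ℓ) (λ a → ⟦ chainFromB T a ⟧ * φ (lastFrom T a)) ≡ up ℓ φ T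
    ∑-chainFrom zero    φ T = trans (ℤP.+-identityʳ _) (ℤP.*-identityˡ (φ T))
    ∑-chainFrom (suc ℓ) φ T = trans (∑-tuples-suc F ℓ _) (∑-cong F λ S → trans
      (∑-cong (tuples F ℓ) λ a → trans (cong (_* φ (lastFrom S a)) (⟦∧⟧ (sub T S) (chainFromB S a))) (ℤP.*-assoc ⟦ sub T S ⟧ _ _))
      (trans (∑-*ˡ ⟦ sub T S ⟧ (tuples F ℓ) _) (cong (⟦ sub T S ⟧ *_) (∑-chainFrom ℓ φ S))))

    matrices : (r ℓ : ℕ) → A → ℤ
    matrices r ℓ T = ∑ (tuples (tuples F r) ℓ) λ B → ⟦ goodB (toList B) ∧ aboveB T (toList B) ⟧

    -- Column by column the interlacing conditions say that the entries form a single chain.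
    matrices≡up : ∀ r ℓ T → matrices r ℓ T ≡ up (r ℕ.* ℓ) (λ _ → + 1) T
    matrices≡up zero    ℓ T = trans (∑-cong (tuples ([] ∷ []) ℓ) λ B → cong ⟦_⟧ (∧-true⁺ (goodB⁺ _ (good B)) (aboveB⁺ T (above B)))) (∑-tuples-[x] [] ℓ)
      where
      empty-≼ : ∀ {ℓ} (B : Vec (Vec A 0) ℓ) → All ([] ≼_) (toList B)
      empty-≼ []       = []
      empty-≼ ([] ∷ B) = tt ∷ empty-≼ B
      good : ∀ {ℓ} (B : Vec (Vec A 0) ℓ) → Good (toList B)
      good []       = tt
      good ([] ∷ B) = tt , empty-≼ B , good B
      above : ∀ {ℓ} (B : Vec (Vec A 0) ℓ) → Above T (toList B)
      above []       = []
      above ([] ∷ B) = [] ∷ above B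
    matrices≡up (suc r) ℓ T = begin
      matrices (suc r) ℓ T
        ≡⟨ ∑-tuples-zipWith F r ℓ _ ⟩
      ∑ (tuples F ℓ) (λ a → ∑ (tuples (tuples F r) ℓ) (λ B → ⟦ goodB (glue a B) ∧ aboveB T (glue a B) ⟧))
        ≡⟨ ∑-cong (tuples F ℓ) (λ a → trans
             (∑-cong (tuples (tuples F r) ℓ) λ B → trans (cong ⟦_⟧ (peel T a B)) (⟦∧⟧ (chainFromB T a) _))
             (∑-*ˡ ⟦ chainFromB T a ⟧ (tuples (tuples F r) ℓ) _)) ⟩
      ∑ (tuples F ℓ) (λ a → ⟦ chainFromB T a ⟧ * matrices r ℓ (lastFrom T a))
        ≡⟨ ∑-chainFrom ℓ (matrices r ℓ) T ⟩
      up ℓ (matrices r ℓ) T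
        ≡⟨ up-cong ℓ (matrices≡up r ℓ) T ⟩
      up ℓ (up (r ℕ.* ℓ) (λ _ → + 1)) T
        ≡⟨ up-+ ℓ (r ℕ.* ℓ) _ T ⟩
      up (suc r ℕ.* ℓ) (λ _ → + 1) T ∎

    -- Both sides count multichains of j + 1 entries, by the least and by the greatest one. The
    -- marked entry is moved up one place at a time by exchanging two sums.
    ∑-up≡∑-down : ∀ j → ∑ F (up j (λ _ → + 1)) ≡ ∑ F (down j)
    ∑-up≡∑-down j = begin
      ∑ F (up j one)                              ≡⟨ ∑-cong F (λ S → sym (ℤP.*-identityˡ _)) ⟩
      ∑ F (λ S → down 0 S * up j one S)           ≡⟨ move 0 j ⟩
      ∑ F (λ S → down (j ℕ.+ 0) S * + 1)          ≡⟨ ∑-cong F (λ S → ℤP.*-identityʳ _) ⟩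
      ∑ F (down (j ℕ.+ 0))                        ≡⟨ cong (λ k → ∑ F (down k)) (ℕP.+-identityʳ j) ⟩
      ∑ F (down j)                                ∎
      where
      one : A → ℤ
      one _ = + 1
      swap : ∀ a b c → a * (b * c) ≡ b * a * c
      swap = solve-∀
      move : ∀ i j → ∑ F (λ S → down i S * up j one S) ≡ ∑ F (λ S → down (j ℕ.+ i) S * + 1)
      move i zero    = refl
      move i (suc j) = begin
        ∑ F (λ S → down i S * ∑ F (λ T → ⟦ sub S T ⟧ * up j one T))
          ≡⟨ ∑-cong F (λ S → trans (sym (∑-*ˡ (down i S) F _)) (∑-cong F λ T → swap (down i S) ⟦ sub S T ⟧ _)) ⟩
        ∑ F (λ S → ∑ F (λ T → ⟦ sub S T ⟧ * down i S * up j one T))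
          ≡⟨ ∑-swap F F _ ⟩
        ∑ F (λ T → ∑ F (λ S → ⟦ sub S T ⟧ * down i S * up j one T))
          ≡⟨ ∑-cong F (λ T → ∑-*ʳ (up j one T) F _) ⟩
        ∑ F (λ T → down (suc i) T * up j one T)
          ≡⟨ move (suc i) j ⟩
        ∑ F (λ S → down (j ℕ.+ suc i) S * + 1)
          ≡⟨ cong (λ k → ∑ F (λ S → down k S * + 1)) (ℕP.+-suc j i) ⟩
        ∑ F (λ S → down (suc j ℕ.+ i) S * + 1) ∎

-- Subsets and the order of their enumeration

⌊⌋-true⁻ : ∀ {P : Set} (p? : Dec P) → ⌊ p? ⌋ ≡ true → P
⌊⌋-true⁻ (yes p) _ = p

subB⁻ : ∀ {n} {S T : Subset n} → subB S T ≡ true → S ⊆ T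
subB⁻ {S = S} {T} = ⌊⌋-true⁻ (S ⊆? T)

subB⁺ : ∀ {n} {S T : Subset n} → S ⊆ T → subB S T ≡ true
subB⁺ {S = S} {T} = ⌊⌋-yes (S ⊆? T)

subB-refl : ∀ {n} (S : Subset n) → subB S S ≡ true
subB-refl S = subB⁺ {S = S} id

subB-trans : ∀ {n} {S T U : Subset n} → subB S T ≡ true → subB T U ≡ true → subB S U ≡ true
subB-trans {S = S} {T} {U} S⊆T T⊆U = subB⁺ {S = S} {U} (subB⁻ {S = T} {U} T⊆U ∘ subB⁻ {S = S} {T} S⊆T)

subB-⊥ : ∀ {n} (S : Subset n) → subB ⊥ S ≡ true
subB-⊥ S = subB⁺ {S = ⊥} {S} (SubsetP.⊥⊆ {p = S})

subB-in-out : ∀ {n} (T S : Subset n) → subB (inside ∷ T) (outside ∷ S) ≡ false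
subB-in-out T S = ⌊⌋-no ((inside ∷ T) ⊆? (outside ∷ S)) λ T⊆S → contradiction (T⊆S Vec.here) λ ()

subB-in-in : ∀ {n} (T S : Subset n) → subB (inside ∷ T) (inside ∷ S) ≡ subB T S
subB-in-in T S = ⌊⌋-ext ((inside ∷ T) ⊆? (inside ∷ S)) (T ⊆? S) SubsetP.drop-∷-⊆ SubsetP.in⊆in

subB-out : ∀ {n} (T : Subset n) b (S : Subset n) → subB (outside ∷ T) (b ∷ S) ≡ subB T S
subB-out T b S = ⌊⌋-ext ((outside ∷ T) ⊆? (b ∷ S)) (T ⊆? S) SubsetP.drop-∷-⊆ SubsetP.out⊆

∑-allSubsets-suc : ∀ n (f : Subset (suc n) → ℤ) →
  ∑ (allSubsets (suc n)) f ≡ ∑ (allSubsets n) (λ S → f (inside ∷ S)) + ∑ (allSubsets n) (λ S → f (outside ∷ S))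
∑-allSubsets-suc n f = trans (∑-tuples-suc (inside ∷ outside ∷ []) n f)
  (cong (_+_ (∑ (allSubsets n) (λ S → f (inside ∷ S)))) (ℤP.+-identityʳ _))

-- The binomial theorem, with the elements of `S` decided one after another.
∑-subsets : ∀ {n} x (S : Subset n) → ∑ (allSubsets n) (λ T → ⟦ subB T S ⟧ * x ^ ∣ T ∣) ≡ (+ 1 + x) ^ ∣ S ∣
∑-subsets x []      = refl
∑-subsets {suc n} x (b ∷ S) = trans (∑-allSubsets-suc n _) (trans (cong (_+_ (∑ (allSubsets n) (λ T → ⟦ subB (inside ∷ T) (b ∷ S) ⟧ * x ^ suc ∣ T ∣)))
    (trans (∑-cong (allSubsets n) λ T → cong (λ c → ⟦ c ⟧ * x ^ ∣ T ∣) (subB-out T b S)) (∑-subsets x S))) (with-head b))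
  where
  with-head : ∀ b → ∑ (allSubsets n) (λ T → ⟦ subB (inside ∷ T) (b ∷ S) ⟧ * x ^ suc ∣ T ∣) + (+ 1 + x) ^ ∣ S ∣ ≡ (+ 1 + x) ^ ∣ b ∷ S ∣
  with-head outside = trans (cong (_+ (+ 1 + x) ^ ∣ S ∣) (trans
    (∑-cong (allSubsets n) λ T → trans (cong (λ c → ⟦ c ⟧ * x ^ suc ∣ T ∣) (subB-in-out T S)) (ℤP.*-zeroˡ (x ^ suc ∣ T ∣))) (∑-zero (allSubsets n))))
    (ℤP.+-identityˡ _)
  with-head inside = begin
    ∑ (allSubsets n) (λ T → ⟦ subB (inside ∷ T) (inside ∷ S) ⟧ * x ^ suc ∣ T ∣) + (+ 1 + x) ^ ∣ S ∣
      ≡⟨ cong (_+ (+ 1 + x) ^ ∣ S ∣) (trans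
           (∑-cong (allSubsets n) λ T → trans (cong (λ c → ⟦ c ⟧ * (x * x ^ ∣ T ∣)) (subB-in-in T S)) (swap ⟦ subB T S ⟧ x (x ^ ∣ T ∣)))
           (trans (∑-*ˡ x (allSubsets n) _) (cong (x *_) (∑-subsets x S)))) ⟩
    x * (+ 1 + x) ^ ∣ S ∣ + (+ 1 + x) ^ ∣ S ∣
      ≡⟨ collect x ((+ 1 + x) ^ ∣ S ∣) ⟩
    (+ 1 + x) * (+ 1 + x) ^ ∣ S ∣ ∎
    where
    swap : ∀ a b c → a * (b * c) ≡ b * (a * c)
    swap = solve-∀
    collect : ∀ x h → x * h + h ≡ (+ 1 + x) * h
    collect = solve-∀

∑-size-0 : ∀ n (f : Subset n → ℤ) → ∑ (allSubsets n) (λ S → f S * ⟦ ⌊ ∣ S ∣ ℕ.≟ 0 ⌋ ⟧) ≡ f ⊥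
∑-size-0 zero    f = trans (ℤP.+-identityʳ _) (ℤP.*-identityʳ (f []))
∑-size-0 (suc n) f = trans (∑-allSubsets-suc n _) (trans
  (cong₂ _+_ (trans (∑-cong (allSubsets n) λ S → ℤP.*-zeroʳ (f (inside ∷ S))) (∑-zero (allSubsets n))) (∑-size-0 n (λ S → f (outside ∷ S))))
  (ℤP.+-identityˡ _))

nonemptyB⁻ : ∀ {n} (S : Subset n) → nonemptyB S ≡ true → ∣ S ∣ ≢ 0
nonemptyB⁻ S e |S|≡0 with ∣ S ∣ ℕ.≟ 0
nonemptyB⁻ S () |S|≡0 | yes _
... | no |S|≢0 = |S|≢0 |S|≡0

nonemptyB-false⁻ : ∀ {n} (S : Subset n) → nonemptyB S ≡ false → ∣ S ∣ ≡ 0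
nonemptyB-false⁻ S e with ∣ S ∣ ℕ.≟ 0
... | yes |S|≡0 = |S|≡0

infix 4 _⇒ᵇ_

_⇒ᵇ_ : Bool → Bool → Set
b ⇒ᵇ c = b ≡ true → c ≡ true

⊆⇒Pointwise : ∀ {n} (S T : Subset n) → S ⊆ T → Pointwise _⇒ᵇ_ S T
⊆⇒Pointwise []      []      _   = []
⊆⇒Pointwise (b ∷ S) (c ∷ T) S⊆T = head ∷ ⊆⇒Pointwise S T (SubsetP.drop-∷-⊆ S⊆T)
  where
  head : b ⇒ᵇ c
  head refl with S⊆T Vec.here
  ... | Vec.here = refl

-- The enumerations of Defs list larger subsets, and hence larger multichains, first.
AllPairs-tuples : {_⊑_ : A → A → Set} {xs : List A} → AllPairs (λ x y → ¬ x ⊑ y) xs →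
  ∀ n → AllPairs (λ v w → ¬ Pointwise _⊑_ v w) (tuples xs n)
AllPairs-tuples {A} {_⊑_} {xs} xs↘ zero    = [] ∷ []
AllPairs-tuples {A} {_⊑_} {xs} xs↘ (suc n) = go xs↘
  where
  go : ∀ {ys} → AllPairs (λ x y → ¬ x ⊑ y) ys →
    AllPairs (λ v w → ¬ Pointwise _⊑_ v w) (concatMap (λ x → map (x ∷_) (tuples xs n)) ys)
  go []                  = []
  go {y ∷ ys} (y↘ ∷ ys↘) = AllPairsP.++⁺
    (AllPairsP.map⁺ (AllPairs.map (λ v⋢w → λ { (_ ∷ v⊑w) → v⋢w v⊑w }) (AllPairs-tuples xs↘ n)))
    (go ys↘)
    (AllP.map⁺ (All.universal (λ v → AllP.concat⁺ (AllP.map⁺ (All.map (λ y⋢z → AllP.map⁺ (All.universal (λ w → λ { (y⊑z ∷ _) → y⋢z y⊑z }) (tuples xs n))) y↘))) (tuples xs n)))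

All-tuples : {P : A → Set} {xs : List A} → All P xs → ∀ n → All (VAll P) (tuples xs n)
All-tuples pxs zero    = [] ∷ []
All-tuples pxs (suc n) = AllP.concat⁺ (AllP.map⁺ (All.map (λ px → AllP.map⁺ (All.map (px ∷_) (All-tuples pxs n))) pxs))

-- Multichains of nonempty faces

module Multichains {n : ℕ} (Δ : Subset n → Bool) where

  open Interlacing (subB {n}) subB-refl (λ {a} {b} {c} → subB-trans {S = a} {b} {c}) public

  nonemptyFaces : List (Subset n)
  nonemptyFaces = select (λ S → Δ S ∧ nonemptyB S) (allSubsets n)

  open Sums nonemptyFaces public

  isChainB≡chainB : ∀ {r} (p : MultiChain n r) → isChainB p ≡ chainB p
  isChainB≡chainB []          = refl
  isChainB≡chainB (S ∷ [])    = refl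
  isChainB≡chainB (S ∷ T ∷ p) = cong (subB S T ∧_) (isChainB≡chainB (T ∷ p))

  adjacent≡precI : ∀ {r} (p q : MultiChain n r) → precI p q ≡ false → precI q q ≡ true → adjacent p q ≡ precI q p
  adjacent≡precI p q p⋠q q≼q with VecP.≡-dec (VecP.≡-dec BoolP._≟_) p q
  ... | yes refl = contradiction (trans (sym p⋠q) q≼q) λ ()
  ... | no _ rewrite p⋠q = refl

  ≼⇒Pointwise : ∀ {r} (p q : MultiChain n r) → p ≼ q → Pointwise _⊆_ p q
  ≼⇒Pointwise []      []      _                  = []
  ≼⇒Pointwise (S ∷ p) (T ∷ q) (S⊆T , _ , _ , p≼q) = subB⁻ {S = S} {T} S⊆T ∷ ≼⇒Pointwise p q p≼q

  module C {r : ℕ} = Cliques {MultiChain n r} adjacent precI adjacent≡precI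

  nonemptyFaces↘ : AllPairs (λ S T → ¬ S ⊆ T) nonemptyFaces
  nonemptyFaces↘ = AllPairsP.filter⁺ (λ S → (Δ S ∧ nonemptyB S) Bool.≟ true)
    (AllPairs.map incomparable (AllPairs-tuples (((λ t⇒f → contradiction (t⇒f refl) λ ()) ∷ []) ∷ [] ∷ []) n))
    where
    incomparable : {S T : Subset n} → ¬ Pointwise _⇒ᵇ_ S T → ¬ S ⊆ T
    incomparable {S} {T} S⋢T S⊆T = S⋢T (⊆⇒Pointwise S T S⊆T)

  multichains-≼ : ∀ r → All (λ p → p ≼ p) (multichains Δ r)
  multichains-≼ r = All.map (λ {p} e → chainB⁻ p (trans (sym (isChainB≡chainB p)) e))
    (AllP.all-filter (λ p → isChainB p Bool.≟ true) (tuples nonemptyFaces r))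

  multichains-⋠ : ∀ r → AllPairs (λ p q → ¬ p ≼ q) (multichains Δ r)
  multichains-⋠ r = AllPairsP.filter⁺ (λ p → isChainB p Bool.≟ true)
    (AllPairs.map (λ {p} {q} h p≼q → h (≼⇒Pointwise p q p≼q)) (AllPairs-tuples nonemptyFaces↘ r))

  multichains-Descending : ∀ r → C.Descending (multichains Δ r)
  multichains-Descending r = All.map interlaceB⁺ (multichains-≼ r) C.,
    AllPairs.map (λ p⋠q → BoolP.¬-not (p⋠q ∘ interlaceB⁻)) (multichains-⋠ r)

  -- The empty set serves as a lower bound that every entry satisfies; it is not a nonempty face,
  -- hence not itself an entry of the chains.
  weakChains≡up : ∀ r ℓ → C.weakChains (multichains Δ r) ℓ ≡ up (r ℕ.* ℓ) (λ _ → + 1) ⊥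
  weakChains≡up r ℓ = begin
    C.weakChains (multichains Δ r) ℓ
      ≡⟨ C.weakChains-select ℓ isChainB (tuples nonemptyFaces r) ⟩
    ∑ (tuples (tuples nonemptyFaces r) ℓ) (λ B → ⟦ allB isChainB (toList B) ∧ allPairsB precI (toList B) ⟧)
      ≡⟨ ∑-cong (tuples (tuples nonemptyFaces r) ℓ) (λ B → cong ⟦_⟧ (sym (trans
           (trans (cong (goodB (toList B) ∧_) (aboveB⁺ ⊥ (All.universal above-⊥ (toList B)))) (BoolP.∧-identityʳ _))
           (cong (_∧ allPairsB precI (toList B)) (sym (allB-chain (toList B))))))) ⟩
    matrices r ℓ ⊥
      ≡⟨ matrices≡up r ℓ ⊥ ⟩
    up (r ℕ.* ℓ) (λ _ → + 1) ⊥ ∎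
    where
    above-⊥ : ∀ {r} (p : MultiChain n r) → VAll (⊥ ⊑_) p
    above-⊥ []      = []
    above-⊥ (S ∷ p) = subB-⊥ S ∷ above-⊥ p
    allB-chain : (B : List (MultiChain n r)) → allB isChainB B ≡ allB chainB B
    allB-chain []      = refl
    allB-chain (p ∷ B) = cong₂ _∧_ (isChainB≡chainB p) (allB-chain B)

-- Evaluating the number of multichains by face numbers

module Faces {n : ℕ} (Δ : Subset n → Bool) (d : ℕ) (isSC : IsSimplicialComplex Δ) (hasDim : HasDim Δ d) where
  open IsSimplicialComplex isSC
  open HasDim hasDim
  open Multichains Δ

  facePolynomial : Seq
  facePolynomial N = ∑[ i < suc d ] (+ fΔ Δ i * (+ N) ^ i)

  -- All subsets of a face are faces, and the empty one may be included in the sum because its term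
  -- is 1 - 1. The binomial theorem then raises both bases by one. At the start 1 = 1 - 0ˢ needs s >
  -- 0.
  down-face : ∀ j S → Δ S ≡ true → ∣ S ∣ ≢ 0 → down j S ≡ (+ suc j) ^ ∣ S ∣ - (+ j) ^ ∣ S ∣
  down-face zero    S ΔS S≢∅ with ∣ S ∣
  ... | zero  = contradiction refl S≢∅
  ... | suc k = sym (trans (cong (_- (+ 0) ^ suc k) (ℤP.^-zeroˡ (suc k))) (cong (_-_ (+ 1)) (ℤP.*-zeroˡ ((+ 0) ^ k))))
  down-face (suc j) S ΔS S≢∅ = begin
    ∑ nonemptyFaces (λ T → ⟦ subB T S ⟧ * down j T)
      ≡⟨ ∑-select (λ T → Δ T ∧ nonemptyB T) (allSubsets n) _ ⟩
    ∑ (allSubsets n) (λ T → ⟦ Δ T ∧ nonemptyB T ⟧ * (⟦ subB T S ⟧ * down j T))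
      ≡⟨ ∑-cong (allSubsets n) (λ T → term T (subB T S) refl (nonemptyB T) refl) ⟩
    ∑ (allSubsets n) (λ T → ⟦ subB T S ⟧ * (+ suc j) ^ ∣ T ∣ + - (+ 1) * (⟦ subB T S ⟧ * (+ j) ^ ∣ T ∣))
      ≡⟨ trans (∑-+ (allSubsets n) _ _) (cong₂ _+_ (∑-subsets (+ suc j) S) (trans (∑-*ˡ (- (+ 1)) (allSubsets n) _) (cong (- (+ 1) *_) (∑-subsets (+ j) S)))) ⟩
    (+ suc (suc j)) ^ ∣ S ∣ + - (+ 1) * (+ suc j) ^ ∣ S ∣
      ≡⟨ minus ((+ suc (suc j)) ^ ∣ S ∣) ((+ suc j) ^ ∣ S ∣) ⟩
    (+ suc (suc j)) ^ ∣ S ∣ - (+ suc j) ^ ∣ S ∣ ∎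
    where
    minus : ∀ a b → a + - (+ 1) * b ≡ a - b
    minus = solve-∀
    vanish : ∀ a b c → a * (+ 0 * b) ≡ + 0 * c + - (+ 1) * (+ 0 * b)
    vanish = solve-∀
    one : ∀ a b → + 1 * (+ 1 * (a - b)) ≡ + 1 * a + - (+ 1) * (+ 1 * b)
    one = solve-∀
    zeros : ∀ a b → + 0 * a ≡ + 1 * b + - (+ 1) * (+ 1 * b)
    zeros = solve-∀
    term : ∀ T b → subB T S ≡ b → ∀ c → nonemptyB T ≡ c → ⟦ Δ T ∧ c ⟧ * (⟦ subB T S ⟧ * down j T)
      ≡ ⟦ subB T S ⟧ * (+ suc j) ^ ∣ T ∣ + - (+ 1) * (⟦ subB T S ⟧ * (+ j) ^ ∣ T ∣)
    term T false T⊈S c     _   rewrite T⊈S = trans (cong (⟦ Δ T ∧ c ⟧ *_) (trans (ℤP.*-zeroˡ (down j T)) (sym (ℤP.*-zeroˡ ((+ j) ^ ∣ T ∣)))))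
      (vanish ⟦ Δ T ∧ c ⟧ ((+ j) ^ ∣ T ∣) ((+ suc j) ^ ∣ T ∣))
    term T true  T⊆S true  T≢∅ rewrite T⊆S | downClosed S T (subB⁻ {S = T} {S} T⊆S) ΔS =
      trans (cong (λ z → + 1 * (+ 1 * z)) (down-face j T (downClosed S T (subB⁻ {S = T} {S} T⊆S) ΔS) (nonemptyB⁻ T T≢∅)))
        (one ((+ suc j) ^ ∣ T ∣) ((+ j) ^ ∣ T ∣))
    term T true  T⊆S false T≡∅ rewrite T⊆S | BoolP.∧-zeroʳ (Δ T) | nonemptyB-false⁻ T T≡∅ = zeros (+ 1 * down j T) (+ 1)

  ∑-by-size : ∀ (w : ℕ → ℤ) → ∑ (allSubsets n) (λ S → ⟦ Δ S ⟧ * w ∣ S ∣) ≡ ∑[ i < suc d ] (+ fΔ Δ i * w i)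
  ∑-by-size w = sym (begin
    ∑[ i < suc d ] (+ fΔ Δ i * w i)
      ≡⟨ ∑<-cong (suc d) (λ i → trans (cong (_* w i) (length-select _ (allSubsets n))) (sym (∑-*ʳ (w i) (allSubsets n) _))) ⟩
    ∑[ i < suc d ] ∑ (allSubsets n) (λ S → ⟦ Δ S ∧ ⌊ ∣ S ∣ ℕ.≟ i ⌋ ⟧ * w i)
      ≡⟨ sym (∑-∑< (allSubsets n) (suc d) _) ⟩
    ∑ (allSubsets n) (λ S → ∑[ i < suc d ] (⟦ Δ S ∧ ⌊ ∣ S ∣ ℕ.≟ i ⌋ ⟧ * w i))
      ≡⟨ ∑-cong (allSubsets n) (λ S → size S (Δ S) refl) ⟩
    ∑ (allSubsets n) (λ S → ⟦ Δ S ⟧ * w ∣ S ∣) ∎)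
    where
    size : ∀ S b → Δ S ≡ b → ∑[ i < suc d ] (⟦ b ∧ ⌊ ∣ S ∣ ℕ.≟ i ⌋ ⟧ * w i) ≡ ⟦ b ⟧ * w ∣ S ∣
    size S true  ΔS = trans (∑<-indicator (suc d) ∣ S ∣ w (s≤s (facesBound S ΔS))) (sym (ℤP.*-identityˡ _))
    size S false _  = trans (trans (∑<-cong (suc d) λ i → ℤP.*-zeroˡ (w i)) (∑<-zero (suc d))) (sym (ℤP.*-zeroˡ (w ∣ S ∣)))

  ∑-down : ∀ j → ∑ nonemptyFaces (down j) ≡ D facePolynomial (suc j)
  ∑-down j = begin
    ∑ nonemptyFaces (down j)
      ≡⟨ ∑-select (λ T → Δ T ∧ nonemptyB T) (allSubsets n) _ ⟩
    ∑ (allSubsets n) (λ S → ⟦ Δ S ∧ nonemptyB S ⟧ * down j S)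
      ≡⟨ ∑-cong (allSubsets n) (λ S → term S (Δ S) refl (nonemptyB S) refl) ⟩
    ∑ (allSubsets n) (λ S → ⟦ Δ S ⟧ * ((+ suc j) ^ ∣ S ∣ - (+ j) ^ ∣ S ∣))
      ≡⟨ ∑-by-size (λ i → (+ suc j) ^ i - (+ j) ^ i) ⟩
    ∑[ i < suc d ] (+ fΔ Δ i * ((+ suc j) ^ i - (+ j) ^ i))
      ≡⟨ trans (∑<-cong (suc d) λ i → distrib (+ fΔ Δ i) ((+ suc j) ^ i) ((+ j) ^ i)) (∑<-minus (suc d) _ _) ⟩
    D facePolynomial (suc j) ∎
    where
    distrib : ∀ a b c → a * (b - c) ≡ a * b - a * c
    distrib = solve-∀
    term : ∀ S b → Δ S ≡ b → ∀ c → nonemptyB S ≡ c → ⟦ b ∧ c ⟧ * down j S ≡ ⟦ b ⟧ * ((+ suc j) ^ ∣ S ∣ - (+ j) ^ ∣ S ∣)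
    term S false _  c     _   = trans (ℤP.*-zeroˡ (down j S)) (sym (ℤP.*-zeroˡ ((+ suc j) ^ ∣ S ∣ - (+ j) ^ ∣ S ∣)))
    term S true  ΔS true  S≢∅ = cong (+ 1 *_) (down-face j S ΔS (nonemptyB⁻ S S≢∅))
    term S true  ΔS false S≡∅ rewrite nonemptyB-false⁻ S S≡∅ = ℤP.*-zeroˡ (down j S)

  fΔ-0 : + fΔ Δ 0 ≡ + 1
  fΔ-0 = begin
    + fΔ Δ 0
      ≡⟨ length-select _ (allSubsets n) ⟩
    ∑ (allSubsets n) (λ S → ⟦ Δ S ∧ ⌊ ∣ S ∣ ℕ.≟ 0 ⌋ ⟧)
      ≡⟨ ∑-cong (allSubsets n) (λ S → ⟦∧⟧ (Δ S) _) ⟩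
    ∑ (allSubsets n) (λ S → ⟦ Δ S ⟧ * ⟦ ⌊ ∣ S ∣ ℕ.≟ 0 ⌋ ⟧)
      ≡⟨ ∑-size-0 n (λ S → ⟦ Δ S ⟧) ⟩
    ⟦ Δ ⊥ ⟧
      ≡⟨ cong ⟦_⟧ hasEmpty ⟩
    + 1 ∎

  -- At N = 0 there is just the empty chain, and `D` leaves F(0), the number of empty faces, since
  -- it takes F(-1) to be 0.
  up-⊥ : ∀ N → up N (λ _ → + 1) ⊥ ≡ D facePolynomial N
  up-⊥ zero    = sym (begin
    facePolynomial 0 - + 0
      ≡⟨ trans (ℤP.+-identityʳ _) (∑<-head d _) ⟩
    + fΔ Δ 0 * + 1 + ∑[ i < d ] (+ fΔ Δ (suc i) * (+ 0 * (+ 0) ^ i))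
      ≡⟨ cong₂ _+_ (trans (ℤP.*-identityʳ _) fΔ-0) (trans (∑<-cong d λ i → zeros (+ fΔ Δ (suc i)) ((+ 0) ^ i)) (∑<-zero d)) ⟩
    + 1 ∎)
    where
    zeros : ∀ a b → a * (+ 0 * b) ≡ + 0
    zeros = solve-∀
  up-⊥ (suc j) = begin
    ∑ nonemptyFaces (λ S → ⟦ subB ⊥ S ⟧ * up j (λ _ → + 1) S)
      ≡⟨ ∑-cong nonemptyFaces (λ S → trans (cong (λ b → ⟦ b ⟧ * up j (λ _ → + 1) S) (subB-⊥ S)) (ℤP.*-identityˡ _)) ⟩
    ∑ nonemptyFaces (up j (λ _ → + 1))
      ≡⟨ ∑-up≡∑-down j ⟩
    ∑ nonemptyFaces (down j)
      ≡⟨ ∑-down j ⟩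
    D facePolynomial (suc j) ∎

-- The dimension of 𝒞ʳ(Δ)

All-sublists : {P : A → Set} {xs : List A} → All P xs → All (All P) (sublists xs)
All-sublists []         = [] ∷ []
All-sublists (px ∷ pxs) = AllP.++⁺ (All-sublists pxs) (AllP.map⁺ (All.map (px ∷_) (All-sublists pxs)))

AllPairs-sublists : {R : A → A → Set} {xs : List A} → AllPairs R xs → All (AllPairs R) (sublists xs)
AllPairs-sublists []         = [] ∷ []
AllPairs-sublists (rx ∷ rxs) = AllP.++⁺ (AllPairs-sublists rxs)
  (AllP.map⁺ (All.zipWith (λ (r , rs) → r ∷ rs) (All-sublists rx , AllPairs-sublists rxs)))

allPairsB⁻ : (R : A → A → Bool) (xs : List A) → allPairsB R xs ≡ true → AllPairs (λ x y → R x y ≡ true) xs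
allPairsB⁻ R []       _ = []
allPairsB⁻ R (x ∷ xs) e = let rx , rxs = ∧-true⁻ {allB (R x) xs} e in allB⁻ (R x) xs rx ∷ allPairsB⁻ R xs rxs

allPairsB⁺ : (R : A → A → Bool) {xs : List A} → AllPairs (λ x y → R x y ≡ true) xs → allPairsB R xs ≡ true
allPairsB⁺ R []         = refl
allPairsB⁺ R (rx ∷ rxs) = ∧-true⁺ (allB⁺ (R _) rx) (allPairsB⁺ R rxs)

[]∈sublists : (xs : List A) → [] ∈ sublists xs
[]∈sublists []       = here refl
[]∈sublists (x ∷ xs) = ∈-++⁺ˡ ([]∈sublists xs)

-- `sublists` preserves the order, so `ys` must be listed as in `xs`. If its first entry `y` comes
-- after `x`, then `x` cannot occur in `ys` at all: entries of `ys` lie below `y`, and `x` does not.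
∈-sublists : {_≤_ : A → A → Set} → {xs ys : List A} →
  AllPairs (λ x y → ¬ x ≤ y) xs → AllPairs (λ x y → y ≤ x × x ≢ y) ys → All (_∈ xs) ys → ys ∈ sublists xs
∈-sublists {xs = xs} {[]}     _ _ _ = []∈sublists xs
∈-sublists {xs = x ∷ xs} {y ∷ ys} (x≰ ∷ xs↘) (y> ∷ ys↘) (here refl ∷ ys∈) =
  ∈-++⁺ʳ (sublists xs) (∈-map⁺ (x ∷_) (∈-sublists xs↘ ys↘ (All.zipWith tail∈ (y> , ys∈))))
  where
  tail∈ : ∀ {z} → (_ × x ≢ z) × z ∈ x ∷ xs → z ∈ xs
  tail∈ ((_ , x≢z) , here refl) = contradiction refl x≢z
  tail∈ (_         , there z∈)  = z∈
∈-sublists {_≤_ = _≤_} {xs = x ∷ xs} {y ∷ ys} (x≰ ∷ xs↘) (y> ∷ ys↘) (there y∈ ∷ ys∈) =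
  ∈-++⁺ˡ (∈-sublists xs↘ (y> ∷ ys↘) (y∈ ∷ All.zipWith tail∈ (y> , ys∈)))
  where
  tail∈ : ∀ {z} → (z ≤ y × y ≢ z) × z ∈ x ∷ xs → z ∈ xs
  tail∈ ((z≤y , _) , here refl) = contradiction z≤y (All.lookup x≰ y∈)
  tail∈ (_         , there z∈)  = z∈

length≤maxLength : {c : List A} {cs : List (List A)} → c ∈ cs → length c ≤ maxLength cs
length≤maxLength {c = c} {_ ∷ cs} (here refl) = ℕP.m≤m⊔n (length c) (maxLength cs)
length≤maxLength {cs = c ∷ cs} (there c∈)     = ℕP.≤-trans (length≤maxLength c∈) (ℕP.m≤n⊔m (length c) (maxLength cs))

maxLength≤ : ∀ {d} {cs : List (List A)} → All (λ c → length c ≤ d) cs → maxLength cs ≤ d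
maxLength≤ []         = z≤n
maxLength≤ (c≤ ∷ cs≤) = ℕP.⊔-lub c≤ (maxLength≤ cs≤)

⊆⇒<⊎≡ : ∀ {n} (S T : Subset n) → S ⊆ T → ∣ S ∣ < ∣ T ∣ ⊎ S ≡ T
⊆⇒<⊎≡ []            []            _   = inj₂ refl
⊆⇒<⊎≡ (inside ∷ S)  (outside ∷ T) S⊆T = contradiction (S⊆T Vec.here) λ ()
⊆⇒<⊎≡ (outside ∷ S) (inside ∷ T)  S⊆T = inj₁ (s≤s (SubsetP.p⊆q⇒∣p∣≤∣q∣ {p = S} {T} (SubsetP.drop-∷-⊆ S⊆T)))
⊆⇒<⊎≡ (inside ∷ S)  (inside ∷ T)  S⊆T with ⊆⇒<⊎≡ S T (SubsetP.drop-∷-⊆ S⊆T)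
... | inj₁ S<T = inj₁ (s≤s S<T)
... | inj₂ S≡T = inj₂ (cong (inside ∷_) S≡T)
⊆⇒<⊎≡ (outside ∷ S) (outside ∷ T) S⊆T with ⊆⇒<⊎≡ S T (SubsetP.drop-∷-⊆ S⊆T)
... | inj₁ S<T = inj₁ S<T
... | inj₂ S≡T = inj₂ (cong (outside ∷_) S≡T)

-- Interlacing implies inclusion entry by entry, so this number increases strictly from one vertex
-- of a clique to the next.
totalSize : ∀ {n r} → MultiChain n r → ℕ
totalSize []      = 0
totalSize (S ∷ p) = ∣ S ∣ ℕ.+ totalSize p

Pointwise-⊆⇒<⊎≡ : ∀ {n r} {p q : MultiChain n r} → Pointwise _⊆_ p q → totalSize p < totalSize q ⊎ p ≡ q
Pointwise-⊆⇒<⊎≡ [] = inj₂ refl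
Pointwise-⊆⇒<⊎≡ (_∷_ {x = S} {y = T} S⊆T p⊆q) with ⊆⇒<⊎≡ S T S⊆T | Pointwise-⊆⇒<⊎≡ p⊆q
... | inj₁ S<T | inj₁ p<q  = inj₁ (ℕP.+-mono-< S<T p<q)
... | inj₁ S<T | inj₂ refl = inj₁ (ℕP.+-monoˡ-< _ S<T)
... | inj₂ refl | inj₁ p<q = inj₁ (ℕP.+-monoʳ-< ∣ S ∣ p<q)
... | inj₂ refl | inj₂ refl = inj₂ refl

-- A complete flag of nonempty subsets of S, from S downwards.
flag : ∀ {n} → Subset n → List (Subset n)
flag []            = []
flag (outside ∷ S) = map (outside ∷_) (flag S)
flag (inside ∷ S)  = (inside ∷ S) ∷ map (outside ∷_) (flag S)

length-flag : ∀ {n} (S : Subset n) → length (flag S) ≡ ∣ S ∣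
length-flag []            = refl
length-flag (outside ∷ S) = trans (length-map (outside ∷_) (flag S)) (length-flag S)
length-flag (inside ∷ S)  = cong suc (trans (length-map (outside ∷_) (flag S)) (length-flag S))

flag-⊆ : ∀ {n} (S : Subset n) → All (λ T → subB T S ≡ true × ∣ T ∣ ≢ 0) (flag S)
flag-⊆ []            = []
flag-⊆ (outside ∷ S) = AllP.map⁺ (All.map (λ {T} (T⊆S , T≢∅) → trans (subB-out T outside S) T⊆S , T≢∅) (flag-⊆ S))
flag-⊆ (inside ∷ S)  = (subB-refl (inside ∷ S) , λ ()) ∷
  AllP.map⁺ (All.map (λ {T} (T⊆S , T≢∅) → trans (subB-out T inside S) T⊆S , T≢∅) (flag-⊆ S))

flag-↘ : ∀ {n} (S : Subset n) → AllPairs (λ T U → subB U T ≡ true × T ≢ U) (flag S)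
flag-↘ []            = []
flag-↘ (outside ∷ S) = AllPairsP.map⁺ (AllPairs.map (λ {T} {U} (U⊆T , T≢U) → trans (subB-out U outside T) U⊆T , λ { refl → T≢U refl }) (flag-↘ S))
flag-↘ (inside ∷ S)  = AllP.map⁺ (All.map (λ {T} (T⊆S , _) → trans (subB-out T inside S) T⊆S , λ ()) (flag-⊆ S)) ∷
  AllPairsP.map⁺ (AllPairs.map (λ {T} {U} (U⊆T , T≢U) → trans (subB-out U outside T) U⊆T , λ { refl → T≢U refl }) (flag-↘ S))

∈-select : {p : A → Bool} {x : A} {xs : List A} → x ∈ xs → p x ≡ true → x ∈ select p xs
∈-select {p = p} = ∈-filter⁺ (λ x → p x Bool.≟ true)

∈-tuples : {xs : List A} {r : ℕ} {v : Vec A r} → VAll (_∈ xs) v → v ∈ tuples xs r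
∈-tuples []                = here refl
∈-tuples {xs = xs} {suc r} {x ∷ v} (x∈ ∷ v∈) = ∈-concatMap⁺ _ (Any.map (λ { refl → ∈-map⁺ (x ∷_) (∈-tuples v∈) }) x∈)

∈-allSubsets : ∀ {n} (S : Subset n) → S ∈ allSubsets n
∈-allSubsets S = ∈-tuples (VAll.universal bit S)
  where
  bit : ∀ b → b ∈ inside ∷ outside ∷ []
  bit inside  = here refl
  bit outside = there (here refl)

module Dimension {n : ℕ} (Δ : Subset n → Bool) (d r : ℕ) (isSC : IsSimplicialComplex Δ) (hasDim : HasDim Δ d) where
  open IsSimplicialComplex isSC
  open HasDim hasDim
  open Multichains Δ

  private
    M = multichains Δ (suc r)
    Vertex = MultiChain n (suc r)

    Bounded : Subset n → Set
    Bounded S = ∣ S ∣ ≤ d × ∣ S ∣ ≢ 0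

    bounded : All (VAll Bounded) M
    bounded = AllP.filter⁺ (λ p → isChainB p Bool.≟ true) (All-tuples (All.map
      (λ {S} e → let ΔS , S≢∅ = ∧-true⁻ {Δ S} e in facesBound S ΔS , nonemptyB⁻ S S≢∅)
      (AllP.all-filter (λ S → (Δ S ∧ nonemptyB S) Bool.≟ true) (allSubsets n))) (suc r))

    -- If p ≼ q then q_t ⊆ p_{t+1}, so the sum of the |q_t| − |p_t| telescopes.
    totalSize-≼ : ∀ {k} (p q : MultiChain n (suc k)) → p ≼ q → VAll Bounded q →
      totalSize q ℕ.+ ∣ Vec.head p ∣ ≤ totalSize p ℕ.+ d
    totalSize-≼ (S ∷ []) (T ∷ []) _ ((T≤d , _) ∷ []) rewrite ℕP.+-identityʳ ∣ T ∣ | ℕP.+-identityʳ ∣ S ∣ | ℕP.+-comm ∣ T ∣ ∣ S ∣ =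
      ℕP.+-monoʳ-≤ ∣ S ∣ T≤d
    totalSize-≼ (S ∷ S′ ∷ p) (T ∷ q@(_ ∷ _)) (_ , T⊆S′ ∷ _ , _ , p≼q) (_ ∷ bq) =
      ℕP.≤-trans (ℕP.≤-reflexive (trans (ℕP.+-comm _ ∣ S ∣) (cong (∣ S ∣ ℕ.+_) (ℕP.+-comm ∣ T ∣ (totalSize q)))))
        (ℕP.≤-trans (ℕP.+-monoʳ-≤ ∣ S ∣ (ℕP.≤-trans (ℕP.+-monoʳ-≤ (totalSize q) T≤S′) (totalSize-≼ (S′ ∷ p) q p≼q bq)))
          (ℕP.≤-reflexive (sym (ℕP.+-assoc ∣ S ∣ _ d))))
      where
      T≤S′ : ∣ T ∣ ≤ ∣ S′ ∣
      T≤S′ = SubsetP.p⊆q⇒∣p∣≤∣q∣ {p = T} {S′} (subB⁻ {S = T} {S′} T⊆S′)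

    totalSize-< : ∀ {p q : Vertex} → p ≼ q → ¬ q ≼ p → totalSize p < totalSize q
    totalSize-< {p} {q} p≼q q⋠p with Pointwise-⊆⇒<⊎≡ (≼⇒Pointwise p q p≼q)
    ... | inj₁ p<q  = p<q
    ... | inj₂ refl = contradiction p≼q q⋠p

    -- Each step down the list lowers `totalSize` by at least one; `z` is the last entry.
    minimum : ∀ p c → AllPairs (λ p q → q ≼ p × ¬ p ≼ q) (p ∷ c) →
      ∃ λ (z : Vertex) → z ∈ p ∷ c × length c ℕ.+ totalSize z ≤ totalSize p
    minimum p []      _                      = p , here refl , ℕP.≤-refl
    minimum p (q ∷ c) (((q≼p , p⋠q) ∷ _) ∷ h) =
      let z , z∈ , le = minimum q c h in z , there z∈ , ℕP.≤-trans (s≤s le) (totalSize-< q≼p p⋠q)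

    -- The total sizes of the greatest entry `p` and the least entry `z` differ by at most d minus
    -- the size of the first set of `z`, hence by at most d - 1 as this set is nonempty. That
    -- `z ≼ p` is part of the hypothesis on all pairs.
    chain-length : ∀ c → AllPairs (λ p q → q ≼ p × ¬ p ≼ q) c → All (λ p → p ≼ p) c → All (VAll Bounded) c → length c ≤ d
    chain-length []      _         _         _         = z≤n
    chain-length (p ∷ c) h@(p> ∷ _) (p≼p ∷ _) b@(bp ∷ _) = finish (minimum p c h)
      where
      finish : (∃ λ (z : Vertex) → z ∈ p ∷ c × length c ℕ.+ totalSize z ≤ totalSize p) → suc (length c) ≤ d
      finish (z , z∈ , le) = ℕP.+-cancelʳ-≤ (totalSize z) _ _ (ℕP.≤-trans (s≤s le)
        (ℕP.≤-trans (subst (_≤ totalSize p ℕ.+ ∣ Vec.head z ∣) (ℕP.+-comm (totalSize p) 1)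
            (ℕP.+-monoʳ-≤ (totalSize p) (ℕP.n≢0⇒n>0 (head-nonempty z (All.lookup b z∈)))))
          (ℕP.≤-trans (totalSize-≼ z p (z≼p z∈) bp) (ℕP.≤-reflexive (ℕP.+-comm (totalSize z) d)))))
        where
        head-nonempty : ∀ z → VAll Bounded z → ∣ Vec.head z ∣ ≢ 0
        head-nonempty (_ ∷ _) ((_ , ≢0) ∷ _) = ≢0
        z≼p : ∀ {z} → z ∈ p ∷ c → z ≼ p
        z≼p (here refl) = p≼p
        z≼p (there z∈c) = proj₁ (All.lookup p> z∈c)

  clique-length : All (λ c → allPairsB adjacent c ≡ true → length c ≤ d) (sublists M)
  clique-length = All.zipWith bound (All.zip (All-sublists (multichains-≼ (suc r)) , All-sublists bounded) , AllPairs-sublists (multichains-⋠ (suc r)))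
    where
    chain : ∀ {c} → All (λ p → p ≼ p) c → AllPairs (λ p q → ¬ p ≼ q) c → AllPairs (λ p q → adjacent p q ≡ true) c →
      AllPairs (λ p q → q ≼ p × ¬ p ≼ q) c
    chain []            []         []         = []
    chain {p ∷ c} (_ ∷ rs) (p⋠ ∷ h) (adj ∷ adjs) =
      All.zipWith (λ {q} ((q≼q , p⋠q) , e) → interlaceB⁻ (trans (sym (adjacent≡precI p q (BoolP.¬-not (p⋠q ∘ interlaceB⁻)) (interlaceB⁺ q≼q))) e) , p⋠q)
        (All.zip (rs , p⋠) , adj) ∷ chain rs h adjs
    bound : ∀ {c} → (All (λ p → p ≼ p) c × All (VAll Bounded) c) × AllPairs (λ p q → ¬ p ≼ q) c → allPairsB adjacent c ≡ true → length c ≤ d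
    bound {c} ((rs , bs) , h) e = chain-length c (chain rs h (allPairsB⁻ adjacent c e)) rs bs

  private
    S₀ = proj₁ faceOfSize
    ΔS₀ = proj₁ (proj₂ faceOfSize)
    ∣S₀∣ = proj₂ (proj₂ faceOfSize)

    constant : ∀ k → MultiChain n k
    constant k = Vec.replicate k S₀

    -- A clique of the greatest size: only the first set varies, through a complete flag of a face
    -- with d elements, and all other sets equal that face.
    flagClique : List Vertex
    flagClique = map (_∷ constant r) (flag S₀)

    VAll-constant : {P : Subset n → Set} → P S₀ → ∀ k → VAll P (constant k)
    VAll-constant px zero    = []
    VAll-constant px (suc k) = px ∷ VAll-constant px k

    constant-≼ : ∀ k → constant k ≼ constant k
    constant-≼ zero    = tt
    constant-≼ (suc k) = subB-refl S₀ , VAll-constant (subB-refl S₀) k , VAll-constant (subB-refl S₀) k , constant-≼ k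

    vertex-≼ : ∀ {T U} → subB U T ≡ true → subB T S₀ ≡ true → subB U S₀ ≡ true → (U ∷ constant r) ≼ (T ∷ constant r)
    vertex-≼ U⊆T T⊆S U⊆S = U⊆T , VAll-constant T⊆S r , VAll-constant U⊆S r , constant-≼ r

    vertex∈M : ∀ {T} → subB T S₀ ≡ true × ∣ T ∣ ≢ 0 → (T ∷ constant r) ∈ M
    vertex∈M {T} (T⊆S , T≢∅) = ∈-select {p = isChainB} (∈-tuples (face∈ T T⊆S T≢∅ ∷ VAll-constant (face∈ S₀ (subB-refl S₀) S₀≢∅) r))
      (trans (isChainB≡chainB (T ∷ constant r)) (chainB⁺ (T ∷ constant r) (vertex-≼ (subB-refl T) T⊆S T⊆S)))
      where
      nonempty : ∀ T → ∣ T ∣ ≢ 0 → nonemptyB T ≡ true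
      nonempty T T≢∅ = cong not (⌊⌋-no (∣ T ∣ ℕ.≟ 0) T≢∅)
      face∈ : ∀ T → subB T S₀ ≡ true → ∣ T ∣ ≢ 0 → T ∈ nonemptyFaces
      face∈ T T⊆S T≢∅ = ∈-select {p = λ S → Δ S ∧ nonemptyB S} (∈-allSubsets T)
        (∧-true⁺ (downClosed S₀ T (subB⁻ {S = T} {S₀} T⊆S) ΔS₀) (nonempty T T≢∅))
      S₀≢∅ : ∣ S₀ ∣ ≢ 0
      S₀≢∅ S≡∅ = T≢∅ (ℕP.n≤0⇒n≡0 (subst (∣ T ∣ ≤_) S≡∅ (SubsetP.p⊆q⇒∣p∣≤∣q∣ {p = T} {S₀} (subB⁻ {S = T} {S₀} T⊆S))))

    flag-pairs : AllPairs (λ T U → (U ∷ constant r) ≼ (T ∷ constant r) × T ≢ U) (flag S₀)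
    flag-pairs = go (flag-⊆ S₀) (flag-↘ S₀)
      where
      go : ∀ {Ts} → All (λ T → subB T S₀ ≡ true × ∣ T ∣ ≢ 0) Ts → AllPairs (λ T U → subB U T ≡ true × T ≢ U) Ts →
        AllPairs (λ T U → (U ∷ constant r) ≼ (T ∷ constant r) × T ≢ U) Ts
      go []               []        = []
      go ((T⊆S , _) ∷ bs) (T> ∷ Ts) = All.zipWith (λ ((U⊆T , T≢U) , (U⊆S , _)) → vertex-≼ U⊆T T⊆S U⊆S , T≢U) (T> , bs) ∷ go bs Ts

    flagClique-↘ : AllPairs (λ p q → q ≼ p × p ≢ q) flagClique
    flagClique-↘ = AllPairsP.map⁺ (AllPairs.map (λ (U≼T , T≢U) → U≼T , λ { refl → T≢U refl }) flag-pairs)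

    flagClique∈M : All (_∈ M) flagClique
    flagClique∈M = AllP.map⁺ (All.map vertex∈M (flag-⊆ S₀))

    flagClique-adjacent : allPairsB adjacent flagClique ≡ true
    flagClique-adjacent = allPairsB⁺ adjacent (AllPairs.map (λ {p} {q} (q≼p , p≢q) → adjacent-≼ p q q≼p p≢q) flagClique-↘)
      where
      adjacent-≼ : ∀ p q → q ≼ p → p ≢ q → adjacent p q ≡ true
      adjacent-≼ p q q≼p p≢q with VecP.≡-dec (VecP.≡-dec BoolP._≟_) p q
      ... | yes p≡q = contradiction p≡q p≢q
      ... | no _    = trans (cong (precI p q ∨_) (interlaceB⁺ q≼p)) (BoolP.∨-zeroʳ (precI p q))

  dimC+1≡d : dimC+1 Δ (suc r) ≡ d
  dimC+1≡d = ℕP.≤-antisym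
    (maxLength≤ (All.zipWith (λ (f , e) → f e) (AllP.filter⁺ clique? clique-length , AllP.all-filter clique? (sublists M))))
    (subst (_≤ dimC+1 Δ (suc r)) (trans (length-map (_∷ constant r) (flag S₀)) (trans (length-flag S₀) ∣S₀∣))
      (length≤maxLength (∈-select {p = allPairsB adjacent} (∈-sublists (multichains-⋠ (suc r)) flagClique-↘ flagClique∈M) flagClique-adjacent)))
    where
    clique? : ∀ c → Dec (allPairsB adjacent c ≡ true)
    clique? c = allPairsB adjacent c Bool.≟ true

theorem4p5 : (n : ℕ) (Δ : Subset n → Bool) (d : ℕ) (r : ℕ) →
    IsSimplicialComplex Δ → HasDim Δ d → 1 ≤ r →
    (m : ℕ) → m ≤ d →
    hC Δ r m ≡ sumTo _+_ (+ 0) d (λ k → + (A0 r (suc d) (suc k) m) * hΔ Δ d k)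
theorem4p5 n Δ d r@(suc r′) isSC hasDim 0<r m _ = begin
  hVec (fC Δ r) (dimC+1 Δ r) m
    ≡⟨ cong (λ e → hVec (fC Δ r) e m) dimC+1≡d ⟩
  hVec (fC Δ r) d m
    ≡⟨ hVec≡D^ (fC Δ r) d m ⟩
  D^ d (λ ℓ → ∑[ k < suc d ] (+ fC Δ r k * compositions k ℓ)) m
    ≡⟨ D^-cong d (λ ℓ → trans (hilbert ℓ) (up≡∑ ℓ)) m ⟩
  D^ d (λ ℓ → ∑[ k < suc d ] (hΔ Δ d k * wt d 0 (d ℕ.∸ k) ℓ)) m
    ≡⟨ D^-∑< d (suc d) (λ k ℓ → hΔ Δ d k * wt d 0 (d ℕ.∸ k) ℓ) m ⟩
  ∑[ k < suc d ] D^ d (λ ℓ → hΔ Δ d k * wt d 0 (d ℕ.∸ k) ℓ) m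
    ≡⟨ ∑<-cong-< (suc d) (λ k k≤d → trans (D^-* d (hΔ Δ d k) (wt d 0 (d ℕ.∸ k)) m)
         (trans (cong (hΔ Δ d k *_) (sym (A0≡D^ d k m 0<r (ℕ.s≤s⁻¹ k≤d)))) (ℤP.*-comm (hΔ Δ d k) _))) ⟩
  ∑[ k < suc d ] (+ (A0 r (suc d) (suc k) m) * hΔ Δ d k)
    ≡⟨ sym (sumTo≡∑< d _) ⟩
  sumTo _+_ (+ 0) d (λ k → + (A0 r (suc d) (suc k) m) * hΔ Δ d k) ∎
  where
  open Multichains Δ
  open Faces Δ d isSC hasDim
  open Dimension Δ d r′ isSC hasDim
  open Transfer r
  open ColouredPermutations r
  M = multichains Δ r
  K = length M
  fC≡cliques : ∀ k → + fC Δ r k ≡ C.cliques M k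
  fC≡cliques k = trans (length-select (λ c → ⌊ length c ℕ.≟ k ⌋) (faces-C Δ r)) (∑-select (allPairsB adjacent) (sublists M) _)
  -- Weak chains are expressed by cliques of every size up to the number `K` of vertices, the
  -- h-vector only by those of size at most d. The limit `d + K` covers both, and the terms beyond d
  -- vanish.
  no-cliques : ∀ k → d < k → C.cliques M k ≡ + 0
  no-cliques k d<k = trans (∑-cong-All clique-length λ c bound → vanish c (allPairsB adjacent c) refl bound) (∑-zero (sublists M))
    where
    vanish : ∀ c b → allPairsB adjacent c ≡ b → (b ≡ true → length c ≤ d) → ⟦ b ⟧ * ⟦ ⌊ length c ℕ.≟ k ⌋ ⟧ ≡ + 0
    vanish c false _ _     = ℤP.*-zeroˡ ⟦ ⌊ length c ℕ.≟ k ⌋ ⟧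
    vanish c true  _ bound = cong (λ b → + 1 * ⟦ b ⟧) (⌊⌋-no (length c ℕ.≟ k) (ℕP.<⇒≢ (ℕP.≤-<-trans (bound refl) d<k)))
  hilbert : ∀ ℓ → ∑[ k < suc d ] (+ fC Δ r k * compositions k ℓ) ≡ up (r ℕ.* ℓ) (λ _ → + 1) ⊥
  hilbert ℓ = begin
    ∑[ k < suc d ] (+ fC Δ r k * compositions k ℓ)
      ≡⟨ ∑<-cong (suc d) (λ k → cong (_* compositions k ℓ) (fC≡cliques k)) ⟩
    ∑[ k < suc d ] (C.cliques M k * compositions k ℓ)
      ≡⟨ sym (ℤP.+-identityʳ _) ⟩
    ∑[ k < suc d ] (C.cliques M k * compositions k ℓ) + + 0
      ≡⟨ cong (_+_ (∑[ k < suc d ] (C.cliques M k * compositions k ℓ))) (sym (trans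
           (∑<-cong K λ i → trans (cong (_* compositions (suc d ℕ.+ i) ℓ) (no-cliques (suc d ℕ.+ i) (ℕP.m≤m+n (suc d) i))) (ℤP.*-zeroˡ (compositions (suc d ℕ.+ i) ℓ)))
           (∑<-zero K))) ⟩
    ∑[ k < suc d ] (C.cliques M k * compositions k ℓ) + ∑[ i < K ] (C.cliques M (suc d ℕ.+ i) * compositions (suc d ℕ.+ i) ℓ)
      ≡⟨ sym (∑<-split (suc d) K (λ k → C.cliques M k * compositions k ℓ)) ⟩
    ∑[ k < suc (d ℕ.+ K) ] (C.cliques M k * compositions k ℓ)
      ≡⟨ C.∑-cliques≡weakChains (d ℕ.+ K) M ℓ (multichains-Descending r) (ℕP.m≤n+m K d) ⟩
    C.weakChains M ℓ
      ≡⟨ weakChains≡up r ℓ ⟩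
    up (r ℕ.* ℓ) (λ _ → + 1) ⊥ ∎
  up≡∑ : ∀ ℓ → up (r ℕ.* ℓ) (λ _ → + 1) ⊥ ≡ ∑[ k < suc d ] (hΔ Δ d k * wt d 0 (d ℕ.∸ k) ℓ)
  up≡∑ ℓ = begin
    up (r ℕ.* ℓ) (λ _ → + 1) ⊥
      -- The added 0 is the colour of the last letter in `wt d 0`.
      ≡⟨ cong (λ N → up N (λ _ → + 1) ⊥) (trans (ℕP.*-comm r ℓ) (sym (ℕP.+-identityʳ (ℓ ℕ.* r)))) ⟩
    up (ℓ ℕ.* r ℕ.+ 0) (λ _ → + 1) ⊥
      ≡⟨ up-⊥ (ℓ ℕ.* r ℕ.+ 0) ⟩
    D facePolynomial (ℓ ℕ.* r ℕ.+ 0)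
      ≡⟨ sym (∑-hVec-DQ (fΔ Δ) d (ℓ ℕ.* r ℕ.+ 0)) ⟩
    ∑[ k < suc d ] (hΔ Δ d k * wt d 0 (d ℕ.∸ k) ℓ) ∎
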